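{- There is a polynomial-time algorithm which, given a forest $F$ and a positive number $t$, computes $Ldyn_t(F)$.
   Context: A threshold assignment is a function $\tau:V(F)\to\{0,1,2,\dots\}$ with $\tau(v)\le deg_F(v)$ for every $v$; $\overline{\tau}=\sum_v\tau(v)/|V(F)|$. A set $D\subseteq V(F)$ is a $\tau$-dynamo if $V(F)$ can be partitioned into $D_0=D,D_1,\dots,D_k$ such that for each $1\le i\le k$, $D_i$ consists of all vertices not in $D_0\cup\dots\cup D_{i-1}$ having at least $\tau(v)$ neighbors in $D_0\cup\dots\cup D_{i-1}$; $dyn_\tau(F)$ is the minimum size of a $\tau$-dynamo. $Ldyn_t(F)=\max\{dyn_\tau(F):\overline{\tau}\le t\}$. -}

module Defs where

open import Data.Bool using (Bool; true; false; T; if_then_else_)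
open import Data.Fin using (Fin)
open import Data.Fin.Subset using (Subset; _∈_; _∉_; _∩_; _∪_; ⊥; ∣_∣)
open import Data.Integer using (+_)
open import Data.List using (List; []; _∷_; _∷ʳ_; length; map; allFin)
open import Data.List.Relation.Unary.Linked using (Linked)
open import Data.List.Relation.Unary.Unique.Propositional using (Unique)
open import Data.Nat using (ℕ; zero; suc; _+_; _*_; _^_; _≤_; _≡ᵇ_; NonZero)
open import Data.Nat.Binary using (ℕᵇ; 2[1+_]; 1+[2_])
import Data.Nat.Binary as Bin
open import Data.Product using (Σ-syntax; ∃; ∃-syntax; _×_)
open import Data.Rational using (ℚ; _/_; Positive; ↧ₙ_; ↥_)
import Data.Integer as ℤ
import Data.Rational as ℚ
open import Data.Vec using (tabulate; sum)
open import Function using (_⇔_)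
open import Relation.Binary.PropositionalEquality using (_≡_)
open import Relation.Nullary using (¬_)

record Graph (n : ℕ) : Set where
  field
    adj         : Fin n → Fin n → Bool
    symmetric   : ∀ u v → adj u v ≡ adj v u
    irreflexive : ∀ v → adj v v ≡ false

  Adj : Fin n → Fin n → Set
  Adj u v = T (adj u v)

  neighbours : Fin n → Subset n
  neighbours v = tabulate (adj v)

  deg : Fin n → ℕ
  deg v = ∣ neighbours v ∣

open Graph public

record Cycle {n : ℕ} (G : Graph n) : Set where
  field
    first    : Fin n
    rest     : List (Fin n)
    distinct : Unique (first ∷ rest)
    long     : 2 ≤ length rest
    linked   : Linked (Adj G) (first ∷ rest ∷ʳ first)

IsForest : ∀ {n} → Graph n → Set
IsForest G = ¬ Cycle G

IsThreshold : ∀ {n} → Graph n → (Fin n → ℕ) → Set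
IsThreshold G τ = ∀ v → τ v ≤ deg G v

average : ∀ {n} .{{_ : NonZero n}} → (Fin n → ℕ) → ℚ
average {n} τ = (+ sum (tabulate τ)) / n

-- before D i = D 0 ∪ … ∪ D (i − 1)
before : ∀ {n} → (ℕ → Subset n) → ℕ → Subset n
before D zero    = ⊥
before D (suc i) = before D i ∪ D i

-- Only D 0, …, D k matter.  They are pairwise disjoint because the rule
-- puts into D i only vertices outside before D i; parts may be empty.
IsDynamo : ∀ {n} → Graph n → (Fin n → ℕ) → Subset n → Set
IsDynamo {n} G τ D₀ =
  Σ[ k ∈ ℕ ] Σ[ D ∈ (ℕ → Subset n) ]
    D 0 ≡ D₀ ×
    (∀ i → 1 ≤ i → i ≤ k → ∀ v →
       v ∈ D i ⇔ (v ∉ before D i × τ v ≤ ∣ neighbours G v ∩ before D i ∣)) ×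
    (∀ v → v ∈ before D (suc k))

IsMinimum : (ℕ → Set) → ℕ → Set
IsMinimum P m = P m × (∀ k → P k → m ≤ k)

IsMaximum : (ℕ → Set) → ℕ → Set
IsMaximum P m = P m × (∀ k → P k → k ≤ m)

IsDyn : ∀ {n} → Graph n → (Fin n → ℕ) → ℕ → Set
IsDyn G τ = IsMinimum λ k → ∃[ D ] IsDynamo G τ D × ∣ D ∣ ≡ k

IsLdyn : ∀ {n} .{{_ : NonZero n}} → Graph n → ℚ → ℕ → Set
IsLdyn G t = IsMaximum λ k →
  ∃[ τ ] IsThreshold G τ × average τ ℚ.≤ t × IsDyn G τ k

-- Model of computation: the language WHILE of N. D. Jones,
-- "Computability and Complexity" (MIT Press, 1997), with its unit-cost
-- time measure.  Data are binary trees over the single atom nil.  Its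
-- class of polynomial-time functions on encodings is that of Turing
-- machines: cons only copies pointers, so trees can be stored with sharing.

data Tree : Set where
  nil  : Tree
  cons : Tree → Tree → Tree

size : Tree → ℕ
size nil        = 1
size (cons a b) = 1 + size a + size b

head tail : Tree → Tree
head nil        = nil
head (cons a _) = a
tail nil        = nil
tail (cons _ b) = b

data Expr : Set where
  var   : ℕ → Expr
  nil   : Expr
  cons  : Expr → Expr → Expr
  hd tl : Expr → Expr

infix  6 _:=_
infixr 5 _⨾_

data Command : Set where
  _:=_     : ℕ → Expr → Command
  _⨾_      : Command → Command → Command
  while_loop_ : Expr → Command → Command

Store : Set
Store = ℕ → Tree

_[_↦_] : Store → ℕ → Tree → Store
(σ [ x ↦ a ]) y = if y ≡ᵇ x then a else σ y

eval : Expr → Store → Tree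
eval (var x)    σ = σ x
eval nil        σ = nil
eval (cons e f) σ = cons (eval e σ) (eval f σ)
eval (hd e)     σ = head (eval e σ)
eval (tl e)     σ = tail (eval e σ)

cost : Expr → ℕ
cost (var _)    = 1
cost nil        = 1
cost (cons e f) = 1 + cost e + cost f
cost (hd e)     = 1 + cost e
cost (tl e)     = 1 + cost e

-- ⟨ C , σ ⟩⇓ σ′ in-time s : started in σ, the command C halts in σ′ after
-- time s.  A loop runs as long as its guard is not nil.
infix 4 ⟨_,_⟩⇓_in-time_

data ⟨_,_⟩⇓_in-time_ : Command → Store → Store → ℕ → Set where
  assign : ∀ {x e σ} →
    ⟨ x := e , σ ⟩⇓ σ [ x ↦ eval e σ ] in-time (1 + cost e)
  seq : ∀ {C D σ σ′ σ″ s s′} →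
    ⟨ C , σ ⟩⇓ σ′ in-time s →
    ⟨ D , σ′ ⟩⇓ σ″ in-time s′ →
    ⟨ C ⨾ D , σ ⟩⇓ σ″ in-time (1 + s + s′)
  while-stop : ∀ {e C σ} →
    eval e σ ≡ nil →
    ⟨ while e loop C , σ ⟩⇓ σ in-time (1 + cost e)
  while-step : ∀ {e C σ σ′ σ″ a b s s′} →
    eval e σ ≡ cons a b →
    ⟨ C , σ ⟩⇓ σ′ in-time s →
    ⟨ while e loop C , σ′ ⟩⇓ σ″ in-time s′ →
    ⟨ while e loop C , σ ⟩⇓ σ″ in-time (1 + cost e + s + s′)

-- Variable 0 serves for both input and output; all others start as nil.
initial : Tree → Store
initial a = (λ _ → nil) [ 0 ↦ a ]

Outputs : Command → Tree → Tree → ℕ → Set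
Outputs C a b s = ∃[ σ ] ⟨ C , initial a ⟩⇓ σ in-time s × σ 0 ≡ b

-- R x y reads "y is a correct answer on the instance x".  The bound
-- c · size ^ d covers all polynomials since size is at least 1.
PolyTimeComputable : ∀ {I O : Set} →
  (I → Tree) → (O → Tree) → (I → O → Set) → Set
PolyTimeComputable {I} {O} encodeI encodeO R =
  Σ[ C ∈ Command ] Σ[ c ∈ ℕ ] Σ[ d ∈ ℕ ]
    ∀ (x : I) → Σ[ y ∈ O ] R x y × Σ[ s ∈ ℕ ]
      Outputs C (encodeI x) (encodeO y) s × s ≤ c * size (encodeI x) ^ d

encodeBool : Bool → Tree
encodeBool false = nil
encodeBool true  = cons nil nil

encodeList : List Tree → Tree
encodeList []       = nil
encodeList (a ∷ as) = cons a (encodeList as)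

-- Bijective base 2, least significant digit first: nil stands for the
-- digit 1 and cons nil nil for the digit 2.
encodeℕᵇ : ℕᵇ → Tree
encodeℕᵇ ℕᵇ.zero  = nil
encodeℕᵇ 1+[2 b ] = cons (encodeBool false) (encodeℕᵇ b)
encodeℕᵇ 2[1+ b ] = cons (encodeBool true) (encodeℕᵇ b)

encodeℕ : ℕ → Tree
encodeℕ m = encodeℕᵇ (Bin.fromℕ m)

-- The adjacency matrix, row by row.
encodeGraph : ∀ {n} → Graph n → Tree
encodeGraph {n} G =
  encodeList (map (λ u → encodeList (map (λ v → encodeBool (adj G u v)) (allFin n)))
                  (allFin n))

-- Numerator and denominator in lowest terms; used for positive t only, so
-- the absolute value loses nothing.
encodeℚ : ℚ → Tree
encodeℚ t = cons (encodeℕ ℤ.∣ ↥ t ∣) (encodeℕ (↧ₙ t))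

record Instance : Set where
  field
    order          : ℕ
    {{nonEmpty}}   : NonZero order
    forest         : Graph order
    isForest       : IsForest forest
    bound          : ℚ
    bound-positive : Positive bound

encodeInstance : Instance → Tree
encodeInstance x = cons (encodeGraph forest) (encodeℚ bound)
  where open Instance x

IsLdynOf : Instance → ℕ → Set
IsLdynOf x = IsLdyn forest bound
  where open Instance x

{-# OPTIONS --safe #-}

-- In a forest, Ldyn_t is the largest k such that some matching M with k edges
-- has Σ deg ≤ t n over the vertices that it covers.  Given M, put τ = deg on
-- these vertices and τ = 0 elsewhere: a τ-dynamo has to contain an end of each
-- edge of M, as otherwise its two ends would wait for each other.  Conversely,
-- for any τ a greedy dynamo D, chosen upwards from the leaves, comes with a
-- matching with |D| edges and degree sum at most Σ τ: a vertex v enters D only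
-- if it would stay inactive even after its parent, and then the thresholds of
-- v and of the descendants that wait for v pay for an edge below v.
--
-- The cheapest matching of each size is found by eliminating vertices of degree
-- at most 1, with (min,+)-convolutions of tables of unary numbers; the bound
-- c q ≤ n p for t = p / q in binary is tested digit by digit with unary carries.
-- The program is written in a typed language whose only loops run over parts
-- of the input, so that each of its terms compiles to polynomial time.

module Submission where

open import Data.Bool using (Bool; true; false; if_then_else_; T; not; _∧_)
open import Data.Fin using (Fin; zero; suc)
import Data.Fin.Properties as Fin
open import Data.Fin.Subset using (Subset; _∈_; _∉_; _⊆_; _∩_; _∪_; ⁅_⁆; ∣_∣) renaming (⊥ to ∅)
open import Data.Fin.Subset.Properties using (_∈?_; p⊆p∪q; q⊆p∪q; x∈p∪q⁻; x∈p∩q⁺; p⊆q⇒∣p∣≤∣q∣; ∉⊥; ∣⊥∣≡0; ∣⁅x⁆∣≡1; ∣p∣≤n; x∈⁅x⁆; p∩q⊆p)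
import Data.Integer as ℤ
import Data.Integer.Properties as ℤ
open import Data.List using (List; []; _∷_; _++_; _∷ʳ_; map; length; allFin; [_]; foldl; foldr) renaming (tabulate to tabulateˡ)
open import Data.List.Membership.Propositional using () renaming (_∈_ to _∈ˡ_)
open import Data.List.Properties using (length-tabulate; map-++; length-++; length-map; reverse-foldl; length-reverse; map-∘; map-cong; ++-assoc)
open import Data.List.Relation.Unary.All as All using (All; []; _∷_; lookup)
import Data.List.Relation.Unary.All.Properties as All
open import Data.List.Relation.Unary.AllPairs using ([]; _∷_)
open import Data.List.Relation.Unary.Any as Any using (Any; here; there)
open import Data.List.Relation.Unary.Linked using (Linked; []; [-]; _∷_)
open import Data.List.Relation.Unary.Unique.Propositional using (Unique)
open import Data.Nat
open import Data.Nat.Binary using (2[1+_]; 1+[2_])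
import Data.Nat.Binary as Bin
import Data.Nat.Binary.Properties as Bin
open import Data.Nat.Properties
open import Data.Nat.Tactic.RingSolver using (solve-∀)
open import Data.Product using (_×_; _,_; proj₁; proj₂; Σ-syntax; ∃-syntax; ∃₂; uncurry)
open import Data.Rational using (ℚ; mkℚ; Positive; ↥_; ↧ₙ_)
import Data.Rational as ℚ
import Data.Rational.Properties as ℚ
import Data.Rational.Unnormalised as ℚᵘ
import Data.Rational.Unnormalised.Properties as ℚᵘ
open import Data.Sum using (_⊎_; inj₁; inj₂)
open import Data.Unit using (⊤)
import Data.Vec as Vec
import Data.Vec.Properties as Vec
open import Function using (_∘_; id; mk⇔; _⇔_; Equivalence)
open import Relation.Binary.PropositionalEquality hiding ([_])
open import Relation.Nullary using (¬_; yes; no; does; contradiction)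

open import Defs

-- A first-order language for polynomial time

-- The two directions of the characterisation differ in kind: a matching yields one threshold all of
-- whose dynamos are large, while the greedy construction yields one small dynamo for each
-- threshold. They meet for an affordable matching of maximal size. The cost model charges the same
-- for `cons` whatever the size of its arguments. With loop lengths fixed by the input, the running
-- time of a term is therefore bounded without regard to the values that it handles. The price is
-- paid in the correctness proof: every fold makes the same number N = (4 + n)^3 of rounds and is
-- right only on lists and numbers of size at most N. This is why the sizes of tables and carries
-- are bounded throughout. Costs of matchings are at most 2 n n, so unary numbers suffice for them;
-- p and q may be exponential in the size of the input and never become unary. Disjointness and
-- covering of vertex sets are expressed by comparing sums of an arbitrary function f over the
-- vertices. Disjoint unions then turn into additions, and indicator functions in place of f give
-- the combinatorial facts back.

data Ty : Set where
  bool nat : Ty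
  list     : Ty → Ty
  _⊗_      : Ty → Ty → Ty

infixr 6 _⊗_

Val : Ty → Set
Val bool     = Bool
Val nat      = ℕ
Val (list A) = List (Val A)
Val (A ⊗ B)  = Val A × Val B

encodeUnary : ℕ → Tree
encodeUnary zero    = nil
encodeUnary (suc k) = cons nil (encodeUnary k)

enc : ∀ A → Val A → Tree
enc bool     b       = encodeBool b
enc nat      k       = encodeUnary k
enc (list A) xs      = encodeList (map (enc A) xs)
enc (A ⊗ B)  (x , y) = cons (enc A x) (enc B y)

Ctx : Set
Ctx = List Ty

Env : Ctx → Set
Env = All Val

data Constant : Ty → Set where
  falseᶜ trueᶜ : Constant bool
  zeroᶜ        : Constant nat
  nilᶜ         : ∀ {A} → Constant (list A)

data Unary : Ty → Ty → Set where
  sucᶜ : Unary nat nat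
  fstᶜ : ∀ {A B} → Unary (A ⊗ B) A
  sndᶜ : ∀ {A B} → Unary (A ⊗ B) B

data Binary : Ty → Ty → Ty → Set where
  pairᶜ : ∀ {A B} → Binary A B (A ⊗ B)
  consᶜ : ∀ {A} → Binary A (list A) (list A)

⟦_⟧⁰ : ∀ {A} → Constant A → Val A
⟦ falseᶜ ⟧⁰ = false
⟦ trueᶜ ⟧⁰  = true
⟦ zeroᶜ ⟧⁰  = 0
⟦ nilᶜ ⟧⁰   = []

⟦_⟧¹ : ∀ {A B} → Unary A B → Val A → Val B
⟦ sucᶜ ⟧¹ = suc
⟦ fstᶜ ⟧¹ = proj₁
⟦ sndᶜ ⟧¹ = proj₂

⟦_⟧² : ∀ {A B C} → Binary A B C → Val A → Val B → Val C
⟦ pairᶜ ⟧² = _,_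
⟦ consᶜ ⟧² = _∷_

infix 4 _⊑_

-- Order-preserving embeddings are themselves part of the syntax through `ren`, so no renaming of
-- terms has to be defined and proved correct. At run time they are free, as the compiler merely
-- composes them with the map of stack positions.
data _⊑_ : Ctx → Ctx → Set where
  same : ∀ {Γ} → Γ ⊑ Γ
  drop : ∀ {Γ Δ A} → Γ ⊑ Δ → Γ ⊑ A ∷ Δ
  keep : ∀ {Γ Δ A} → Γ ⊑ Δ → A ∷ Γ ⊑ A ∷ Δ

rename : ∀ {Γ Δ A} → Γ ⊑ Δ → A ∈ˡ Γ → A ∈ˡ Δ
rename same     x         = x
rename (drop θ) x         = there (rename θ x)
rename (keep θ) (here e)  = here e
rename (keep θ) (there x) = there (rename θ x)

restrict : ∀ {Γ Δ} → Γ ⊑ Δ → Env Δ → Env Γ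
restrict same     γ       = γ
restrict (drop θ) (x ∷ γ) = restrict θ γ
restrict (keep θ) (x ∷ γ) = x ∷ restrict θ γ

lookup-restrict : ∀ {Γ Δ A} (θ : Γ ⊑ Δ) (γ : Env Δ) (x : A ∈ˡ Γ) →
  lookup (restrict θ γ) x ≡ lookup γ (rename θ x)
lookup-restrict same     γ       x           = refl
lookup-restrict (drop θ) (_ ∷ γ) x           = lookup-restrict θ γ x
lookup-restrict (keep θ) (_ ∷ γ) (here refl) = refl
lookup-restrict (keep θ) (_ ∷ γ) (there x)   = lookup-restrict θ γ x

-- The only loop runs once per entry of a list that is part of the input
-- (lengthened by four entries in the case of the rows); this makes every
-- term polynomial.
data Clock : Set where
  rows numerator denominator : Clock

data Tm (Γ : Ctx) : Ty → Set where
  var      : ∀ {A} → A ∈ˡ Γ → Tm Γ A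
  ren      : ∀ {Δ A} → Δ ⊑ Γ → Tm Δ A → Tm Γ A
  const    : ∀ {A} → Constant A → Tm Γ A
  unary    : ∀ {A B} → Unary A B → Tm Γ A → Tm Γ B
  binary   : ∀ {A B C} → Binary A B C → Tm Γ A → Tm Γ B → Tm Γ C
  bind     : ∀ {A B} → Tm Γ A → Tm (A ∷ Γ) B → Tm Γ B
  branch   : ∀ {A} → Tm Γ bool → Tm Γ A → Tm Γ A → Tm Γ A
  caseNat  : ∀ {A} → Tm Γ nat → Tm Γ A → Tm (nat ∷ Γ) A → Tm Γ A
  caseList : ∀ {A B} → Tm Γ (list B) → Tm Γ A → Tm (B ∷ list B ∷ Γ) A → Tm Γ A
  rep      : ∀ {A} → Clock → Tm Γ A → Tm (A ∷ Γ) A → Tm Γ A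

iter : ∀ {A : Set} → ℕ → (A → A) → A → A
iter zero    f x = x
iter (suc k) f x = iter k f (f x)

iter-+ : ∀ {A : Set} i j (f : A → A) x → iter (i + j) f x ≡ iter j f (iter i f x)
iter-+ zero    j f x = refl
iter-+ (suc i) j f x = iter-+ i j f (f x)

elimNat : ∀ {A : Set} → A → (ℕ → A) → ℕ → A
elimNat z s zero    = z
elimNat z s (suc k) = s k

elimList : ∀ {A B : Set} → A → (B → List B → A) → List B → A
elimList n c []       = n
elimList n c (x ∷ xs) = c x xs

module Semantics (ticks : Clock → ℕ) where

  ⟦_⟧ : ∀ {Γ A} → Tm Γ A → Env Γ → Val A
  ⟦ var x ⟧          γ = lookup γ x
  ⟦ ren θ t ⟧        γ = ⟦ t ⟧ (restrict θ γ)
  ⟦ const c ⟧        γ = ⟦ c ⟧⁰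
  ⟦ unary o t ⟧      γ = ⟦ o ⟧¹ (⟦ t ⟧ γ)
  ⟦ binary o t u ⟧   γ = ⟦ o ⟧² (⟦ t ⟧ γ) (⟦ u ⟧ γ)
  ⟦ bind t u ⟧       γ = ⟦ u ⟧ (⟦ t ⟧ γ ∷ γ)
  ⟦ branch t u v ⟧   γ = if ⟦ t ⟧ γ then ⟦ u ⟧ γ else ⟦ v ⟧ γ
  ⟦ caseNat t u v ⟧  γ = elimNat (⟦ u ⟧ γ) (λ k → ⟦ v ⟧ (k ∷ γ)) (⟦ t ⟧ γ)
  ⟦ caseList t u v ⟧ γ =
    elimList (⟦ u ⟧ γ) (λ x xs → ⟦ v ⟧ (x ∷ xs ∷ γ)) (⟦ t ⟧ γ)
  ⟦ rep κ t u ⟧      γ = iter (ticks κ) (λ x → ⟦ u ⟧ (x ∷ γ)) (⟦ t ⟧ γ)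

-- Compilation to WHILE

data Poly : Set where
  #_      : ℕ → Poly
  X       : Poly
  _⊞_ _⊠_ : Poly → Poly → Poly

infixl 6 _⊞_
infixl 7 _⊠_
infix  8 #_

_at_ : Poly → ℕ → ℕ
(# k)   at n = k
X       at n = n
(p ⊞ q) at n = p at n + q at n
(p ⊠ q) at n = p at n * q at n

-- For a sum the degrees are added rather than maximised: this exceeds both, and for positive n a
-- larger exponent only weakens the bound.
coefficient degree : Poly → ℕ
coefficient (# k)   = k
coefficient X       = 1
coefficient (p ⊞ q) = coefficient p + coefficient q
coefficient (p ⊠ q) = coefficient p * coefficient q
degree (# k)   = 0
degree X       = 1
degree (p ⊞ q) = degree p + degree q
degree (p ⊠ q) = degree p + degree q

at-≤-monomial : ∀ p n .{{_ : NonZero n}} → p at n ≤ coefficient p * n ^ degree p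
at-≤-monomial (# k)   n = ≤-reflexive (sym (*-identityʳ k))
at-≤-monomial X       n =
  ≤-reflexive (sym (trans (+-identityʳ (n * 1)) (*-identityʳ n)))
at-≤-monomial (p ⊞ q) n = begin
  p at n + q at n
    ≤⟨ +-mono-≤ (at-≤-monomial p n) (at-≤-monomial q n) ⟩
  coefficient p * n ^ degree p + coefficient q * n ^ degree q
    ≤⟨ +-mono-≤ (*-monoʳ-≤ (coefficient p) (^-monoʳ-≤ n (m≤m+n (degree p) (degree q))))
                (*-monoʳ-≤ (coefficient q) (^-monoʳ-≤ n (m≤n+m (degree q) (degree p)))) ⟩
  coefficient p * n ^ (degree p + degree q) + coefficient q * n ^ (degree p + degree q)
    ≡⟨ *-distribʳ-+ (n ^ (degree p + degree q)) (coefficient p) (coefficient q) ⟨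
  (coefficient p + coefficient q) * n ^ (degree p + degree q) ∎
  where open ≤-Reasoning
at-≤-monomial (p ⊠ q) n = begin
  p at n * q at n
    ≤⟨ *-mono-≤ (at-≤-monomial p n) (at-≤-monomial q n) ⟩
  (coefficient p * n ^ degree p) * (coefficient q * n ^ degree q)
    ≡⟨ [m*n]*[o*p]≡[m*o]*[n*p] (coefficient p) _ (coefficient q) _ ⟩
  (coefficient p * coefficient q) * (n ^ degree p * n ^ degree q)
    ≡⟨ cong (coefficient p * coefficient q *_) (^-distribˡ-+-* n (degree p) (degree q)) ⟨
  (coefficient p * coefficient q) * n ^ (degree p + degree q) ∎
  where open ≤-Reasoning

-- A Hoare triple with total correctness and a time bound, for a fixed initial store. Composition
-- passes on only the postcondition, so intermediate stores are never named.
record Exec (C : Command) (σ : Store) (b : ℕ) (Q : Store → Set) : Set where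
  constructor exec
  field
    {final} : Store
    {time}  : ℕ
    run     : ⟨ C , σ ⟩⇓ final in-time time
    fast    : time ≤ b
    post    : Q final

module _ {Q : Store → Set} where

  exec-≤ : ∀ {C σ b b′} → b ≤ b′ → Exec C σ b Q → Exec C σ b′ Q
  exec-≤ le (exec r f p) = exec r (≤-trans f le) p

  exec-assign : ∀ {x e σ} → Q (σ [ x ↦ eval e σ ]) → Exec (x := e) σ (1 + cost e) Q
  exec-assign p = exec assign ≤-refl p

  exec-seq : ∀ {C D σ b b′} {P : Store → Set} → Exec C σ b P →
    (∀ {σ′} → P σ′ → Exec D σ′ b′ Q) → Exec (C ⨾ D) σ (1 + b + b′) Q
  exec-seq (exec r f p) k with k p
  ... | exec r′ f′ p′ = exec (seq r r′) (s≤s (+-mono-≤ f f′)) p′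

  exec-stop : ∀ {e C σ} → eval e σ ≡ nil → Q σ →
    Exec (while e loop C) σ (1 + cost e) Q
  exec-stop eq p = exec (while-stop eq) ≤-refl p

  exec-step : ∀ {e C σ a a′ b b′} {P : Store → Set} → eval e σ ≡ cons a a′ →
    Exec C σ b P → (∀ {σ′} → P σ′ → Exec (while e loop C) σ′ b′ Q) →
    Exec (while e loop C) σ (1 + cost e + b + b′) Q
  exec-step {e} eq (exec r f p) k with k p
  ... | exec r′ f′ p′ =
    exec (while-step eq r r′) (+-mono-≤ (+-monoʳ-≤ (1 + cost e) f) f′) p′

slot : ℕ → Expr → Expr
slot zero    e = hd e
slot (suc i) e = slot i (tl e)

nth : ℕ → Tree → Tree
nth zero    s = head s
nth (suc i) s = nth i (tail s)

eval-slot : ∀ i e σ → eval (slot i e) σ ≡ nth i (eval e σ)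
eval-slot zero    e σ = refl
eval-slot (suc i) e σ = eval-slot i (tl e) σ

spine : Tree → ℕ
spine nil        = 0
spine (cons _ a) = suc (spine a)

spine≤size : ∀ a → spine a ≤ size a
spine≤size nil        = z≤n
spine≤size (cons a b) = s≤s (≤-trans (spine≤size b) (m≤n+m (size b) (size a)))

size-head : ∀ a → size (head a) ≤ size a
size-head nil        = ≤-refl
size-head (cons a b) = ≤-trans (m≤m+n (size a) (size b)) (n≤1+n _)

size-tail : ∀ a → size (tail a) ≤ size a
size-tail nil        = ≤-refl
size-tail (cons a b) = ≤-trans (m≤n+m (size b) (size a)) (n≤1+n _)

-- The four additional ticks make (4 + n)^3 exceed, coefficient by coefficient, every bound that the
-- folds will need.
clockTree : Clock → Tree → Tree
clockTree rows        ι = cons nil (cons nil (cons nil (cons nil (head ι))))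
clockTree numerator   ι = head (tail ι)
clockTree denominator ι = tail (tail ι)

ticksOf : Tree → Clock → ℕ
ticksOf ι κ = spine (clockTree κ ι)

clock : Clock → Expr
clock rows        = cons nil (cons nil (cons nil (cons nil (hd (var 2)))))
clock numerator   = hd (tl (var 2))
clock denominator = tl (tl (var 2))

eval-clock : ∀ κ σ → eval (clock κ) σ ≡ clockTree κ (σ 2)
eval-clock rows        σ = refl
eval-clock numerator   σ = refl
eval-clock denominator σ = refl

spine-clockTree : ∀ κ ι → spine (clockTree κ ι) ≤ 4 + size ι
spine-clockTree rows        ι = +-monoʳ-≤ 4 (≤-trans (spine≤size _) (size-head ι))
spine-clockTree numerator   ι = ≤-trans (spine≤size (head (tail ι)))
  (≤-trans (size-head (tail ι)) (≤-trans (size-tail ι) (m≤n+m _ 4)))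
spine-clockTree denominator ι = ≤-trans (spine≤size (tail (tail ι)))
  (≤-trans (size-tail (tail ι)) (≤-trans (size-tail ι) (m≤n+m _ 4)))

-- Variable 0 holds the value just computed, variable 1 a stack with the
-- values of the variables in scope and the loop counters, variable 2 the
-- input; variables 3 and 4 are flags for case distinctions.
module _ (ι : Tree) where

  record Holds (s a : Tree) (σ : Store) : Set where
    constructor holds
    field
      result : σ 0 ≡ a
      stack  : σ 1 ≡ s
      input  : σ 2 ≡ ι

  Computes : Command → Tree → Tree → ℕ → Set
  Computes C s a b = ∀ {σ} → σ 1 ≡ s → σ 2 ≡ ι → Exec C σ b (Holds s a)

simpleCode : Expr → Command
simpleCode e = 0 := e

thenCode : Command → Expr → Command
thenCode C e = C ⨾ 0 := e

bindCode : Command → Command → Command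
bindCode C D = C ⨾ 1 := cons (var 0) (var 1) ⨾ D ⨾ 1 := tl (var 1)

pairCode : Command → Command → Command
pairCode C D =
  C ⨾ 1 := cons (var 0) (var 1) ⨾ D ⨾ 0 := cons (hd (var 1)) (var 0) ⨾ 1 := tl (var 1)

-- WHILE has no conditional, so each branch is a loop that clears its own guard. The first branch
-- always receives head and tail of the tested value, which serves booleans, numbers and lists
-- alike. The flags are cleared after `D` because distinctions inside `D` overwrite them.
branchCode : Command → Command → Command → Command
branchCode C D E =
  C ⨾ 3 := var 0 ⨾ 4 := cons nil nil ⨾
  (while var 3 loop
     (1 := cons (hd (var 0)) (cons (tl (var 0)) (var 1)) ⨾ D ⨾
      1 := tl (tl (var 1)) ⨾ 3 := nil ⨾ 4 := nil)) ⨾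
  (while var 4 loop (E ⨾ 4 := nil))

-- Between rounds the counter is on top of the stack; during a round the current value lies above
-- it. The last assignment drops that value and shortens the counter.
loopCode : Command → Command
loopCode D = while hd (var 1) loop
  (1 := cons (var 0) (var 1) ⨾ D ⨾
   1 := cons (tl (hd (tl (var 1)))) (tl (tl (var 1))))

repCode : Clock → Command → Command → Command
repCode κ C D = C ⨾ 1 := cons (clock κ) (var 1) ⨾ loopCode D ⨾ 1 := tl (var 1)

-- These sums are left unsimplified so that they agree by computation both with what the rules for
-- `Exec` produce and with the values of `bindPoly`, `pairPoly` and their companions.
bindTime pairTime : ℕ → ℕ → ℕ
bindTime b b′ = 1 + b + (1 + 4 + (1 + b′ + 3))
pairTime b b′ = 1 + b + (1 + 4 + (1 + b′ + (1 + 5 + 3)))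

branchTime : ℕ → ℕ → ℕ → ℕ
branchTime b b′ b″ =
  1 + b + (1 + 2 + (1 + 4 + (1 + (2 + (1 + 8 + (1 + b′ + (1 + 4 + (1 + 2 + 2)))) + 2)
                               + (2 + (1 + b″ + 2) + 2))))

repTime : ℕ → ℕ → ℕ → ℕ
repTime k b b′ = 1 + b + (1 + 13 + (1 + (3 + k * (3 + (1 + 4 + (1 + b′ + 9)))) + 3))

module _ {ι : Tree} where

  computes-simple : ∀ {e s a} → (∀ {σ} → σ 1 ≡ s → eval e σ ≡ a) →
    Computes ι (simpleCode e) s a (1 + cost e)
  computes-simple h σ1 σ2 = exec-assign (holds (h σ1) σ1 σ2)

  computes-then : ∀ {C s a a′ b e} → Computes ι C s a b →
    (∀ {σ} → σ 0 ≡ a → eval e σ ≡ a′) →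
    Computes ι (thenCode C e) s a′ (1 + b + (1 + cost e))
  computes-then c h σ1 σ2 = exec-seq (c σ1 σ2) λ (holds r st i) →
    exec-assign (holds (h r) st i)

  computes-bind : ∀ {C D s a a′ b b′} → Computes ι C s a b →
    Computes ι D (cons a s) a′ b′ →
    Computes ι (bindCode C D) s a′ (bindTime b b′)
  computes-bind c d σ1 σ2 =
    exec-seq (c σ1 σ2) λ (holds r st i) →
    exec-seq (exec-assign {Q = λ σ → σ 1 ≡ _ × σ 2 ≡ ι} (cong₂ cons r st , i)) λ (st , i) →
    exec-seq (d st i) λ (holds r st i) →
    exec-assign (holds r (cong tail st) i)

  computes-pair : ∀ {C D s a a′ b b′} → Computes ι C s a b →
    Computes ι D (cons a s) a′ b′ →
    Computes ι (pairCode C D) s (cons a a′) (pairTime b b′)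
  computes-pair c d σ1 σ2 =
    exec-seq (c σ1 σ2) λ (holds r st i) →
    exec-seq (exec-assign {Q = λ σ → σ 1 ≡ _ × σ 2 ≡ ι} (cong₂ cons r st , i)) λ (st , i) →
    exec-seq (d st i) λ (holds r st i) →
    exec-seq (exec-assign {Q = Holds ι _ _} (holds (cong₂ cons (cong head st) r) st i))
      λ (holds r st i) → exec-assign (holds r (cong tail st) i)

  computes-branch-nil : ∀ {C D E s a b b″} b′ → Computes ι C s nil b →
    Computes ι E s a b″ →
    Computes ι (branchCode C D E) s a (branchTime b b′ b″)
  computes-branch-nil {s = s} {b″ = b″} b′ c e σ1 σ2 =
    exec-seq (c σ1 σ2) λ (holds r st i) →
    exec-seq (exec-assign {Q = λ σ → σ 1 ≡ s × σ 2 ≡ ι × σ 3 ≡ nil} (st , i , r))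
      λ (st , i , g) →
    exec-seq (exec-assign {Q = λ σ → σ 1 ≡ s × σ 2 ≡ ι × σ 3 ≡ nil × σ 4 ≡ cons nil nil}
                (st , i , g , refl)) λ (st , i , g , f) →
    exec-seq (exec-≤ (m≤n+m 2 (2 + (1 + 8 + (1 + b′ + (1 + 4 + (1 + 2 + 2)))))) (exec-stop {Q = λ σ → σ 1 ≡ s × σ 2 ≡ ι × σ 4 ≡ cons nil nil}
                g (st , i , f))) λ (st , i , f) →
    exec-step f (exec-seq (e st i) λ (holds r st i) →
      exec-assign {Q = λ σ → Holds ι _ _ σ × σ 4 ≡ nil} (holds r st i , refl))
      λ (h , f) → exec-stop f h

  computes-branch-cons : ∀ {C D E s x y a b b′} b″ → Computes ι C s (cons x y) b →
    Computes ι D (cons x (cons y s)) a b′ →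
    Computes ι (branchCode C D E) s a (branchTime b b′ b″)
  computes-branch-cons {s = s} {x} {y} {a} {b′ = b′} b″ c d σ1 σ2 =
    exec-seq (c σ1 σ2) λ (holds r st i) →
    exec-seq (exec-assign {Q = λ σ → Holds ι s (cons x y) σ × σ 3 ≡ cons x y}
                (holds r st i , r)) λ (holds r st i , g) →
    exec-seq (exec-assign {Q = λ σ → Holds ι s (cons x y) σ × σ 3 ≡ cons x y}
                (holds r st i , g)) λ (holds r st i , g) →
    exec-seq
      (exec-step {Q = λ σ → Holds ι s a σ × σ 4 ≡ nil} g
        (exec-seq (exec-assign {Q = λ σ → σ 1 ≡ cons x (cons y s) × σ 2 ≡ ι}
          (cong₂ cons (cong head r) (cong₂ cons (cong tail r) st) , i)) λ (st , i) →
        exec-seq (d st i) λ (holds r st i) →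
        exec-seq (exec-assign {Q = Holds ι s a} (holds r (cong (λ t → tail (tail t)) st) i))
          λ (holds r st i) →
        exec-seq (exec-assign {Q = λ σ → Holds ι s a σ × σ 3 ≡ nil} (holds r st i , refl))
          λ (holds r st i , g) →
        exec-assign {Q = λ σ → Holds ι s a σ × σ 3 ≡ nil × σ 4 ≡ nil}
          (holds r st i , g , refl))
        λ (h , g , f) → exec-stop g (h , f))
      λ (h , f) → exec-≤ (m≤n+m 2 (2 + (1 + b″ + 2))) (exec-stop f h)

  exec-loop : ∀ {A : Set} (encode : A → Tree) (f : A → A) {D s b} →
    (∀ t x → Computes ι D (cons (encode x) (cons t s)) (encode (f x)) b) →
    ∀ t x {σ} → Holds ι (cons t s) (encode x) σ →
    Exec (loopCode D) σ (3 + spine t * (3 + (1 + 4 + (1 + b + 9))))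
      (λ σ → Σ[ t′ ∈ Tree ] Holds ι (cons t′ s) (encode (iter (spine t) f x)) σ)
  exec-loop encode f d nil x (holds r st i) = exec-stop (cong head st) (nil , holds r st i)
  exec-loop encode f {D} {s} {b} d (cons h t) x (holds r st i) = exec-≤ (≤-reflexive bound)
    (exec-step (cong head st)
      (exec-seq (exec-assign {Q = λ σ → σ 1 ≡ _ × σ 2 ≡ ι} (cong₂ cons r st , i)) λ (st , i) →
       exec-seq (d (cons h t) x st i) λ (holds r st i) →
       exec-assign {Q = Holds ι (cons t s) (encode (f x))}
         (holds r (cong (λ u → cons (tail (head (tail u))) (tail (tail u))) st) i))
      (exec-loop encode f d t (f x)))
    where
    bound : 3 + (1 + 4 + (1 + b + 9)) + (3 + spine t * (3 + (1 + 4 + (1 + b + 9)))) ≡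
      3 + (3 + (1 + 4 + (1 + b + 9)) + spine t * (3 + (1 + 4 + (1 + b + 9))))
    bound = begin
      B + (3 + R) ≡⟨ +-assoc B 3 R ⟨
      B + 3 + R   ≡⟨ cong (_+ R) (+-comm B 3) ⟩
      3 + B + R ∎
      where
      open ≡-Reasoning
      B = 3 + (1 + 4 + (1 + b + 9))
      R = spine t * B

  computes-rep : ∀ {A : Set} (encode : A → Tree) (f : A → A) {C D s x b b′} κ →
    Computes ι C s (encode x) b →
    (∀ t x → Computes ι D (cons (encode x) (cons t s)) (encode (f x)) b′) →
    Computes ι (repCode κ C D) s (encode (iter (spine (clockTree κ ι)) f x))
      (repTime (4 + size ι) b b′)
  computes-rep encode f {s = s} {x = x} {b′ = b′} κ c d σ1 σ2 =
    exec-seq (c σ1 σ2) λ (holds r st i) →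
    exec-seq (exec-≤ (cost-clock κ) (exec-assign {Q = Holds ι (cons (clockTree κ ι) s) (encode x)}
      (holds r (cong₂ cons (trans (eval-clock κ _) (cong (clockTree κ) i)) st) i))) λ h →
    exec-seq (exec-≤ (+-monoʳ-≤ 3 (*-monoˡ-≤ (3 + (1 + 4 + (1 + b′ + 9))) (spine-clockTree κ ι)))
      (exec-loop encode f d (clockTree κ ι) x h)) λ (_ , holds r st i) →
    exec-assign (holds r (cong tail st) i)
    where
    cost-clock : ∀ κ → 1 + cost (cons (clock κ) (var 1)) ≤ 13
    cost-clock rows        = ≤-refl
    cost-clock numerator   = m≤m+n 6 7
    cost-clock denominator = m≤m+n 6 7

-- Positions on the stack are not de Bruijn indices: the stack also holds loop counters, finished
-- first components of pairs, and parts of a tested value that no variable names.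
Loc : Ctx → Set
Loc Γ = ∀ {A} → A ∈ˡ Γ → ℕ

_▸_ : ∀ {Γ A} → ℕ → Loc Γ → Loc (A ∷ Γ)
(i ▸ ρ) (here _)  = i
(i ▸ ρ) (there x) = ρ x

shift : ∀ {Γ} → ℕ → Loc Γ → Loc Γ
shift k ρ x = k + ρ x

constantExpr : ∀ {A} → Constant A → Expr
constantExpr trueᶜ = cons nil nil
constantExpr _     = nil

unaryExpr : ∀ {A B} → Unary A B → Expr
unaryExpr sucᶜ = cons nil (var 0)
unaryExpr fstᶜ = hd (var 0)
unaryExpr sndᶜ = tl (var 0)

eval-constantExpr : ∀ {A} (o : Constant A) σ → eval (constantExpr o) σ ≡ enc A ⟦ o ⟧⁰
eval-constantExpr falseᶜ σ = refl
eval-constantExpr trueᶜ  σ = refl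
eval-constantExpr zeroᶜ  σ = refl
eval-constantExpr nilᶜ   σ = refl

eval-unaryExpr : ∀ {A B} (o : Unary A B) x {σ} → σ 0 ≡ enc A x →
  eval (unaryExpr o) σ ≡ enc B (⟦ o ⟧¹ x)
eval-unaryExpr sucᶜ x       eq = cong (cons nil) eq
eval-unaryExpr fstᶜ (x , y) eq = cong head eq
eval-unaryExpr sndᶜ (x , y) eq = cong tail eq

enc-binary : ∀ {A B C} (o : Binary A B C) x y →
  cons (enc A x) (enc B y) ≡ enc C (⟦ o ⟧² x y)
enc-binary pairᶜ x y = refl
enc-binary consᶜ x y = refl

compile : ∀ {Γ A} → Tm Γ A → Loc Γ → Command
compile (var x)          ρ = simpleCode (slot (ρ x) (var 1))
compile (ren θ t)        ρ = compile t (λ x → ρ (rename θ x))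
compile (const o)        ρ = simpleCode (constantExpr o)
compile (unary o t)      ρ = thenCode (compile t ρ) (unaryExpr o)
compile (binary o t u)   ρ = pairCode (compile t ρ) (compile u (shift 1 ρ))
compile (bind t u)       ρ = bindCode (compile t ρ) (compile u (0 ▸ shift 1 ρ))
compile (branch t u v)   ρ = branchCode (compile t ρ) (compile u (shift 2 ρ)) (compile v ρ)
compile (caseNat t u v)  ρ =
  branchCode (compile t ρ) (compile v (1 ▸ shift 2 ρ)) (compile u ρ)
compile (caseList t u v) ρ =
  branchCode (compile t ρ) (compile v (0 ▸ (1 ▸ shift 2 ρ))) (compile u ρ)
compile (rep κ t u)      ρ = repCode κ (compile t ρ) (compile u (0 ▸ shift 2 ρ))

bindPoly pairPoly : Poly → Poly → Poly
bindPoly p q = # 1 ⊞ p ⊞ (# 5 ⊞ (# 1 ⊞ q ⊞ # 3))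
pairPoly p q = # 1 ⊞ p ⊞ (# 5 ⊞ (# 1 ⊞ q ⊞ (# 6 ⊞ # 3)))

branchPoly : Poly → Poly → Poly → Poly
branchPoly p q r =
  # 1 ⊞ p ⊞ (# 3 ⊞ (# 5 ⊞ (# 1 ⊞ (# 2 ⊞ (# 9 ⊞ (# 1 ⊞ q ⊞ (# 5 ⊞ (# 3 ⊞ # 2)))) ⊞ # 2)
                                ⊞ (# 2 ⊞ (# 1 ⊞ r ⊞ # 2) ⊞ # 2))))

repPoly : Poly → Poly → Poly
repPoly p q =
  # 1 ⊞ p ⊞ (# 14 ⊞ (# 1 ⊞ (# 3 ⊞ (# 4 ⊞ X) ⊠ (# 3 ⊞ (# 5 ⊞ (# 1 ⊞ q ⊞ # 9)))) ⊞ # 3))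

runtime : ∀ {Γ A} → Tm Γ A → Loc Γ → Poly
runtime (var x)          ρ = # (1 + cost (slot (ρ x) (var 1)))
runtime (ren θ t)        ρ = runtime t (λ x → ρ (rename θ x))
runtime (const o)        ρ = # (1 + cost (constantExpr o))
runtime (unary o t)      ρ = # 1 ⊞ runtime t ρ ⊞ # (1 + cost (unaryExpr o))
runtime (binary o t u)   ρ = pairPoly (runtime t ρ) (runtime u (shift 1 ρ))
runtime (bind t u)       ρ = bindPoly (runtime t ρ) (runtime u (0 ▸ shift 1 ρ))
runtime (branch t u v)   ρ = branchPoly (runtime t ρ) (runtime u (shift 2 ρ)) (runtime v ρ)
runtime (caseNat t u v)  ρ =
  branchPoly (runtime t ρ) (runtime v (1 ▸ shift 2 ρ)) (runtime u ρ)
runtime (caseList t u v) ρ =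
  branchPoly (runtime t ρ) (runtime v (0 ▸ (1 ▸ shift 2 ρ))) (runtime u ρ)
runtime (rep κ t u)      ρ = repPoly (runtime t ρ) (runtime u (0 ▸ shift 2 ρ))

Represents : ∀ {Γ} → Loc Γ → Tree → Env Γ → Set
Represents {Γ} ρ s γ = ∀ {A} (x : A ∈ˡ Γ) → nth (ρ x) s ≡ enc A (lookup γ x)

extend : ∀ {Γ A s γ i v} {ρ : Loc Γ} → nth i s ≡ enc A v → Represents ρ s γ →
  Represents (_▸_ {A = A} i ρ) s (v ∷ γ)
extend eq h (here refl) = eq
extend eq h (there x)   = h x

module _ (ι : Tree) where

  open Semantics (ticksOf ι)

  compile-correct : ∀ {Γ A} (t : Tm Γ A) (ρ : Loc Γ) {s} (γ : Env Γ) → Represents ρ s γ →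
    Computes ι (compile t ρ) s (enc A (⟦ t ⟧ γ)) (runtime t ρ at size ι)
  compile-correct (var x) ρ γ h = computes-simple {e = slot (ρ x) (var 1)} λ {σ} σ1 →
    trans (eval-slot (ρ x) (var 1) σ) (trans (cong (nth (ρ x)) σ1) (h x))
  compile-correct (ren θ t) ρ γ h = compile-correct t _ (restrict θ γ) λ x →
    trans (h (rename θ x)) (cong (enc _) (sym (lookup-restrict θ γ x)))
  compile-correct (const o) ρ γ h = computes-simple {e = constantExpr o} λ {σ} _ →
    eval-constantExpr o σ
  compile-correct (unary o t) ρ γ h = computes-then {e = unaryExpr o}
    (compile-correct t ρ γ h) (eval-unaryExpr o (⟦ t ⟧ γ))
  compile-correct (binary o t u) ρ {s} γ h =
    subst (λ a → Computes ι (compile (binary o t u) ρ) s a (runtime (binary o t u) ρ at size ι))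
      (enc-binary o (⟦ t ⟧ γ) (⟦ u ⟧ γ))
      (computes-pair (compile-correct t ρ γ h) (compile-correct u (shift 1 ρ) γ h))
  compile-correct (bind t u) ρ γ h = computes-bind (compile-correct t ρ γ h)
    (compile-correct u _ (⟦ t ⟧ γ ∷ γ) (extend {ρ = shift 1 ρ} refl h))
  compile-correct (branch t u v) ρ γ h with ⟦ t ⟧ γ | compile-correct t ρ γ h
  ... | false | c = computes-branch-nil _ c (compile-correct v ρ γ h)
  ... | true  | c = computes-branch-cons _ c (compile-correct u (shift 2 ρ) γ h)
  compile-correct (caseNat t u v) ρ γ h with ⟦ t ⟧ γ | compile-correct t ρ γ h
  ... | zero  | c = computes-branch-nil _ c (compile-correct u ρ γ h)
  ... | suc k | c = computes-branch-cons _ c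
    (compile-correct v _ (k ∷ γ) (extend {ρ = shift 2 ρ} refl h))
  compile-correct (caseList t u v) ρ γ h with ⟦ t ⟧ γ | compile-correct t ρ γ h
  ... | []     | c = computes-branch-nil _ c (compile-correct u ρ γ h)
  ... | x ∷ xs | c = computes-branch-cons _ c (compile-correct v _ (x ∷ xs ∷ γ)
    (extend {ρ = 1 ▸ shift 2 ρ} refl (extend {ρ = shift 2 ρ} refl h)))
  compile-correct (rep {A = A} κ t u) ρ γ h =
    computes-rep (enc A) (λ x → ⟦ u ⟧ (x ∷ γ)) κ (compile-correct t ρ γ h)
      λ c x → compile-correct u _ (x ∷ γ) (extend {ρ = shift 2 ρ} refl h)

program : ∀ {A B} → Tm (A ∷ []) B → Command
program t = 2 := var 0 ⨾ 1 := cons (var 0) nil ⨾ compile t (0 ▸ λ ())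

programPoly : ∀ {A B} → Tm (A ∷ []) B → Poly
programPoly {A} t = # 3 ⊞ (# 5 ⊞ runtime {A ∷ []} t (0 ▸ λ ()))

size-nonZero : ∀ a → NonZero (size a)
size-nonZero nil        = _
size-nonZero (cons _ _) = _

program-correct : ∀ {A B} (t : Tm (A ∷ []) B) (x : Val A) →
  let ι = enc A x
      open Semantics (ticksOf ι) in
  Σ[ s ∈ ℕ ] Outputs (program t) ι (enc B (⟦ t ⟧ (x ∷ []))) s ×
    s ≤ coefficient (programPoly t) * size ι ^ degree (programPoly t)
program-correct {A} {B} t x = time , (final , run , Holds.result post) ,
  ≤-trans fast (at-≤-monomial (programPoly t) (size ι) {{size-nonZero ι}})
  where
  ι = enc A x
  open Semantics (ticksOf ι)
  whole : Exec (program t) (initial ι) (programPoly t at size ι)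
    (Holds ι (cons ι nil) (enc B (⟦ t ⟧ (x ∷ []))))
  whole = exec-seq (exec-assign {Q = λ σ → σ 0 ≡ ι × σ 2 ≡ ι} (refl , refl)) λ (r , i) →
    exec-seq (exec-assign {Q = λ σ → σ 1 ≡ cons ι nil × σ 2 ≡ ι} (cong (λ a → cons a nil) r , i))
      λ (st , i) → compile-correct ι t _ (x ∷ []) (extend {ρ = λ ()} refl λ ()) st i
  open Exec whole

term⇒polyTime : ∀ {I O : Set} {encodeI : I → Tree} {encodeO : O → Tree} {R : I → O → Set} {A B}
  (t : Tm (A ∷ []) B) (input : I → Val A) (output : I → O) →
  (∀ x → enc A (input x) ≡ encodeI x) →
  (∀ x → let open Semantics (ticksOf (enc A (input x))) in
         enc B (⟦ t ⟧ (input x ∷ [])) ≡ encodeO (output x)) →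
  (∀ x → R x (output x)) →
  PolyTimeComputable encodeI encodeO R
term⇒polyTime t input output input-eq output-eq correct =
  program t , coefficient (programPoly t) , degree (programPoly t) , λ x →
  output x , correct x ,
  subst₂ (λ a b → Σ[ s ∈ ℕ ] Outputs (program t) a b s ×
                    s ≤ coefficient (programPoly t) * size a ^ degree (programPoly t))
    (input-eq x) (output-eq x) (program-correct t (input x))

-- Weighted sums

bit : Bool → ℕ
bit false = 0
bit true  = 1

bit≤1 : ∀ b → bit b ≤ 1
bit≤1 false = z≤n
bit≤1 true  = ≤-refl

T⇒≡ : ∀ {b} → T b → b ≡ true
T⇒≡ {true} _ = refl

≡⇒T : ∀ {b} → b ≡ true → T b
≡⇒T refl = _

wsum : ∀ {A : Set} → (A → ℕ) → List A → ℕ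
wsum f []       = 0
wsum f (x ∷ xs) = f x + wsum f xs

wsum-++ : ∀ {A : Set} (f : A → ℕ) xs ys → wsum f (xs ++ ys) ≡ wsum f xs + wsum f ys
wsum-++ f []       ys = refl
wsum-++ f (x ∷ xs) ys = trans (cong (f x +_) (wsum-++ f xs ys)) (sym (+-assoc (f x) _ _))

wsum-map : ∀ {A B : Set} (f : B → ℕ) (g : A → B) xs → wsum f (map g xs) ≡ wsum (f ∘ g) xs
wsum-map f g []       = refl
wsum-map f g (x ∷ xs) = cong (f (g x) +_) (wsum-map f g xs)

wsum-bound : ∀ {A : Set} {f : A → ℕ} {xs} → All (λ x → 1 ≤ f x) xs → length xs ≤ wsum f xs
wsum-bound []       = z≤n
wsum-bound (h ∷ hs) = +-mono-≤ h (wsum-bound hs)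

wsum-one : ∀ {A : Set} (xs : List A) → wsum (λ _ → 1) xs ≡ length xs
wsum-one []       = refl
wsum-one (x ∷ xs) = cong suc (wsum-one xs)

wsum-∃> : ∀ {A : Set} (f g : A → ℕ) xs → wsum g xs < wsum f xs → ∃[ x ] x ∈ˡ xs × g x < f x
wsum-∃> f g (x ∷ xs) lt with g x <? f x
... | yes gx<fx = x , here refl , gx<fx
... | no  gx≮fx with y , y∈ , h ← wsum-∃> f g xs (+-cancelˡ-< (g x) _ _
        (<-≤-trans lt (+-monoˡ-≤ (wsum f xs) (≮⇒≥ gx≮fx)))) = y , there y∈ , h

total : ∀ {n} → (Fin n → ℕ) → ℕ
total {zero}  f = 0
total {suc n} f = f zero + total (f ∘ suc)

total-cong : ∀ {n} {f g : Fin n → ℕ} → (∀ v → f v ≡ g v) → total f ≡ total g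
total-cong {zero}  h = refl
total-cong {suc n} h = cong₂ _+_ (h zero) (total-cong (h ∘ suc))

total-+ : ∀ {n} (f g : Fin n → ℕ) → total (λ v → f v + g v) ≡ total f + total g
total-+ {zero}  f g = refl
total-+ {suc n} f g rewrite total-+ (f ∘ suc) (g ∘ suc) =
  lemma (f zero) (g zero) (total (f ∘ suc)) (total (g ∘ suc))
  where
  lemma : ∀ a b c d → a + b + (c + d) ≡ a + c + (b + d)
  lemma = solve-∀

total-const : ∀ n c → total {n} (λ _ → c) ≡ n * c
total-const zero    c = refl
total-const (suc n) c = cong (c +_) (total-const n c)

wsum-tabulate : ∀ {A : Set} {n} (f : A → ℕ) (g : Fin n → A) →
  wsum f (tabulateˡ g) ≡ total (f ∘ g)
wsum-tabulate {n = zero}  f g = refl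
wsum-tabulate {n = suc n} f g = cong (f (g zero) +_) (wsum-tabulate f (g ∘ suc))

sum-tabulate : ∀ {n} (f : Fin n → ℕ) → Vec.sum (Vec.tabulate f) ≡ total f
sum-tabulate {zero}  f = refl
sum-tabulate {suc n} f = cong (f zero +_) (sum-tabulate (f ∘ suc))

card-total : ∀ {n} (p : Subset n) → ∣ p ∣ ≡ total (bit ∘ Vec.lookup p)
card-total Vec.[]            = refl
card-total (false Vec.∷ p)   = card-total p
card-total (true  Vec.∷ p)   = cong suc (card-total p)

card-tabulate : ∀ {n} (f : Fin n → Bool) → ∣ Vec.tabulate f ∣ ≡ total (bit ∘ f)
card-tabulate {zero}  f = refl
card-tabulate {suc n} f with f zero
... | false = card-tabulate (f ∘ suc)
... | true  = cong suc (card-tabulate (f ∘ suc))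

card-∪ : ∀ {n} (p q : Subset n) → ∣ p ∪ q ∣ ≤ ∣ p ∣ + ∣ q ∣
card-∪ Vec.[]          Vec.[]          = z≤n
card-∪ (false Vec.∷ p) (false Vec.∷ q) = card-∪ p q
card-∪ (false Vec.∷ p) (true Vec.∷ q)  =
  ≤-trans (s≤s (card-∪ p q)) (≤-reflexive (sym (+-suc ∣ p ∣ ∣ q ∣)))
card-∪ (true Vec.∷ p)  (false Vec.∷ q) = s≤s (card-∪ p q)
card-∪ (true Vec.∷ p)  (true Vec.∷ q)  =
  s≤s (≤-trans (card-∪ p q) (+-monoʳ-≤ ∣ p ∣ (n≤1+n ∣ q ∣)))

∈⇒bit : ∀ {n} {v : Fin n} {p : Subset n} → v ∈ p → bit (Vec.lookup p v) ≡ 1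
∈⇒bit v∈ = cong bit (Vec.[]=⇒lookup v∈)

∈-tabulate⁺ : ∀ {n} {v : Fin n} {f : Fin n → Bool} → f v ≡ true → v ∈ Vec.tabulate f
∈-tabulate⁺ {v = v} {f} eq = Vec.lookup⇒[]= v _ (trans (Vec.lookup∘tabulate f v) eq)

∈-tabulate⁻ : ∀ {n} {v : Fin n} {f : Fin n → Bool} → v ∈ Vec.tabulate f → f v ≡ true
∈-tabulate⁻ {v = v} {f} v∈ = trans (sym (Vec.lookup∘tabulate f v)) (Vec.[]=⇒lookup v∈)

δ : ∀ {n} → Fin n → Fin n → ℕ
δ x v = bit (does (v Fin.≟ x))

total-δ : ∀ {n} (x : Fin n) → total (δ x) ≡ 1
total-δ {suc n} zero    = cong suc (trans (total-const n 0) (*-zeroʳ n))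
total-δ {suc n} (suc x) = total-δ x

total-pick : ∀ {n} (f : Fin n → ℕ) x → total (λ v → f v * δ v x) ≡ f x
total-pick {suc n} f zero    = begin
  f zero * 1 + total (λ v → f (suc v) * 0)
    ≡⟨ cong₂ _+_ (*-identityʳ _) (total-cong λ v → *-zeroʳ (f (suc v))) ⟩
  f zero + total {n} (λ _ → 0)  ≡⟨ cong (f zero +_) (trans (total-const n 0) (*-zeroʳ n)) ⟩
  f zero + 0                    ≡⟨ +-identityʳ _ ⟩
  f zero                        ∎
  where open ≡-Reasoning
total-pick {suc n} f (suc x) = cong₂ _+_ (*-zeroʳ (f zero)) (total-pick (f ∘ suc) x)

⊆-full : ∀ {n} {p q : Subset n} {v} → ∣ p ∣ ≤ ∣ p ∩ q ∣ → v ∈ p → v ∈ q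
⊆-full {p = true  Vec.∷ p} {true  Vec.∷ q} le Vec.here        = Vec.here
⊆-full {p = true  Vec.∷ p} {false Vec.∷ q} le v∈ =
  contradiction (≤-trans le (p⊆q⇒∣p∣≤∣q∣ (p∩q⊆p p q))) 1+n≰n
⊆-full {p = true  Vec.∷ p} {true  Vec.∷ q} (s≤s le) (Vec.there v∈) = Vec.there (⊆-full le v∈)
⊆-full {p = false Vec.∷ p} {_     Vec.∷ q} le (Vec.there v∈) = Vec.there (⊆-full le v∈)

-- For w = λ f → wsum f vs this says that the entries of vs are distinct.
Fits : ∀ {n} → ((Fin n → ℕ) → ℕ) → Set
Fits {n} w = ∀ f → w f ≤ total f

-- Spreading of activity

module Spread {n} (G : Graph n) (τ : Fin n → ℕ) where

  next : Subset n → Subset n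
  next S = Vec.tabulate λ v → not (Vec.lookup S v) ∧ (τ v ≤ᵇ ∣ neighbours G v ∩ S ∣)

  module _ (D₀ : Subset n) where

    active : ℕ → Subset n
    -- Not simply `D₀`, so that it is literally `before layer 1`.
    active zero    = ∅ ∪ D₀
    active (suc i) = active i ∪ next (active i)

    layer : ℕ → Subset n
    layer zero    = D₀
    layer (suc i) = next (active i)

    Reached : Fin n → Set
    Reached v = ∃[ i ] v ∈ active i

    before-layer : ∀ i → before layer (suc i) ≡ active i
    before-layer zero    = refl
    before-layer (suc i) = cong (_∪ next (active i)) (before-layer i)

    active-mono : ∀ {i j} → i ≤′ j → active i ⊆ active j
    active-mono (≤′-reflexive refl) = id
    active-mono (≤′-step i≤j)       = p⊆p∪q _ ∘ active-mono i≤j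

    reached-initial : ∀ {v} → v ∈ D₀ → Reached v
    reached-initial v∈ = 0 , q⊆p∪q ∅ D₀ v∈

    active-fires : ∀ {v} i → τ v ≤ ∣ neighbours G v ∩ active i ∣ → v ∈ active (suc i)
    active-fires {v} i le with Vec.lookup (active i) v in eq
    ... | true  = p⊆p∪q _ (Vec.lookup⇒[]= v (active i) eq)
    ... | false = q⊆p∪q (active i) _ (∈-tabulate⁺ (cong₂ (λ b c → not b ∧ c) eq (T⇒≡ (≤⇒≤ᵇ le))))

    common-stage : ∀ {vs} → All Reached vs → ∃[ i ] All (_∈ active i) vs
    common-stage []              = 0 , []
    common-stage ((i , v∈) ∷ hs) with j , h ← common-stage hs =
      i ⊔ j , active-mono (≤⇒≤′ (m≤m⊔n i j)) v∈ ∷ All.map (active-mono (≤⇒≤′ (m≤n⊔m i j))) h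

    -- The neighbours may become active at different stages, but at a common later stage all of them
    -- count. `Fits`, applied to the indicator function of the active neighbours, turns the length
    -- of the list into a cardinality.
    reached-fires : ∀ {v vs} → All (Adj G v) vs → All Reached vs →
      Fits (λ f → wsum f vs) → τ v ≤ length vs → Reached v
    reached-fires {v} {vs} adjs hs fits τ≤ with i , h ← common-stage hs = suc i , active-fires i (begin
      τ v                                             ≤⟨ τ≤ ⟩
      length vs                                       ≤⟨ wsum-bound (All.zipWith member (adjs , h)) ⟩
      wsum (bit ∘ Vec.lookup (neighbours G v ∩ active i)) vs ≤⟨ fits _ ⟩
      total (bit ∘ Vec.lookup (neighbours G v ∩ active i))   ≡⟨ card-total (neighbours G v ∩ active i) ⟨
      ∣ neighbours G v ∩ active i ∣                   ∎)
      where
      open ≤-Reasoning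
      member : ∀ {u} → Adj G v u × u ∈ active i →
        1 ≤ bit (Vec.lookup (neighbours G v ∩ active i) u)
      member (a , u∈) = ≤-reflexive (sym (∈⇒bit (x∈p∩q⁺ (∈-tabulate⁺ (T⇒≡ a) , u∈))))

    reached⇒dynamo : (∀ v → Reached v) → IsDynamo G τ D₀
    reached⇒dynamo h with i , all∈ ← common-stage {vs = allFin n} (All.tabulate λ {v} _ → h v) =
      i , layer , refl , rule , λ v → subst (v ∈_) (sym (before-layer i)) (lookup all∈ (∈-allFin v))
      where
      open import Data.List.Membership.Propositional.Properties using (∈-allFin)
      split : ∀ {b c} → not b ∧ c ≡ true → b ≡ false × c ≡ true
      split {false} eq = refl , eq
      rule : ∀ j → 1 ≤ j → j ≤ i → ∀ v →
        v ∈ layer j ⇔ (v ∉ before layer j × τ v ≤ ∣ neighbours G v ∩ before layer j ∣)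
      rule (suc j) _ _ v rewrite before-layer j = mk⇔
        (λ v∈ → let (a , b) = split (∈-tabulate⁻ v∈) in
          (λ v∈′ → contradiction (trans (sym (Vec.[]=⇒lookup v∈′)) a) λ ()) , ≤ᵇ⇒≤ _ _ (≡⇒T b))
        (λ (v∉ , le) → ∈-tabulate⁺ (cong₂ (λ b c → not b ∧ c) (not-in v∉) (T⇒≡ (≤⇒≤ᵇ le))))
        where
        not-in : v ∉ active j → Vec.lookup (active j) v ≡ false
        not-in v∉ with Vec.lookup (active j) v in eq
        ... | false = refl
        ... | true  = contradiction (Vec.lookup⇒[]= v (active j) eq) v∉

-- Two adjacent vertices that both wait for all of their neighbours wait
-- for each other.
dynamo-hits : ∀ {n} {G : Graph n} {τ D₀} {u v} → IsDynamo G τ D₀ → Adj G u v →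
  deg G u ≤ τ u → deg G v ≤ τ v → 1 ≤ bit (Vec.lookup D₀ u) + bit (Vec.lookup D₀ v)
dynamo-hits {G = G} {τ} {_} {u} {v} (k , D , refl , rule , cover) u~v degu degv
  with u ∈? D 0 | v ∈? D 0
... | yes u∈ | _      = ≤-trans (≤-reflexive (sym (∈⇒bit u∈))) (m≤m+n _ _)
... | no _   | yes v∈ = ≤-trans (≤-reflexive (sym (∈⇒bit v∈))) (m≤n+m _ (bit (Vec.lookup (D 0) u)))
... | no u∉  | no v∉  = contradiction (inj₁ (cover u)) (waiting (suc k) ≤-refl)
  where
  v~u : Adj G v u
  v~u = subst T (symmetric G u v) u~v
  stuck : ∀ {x y} i → suc i ≤ suc k → x ∉ D 0 → Adj G x y → deg G x ≤ τ x → x ∈ D i →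
    y ∈ before D i
  stuck zero    le x∉ a d x∈ = contradiction x∈ x∉
  stuck {x} {y} (suc i) (s≤s le) x∉ a d x∈ =
    ⊆-full (≤-trans d (proj₂ (Equivalence.to (rule (suc i) (s≤s z≤n) le x) x∈)))
      (∈-tabulate⁺ {f = adj G x} (T⇒≡ a))
  waiting : ∀ i → i ≤ suc k → ¬ (u ∈ before D i ⊎ v ∈ before D i)
  waiting zero    le (inj₁ u∈) = ∉⊥ u∈
  waiting zero    le (inj₂ v∈) = ∉⊥ v∈
  waiting (suc i) le (inj₁ u∈) with x∈p∪q⁻ (before D i) (D i) u∈
  ... | inj₁ h = waiting i (≤-trans (n≤1+n i) le) (inj₁ h)
  ... | inj₂ h = waiting i (≤-trans (n≤1+n i) le) (inj₂ (stuck i le u∉ u~v degu h))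
  waiting (suc i) le (inj₂ v∈) with x∈p∪q⁻ (before D i) (D i) v∈
  ... | inj₁ h = waiting i (≤-trans (n≤1+n i) le) (inj₂ h)
  ... | inj₂ h = waiting i (≤-trans (n≤1+n i) le) (inj₁ (stuck i le v∉ v~u degv h))

-- Rooted forests

data Rose (V : Set) : Set where
  node : V → List (Rose V) → Rose V

root : ∀ {V} → Rose V → V
root (node v _) = v

children : ∀ {V} → Rose V → List (Rose V)
children (node _ ts) = ts

module _ {V : Set} where

  weight : (V → ℕ) → Rose V → ℕ
  weights : (V → ℕ) → List (Rose V) → ℕ
  weight f (node v ts) = f v + weights f ts
  weights f []       = 0
  weights f (t ∷ ts) = weight f t + weights f ts

  data Everywhere (P : V → Set) : Rose V → Set where
    node : ∀ {v ts} → P v → All (Everywhere P) ts → Everywhere P (node v ts)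

  weights-++ : ∀ f ts us → weights f (ts ++ us) ≡ weights f ts + weights f us
  weights-++ f []       us = refl
  weights-++ f (t ∷ ts) us =
    trans (cong (weight f t +_) (weights-++ f ts us)) (sym (+-assoc (weight f t) _ _))

  root≤weight : ∀ f t → f (root t) ≤ weight f t
  root≤weight f (node v ts) = m≤m+n (f v) (weights f ts)

  roots≤weights : ∀ f ts → wsum (f ∘ root) ts ≤ weights f ts
  roots≤weights f []       = z≤n
  roots≤weights f (t ∷ ts) = +-mono-≤ (root≤weight f t) (roots≤weights f ts)

module _ {n} {P : Fin n → Set} (v : Fin n) where

  -- Occurrence of v in a tree is expressed by the weight of `δ v`, because the covering of all
  -- vertices is known only in terms of weights.
  everywhere-at : ∀ {t} → Everywhere P t → 1 ≤ weight (δ v) t → P v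
  everywhere-at-list : ∀ {ts} → All (Everywhere P) ts → 1 ≤ weights (δ v) ts → P v
  everywhere-at (node {u} p ps) h with u Fin.≟ v
  ... | yes refl = p
  ... | no  _    = everywhere-at-list ps h
  everywhere-at-list {t ∷ ts} (p ∷ ps) h with weight (δ v) t in eq
  ... | zero  = everywhere-at-list ps h
  ... | suc _ = everywhere-at p (≤-trans (s≤s z≤n) (≤-reflexive (sym eq)))

-- Matchings in rooted trees and the thresholds that they define

data Mode : Set where
  free any : Mode

module Matching {n} (G : Graph n) where

  -- Rooted e t says that t is a part of G cut off at its root, which has e
  -- neighbours outside of t; the other vertices of t have none.
  data Rooted : ℕ → Rose (Fin n) → Set
  data Subtrees (v : Fin n) : List (Rose (Fin n)) → Set

  data Rooted where
    rooted : ∀ {e v ts} → deg G v ≡ length ts + e → Subtrees v ts → Rooted e (node v ts)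

  data Subtrees v where
    []  : Subtrees v []
    _∷_ : ∀ {t ts} → Adj G v (root t) × Rooted 1 t → Subtrees v ts → Subtrees v (t ∷ ts)

  -- Matches m t k c: in t there is a matching with k edges that cover
  -- vertices of total degree c; in mode free it avoids the root.
  data Matches : Mode → Rose (Fin n) → ℕ → ℕ → Set where
    bare : ∀ {m v} → Matches m (node v []) 0 0
    skip : ∀ {m v t ts k c k′ c′} → Matches any t k c → Matches m (node v ts) k′ c′ →
      Matches m (node v (t ∷ ts)) (k + k′) (c + c′)
    edge : ∀ {v t ts k c k′ c′} → Matches free t k c → Matches free (node v ts) k′ c′ →
      Matches any (node v (t ∷ ts)) (suc (k + k′)) (deg G v + deg G (root t) + (c + c′))

  data MatchesAll : List (Rose (Fin n)) → ℕ → ℕ → Set where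
    []  : MatchesAll [] 0 0
    _∷_ : ∀ {t ts k c k′ c′} → Matches any t k c → MatchesAll ts k′ c′ →
      MatchesAll (t ∷ ts) (k + k′) (c + c′)

  free⇒any : ∀ {t k c} → Matches free t k c → Matches any t k c
  free⇒any bare       = bare
  free⇒any (skip m f) = skip m (free⇒any f)

  ends : (Fin n → ℕ) → Fin n × Fin n → ℕ
  ends f (u , v) = f u + f v

  at-root : Mode → ℕ → ℕ
  at-root free x = 0
  at-root any  x = x

  -- `room` stands for the set of vertices that the edges may use, given as the functional that sums
  -- f over it.
  record Edges (k c : ℕ) (room : (Fin n → ℕ) → ℕ) : Set where
    field
      edges    : List (Fin n × Fin n)
      adjacent : All (uncurry (Adj G)) edges
      number   : length edges ≡ k
      degrees  : wsum (ends (deg G)) edges ≡ c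
      -- As this holds for all f, the ends of the edges are distinct.
      fits     : ∀ f → wsum (ends f) edges ≤ room f

  edges-++ : ∀ {k c k′ c′ w w′} → Edges k c w → Edges k′ c′ w′ →
    Edges (k + k′) (c + c′) (λ f → w f + w′ f)
  edges-++ M M′ = record
    { edges    = M.edges ++ M′.edges
    ; adjacent = All.++⁺ M.adjacent M′.adjacent
    ; number   = trans (length-++ M.edges) (cong₂ _+_ M.number M′.number)
    ; degrees  = trans (wsum-++ _ M.edges M′.edges) (cong₂ _+_ M.degrees M′.degrees)
    ; fits     = λ f → ≤-trans (≤-reflexive (wsum-++ (ends f) M.edges M′.edges))
                         (+-mono-≤ (M.fits f) (M′.fits f))
    }
    where
    module M  = Edges M
    module M′ = Edges M′

  edges-≤ : ∀ {k c w w′} → (∀ f → w f ≤ w′ f) → Edges k c w → Edges k c w′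
  edges-≤ le M = record { Edges M ; fits = λ f → ≤-trans (Edges.fits M f) (le f) }

  matches⇒edges : ∀ {m v ts k c} → Subtrees v ts → Matches m (node v ts) k c →
    Edges k c (λ f → at-root m (f v) + weights f ts)
  matches⇒edges _ bare = record
    { edges = [] ; adjacent = [] ; number = refl ; degrees = refl ; fits = λ _ → z≤n }
  matches⇒edges {m} {v} {node r us ∷ ts} ((_ , rooted _ sub) ∷ subs) (skip M M′) =
    edges-≤ (λ f → ≤-reflexive (lemma (f r) (weights f us) (at-root m (f v)) (weights f ts)))
      (edges-++ (matches⇒edges sub M) (matches⇒edges subs M′))
    where
    lemma : ∀ a b c d → a + b + (c + d) ≡ c + (a + b + d)
    lemma = solve-∀
  matches⇒edges {_} {v} {node r us ∷ ts} ((v~r , rooted _ sub) ∷ subs) (edge M M′) =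
    edges-≤ (λ f → ≤-reflexive (lemma (f v) (f r) (weights f us) (weights f ts)))
      (edges-++ single (edges-++ (matches⇒edges sub M) (matches⇒edges subs M′)))
    where
    single : Edges 1 (deg G v + deg G r) (λ f → f v + f r)
    single = record
      { edges = (v , r) ∷ [] ; adjacent = v~r ∷ [] ; number = refl
      ; degrees = +-identityʳ _ ; fits = λ f → ≤-reflexive (+-identityʳ _) }
    lemma : ∀ a b c d → a + b + (c + d) ≡ a + (b + c + d)
    lemma = solve-∀

  matchesAll⇒edges : ∀ {ts k c} → All (Rooted 0) ts → MatchesAll ts k c →
    Edges k c (λ f → weights f ts)
  matchesAll⇒edges [] [] = record
    { edges = [] ; adjacent = [] ; number = refl ; degrees = refl ; fits = λ _ → z≤n }
  matchesAll⇒edges {node v us ∷ ts} (rooted _ sub ∷ hs) (M ∷ Ms) =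
    edges-++ (matches⇒edges sub M) (matchesAll⇒edges hs Ms)

  -- As each vertex ends at most one edge, this is the degree on the ends of
  -- the edges and 0 elsewhere.
  waiting : List (Fin n × Fin n) → Fin n → ℕ
  waiting M v = deg G v * wsum (ends (δ v)) M

  total-waiting : ∀ M → total (waiting M) ≡ wsum (ends (deg G)) M
  total-waiting []            = trans (total-cong λ v → *-zeroʳ (deg G v))
                                  (trans (total-const n 0) (*-zeroʳ n))
  total-waiting ((x , y) ∷ M) = begin
    total (λ v → deg G v * (δ v x + δ v y + wsum (ends (δ v)) M))
      ≡⟨ total-cong (λ v → distribute (deg G v) (δ v x) (δ v y) _) ⟩
    total (λ v → deg G v * δ v x + deg G v * δ v y + waiting M v)
      ≡⟨ total-+ (λ v → deg G v * δ v x + deg G v * δ v y) (waiting M) ⟩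
    total (λ v → deg G v * δ v x + deg G v * δ v y) + total (waiting M)
      ≡⟨ cong₂ _+_ (trans (total-+ (λ v → deg G v * δ v x) (λ v → deg G v * δ v y))
           (cong₂ _+_ (total-pick (deg G) x) (total-pick (deg G) y))) (total-waiting M) ⟩
    deg G x + deg G y + wsum (ends (deg G)) M ∎
    where
    open ≡-Reasoning
    distribute : ∀ d a b c → d * (a + b + c) ≡ d * a + d * b + d * c
    distribute = solve-∀

  waiting-threshold : ∀ M → (∀ f → wsum (ends f) M ≤ total f) → IsThreshold G (waiting M)
  waiting-threshold M fits v = ≤-trans
    (*-monoʳ-≤ (deg G v) (≤-trans (fits (δ v)) (≤-reflexive (total-δ v))))
    (≤-reflexive (*-identityʳ _))

  δ-self : ∀ (v : Fin n) → δ v v ≡ 1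
  δ-self v with v Fin.≟ v
  ... | yes _   = refl
  ... | no  v≢v = contradiction refl v≢v

  deg≤waiting : ∀ {x y M} → (x , y) ∈ˡ M → deg G x ≤ waiting M x × deg G y ≤ waiting M y
  deg≤waiting {x} {y} {M} e∈ = scale x (≤-trans (≤-trans (≤-reflexive (sym (δ-self x)))
      (m≤m+n _ _)) (occurs (δ x) e∈))
    , scale y (≤-trans (≤-trans (≤-reflexive (sym (δ-self y))) (m≤n+m _ (δ y x))) (occurs (δ y) e∈))
    where
    occurs : ∀ f {M} → (x , y) ∈ˡ M → ends f (x , y) ≤ wsum (ends f) M
    occurs f (here refl) = m≤m+n _ _
    occurs f (there e∈)  = ≤-trans (occurs f e∈) (m≤n+m _ _)
    scale : ∀ v {c} → 1 ≤ c → deg G v ≤ deg G v * c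
    scale v {c} 1≤c = ≤-trans (≤-reflexive (sym (*-identityʳ (deg G v)))) (*-monoʳ-≤ (deg G v) 1≤c)

  -- Each edge has an end in `D₀`, and `fits` at the indicator function of `D₀` ensures that no
  -- vertex is counted for two edges.
  dynamo-large : ∀ {M D₀} → All (uncurry (Adj G)) M → (∀ f → wsum (ends f) M ≤ total f) →
    IsDynamo G (waiting M) D₀ → length M ≤ ∣ D₀ ∣
  dynamo-large {M} {D₀} adjs fits dyn = begin
    length M                                ≤⟨ wsum-bound (All.tabulate hit) ⟩
    wsum (ends (bit ∘ Vec.lookup D₀)) M     ≤⟨ fits _ ⟩
    total (bit ∘ Vec.lookup D₀)             ≡⟨ card-total D₀ ⟨
    ∣ D₀ ∣                                  ∎
    where
    open ≤-Reasoning
    hit : ∀ {e} → e ∈ˡ M → 1 ≤ ends (bit ∘ Vec.lookup D₀) e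
    hit e∈ = dynamo-hits {G = G} dyn (lookup adjs e∈) (proj₁ (deg≤waiting e∈)) (proj₂ (deg≤waiting e∈))

-- A greedy dynamo

-- Going up from the leaves, a vertex is put into the dynamo only if it would
-- stay inactive even after its parent.  A vertex that waits for its parent is
-- called pending; pending vertices save enough threshold to pay for an edge
-- between them and a parent in the dynamo.
module Greedy {n} (G : Graph n) (τ : Fin n → ℕ) (τ≤deg : IsThreshold G τ) where

  open Matching G
  open Spread G τ

  record Active (t : Rose (Fin n)) : Set where
    field
      {k c}   : ℕ
      dynamo  : Subset n
      matches : Matches any t k c
      small   : ∣ dynamo ∣ ≤ k
      cheap   : c ≤ weight τ t
      reached : ∀ D₀ → dynamo ⊆ D₀ → Everywhere (Reached D₀) t

  -- The matching avoids the root and leaves `deg G (root t)` of the threshold unspent; this can pay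
  -- for the lower end of an edge to the parent. The `Fits` hypothesis puts p outside t, so that p
  -- counts in addition to the active children.
  record Pending (t : Rose (Fin n)) : Set where
    field
      {k c}   : ℕ
      dynamo  : Subset n
      matches : Matches free t k c
      small   : ∣ dynamo ∣ ≤ k
      cheap   : c + deg G (root t) ≤ weight τ t
      reached : ∀ D₀ → dynamo ⊆ D₀ → ∀ p → Adj G (root t) p →
        Fits (λ f → f p + weight f t) → Reached D₀ p → Everywhere (Reached D₀) t

  -- The balance for the children treated so far. In `cheap` every pending child has saved at least
  -- one unit. In `spare` one of them is matched with v instead: its whole saving goes into its own
  -- end of the edge, so one unit fewer is left, hence `suc`. The other end is still unpaid and
  -- appears as `deg G v`.
  record Below (v : Fin n) (ts : List (Rose (Fin n))) : Set where
    field
      {k c pending} : ℕ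
      dynamo   : Subset n
      actives  : List (Fin n)
      count    : length actives + pending ≡ length ts
      matches  : Matches free (node v ts) k c
      small    : ∣ dynamo ∣ ≤ k
      cheap    : c + pending ≤ weights τ ts
      spare    : pending ≡ 0 ⊎
        ∃[ c′ ] Matches any (node v ts) (suc k) c′ × c′ + pending ≤ suc (weights τ ts + deg G v)
      adjacent : All (Adj G v) actives
      fits     : ∀ f → wsum f actives ≤ weights f ts
      reached  : ∀ D₀ → dynamo ⊆ D₀ → All (Reached D₀) actives
      finish   : ∀ D₀ → dynamo ⊆ D₀ → Fits (λ f → f v + weights f ts) → Reached D₀ v →
        All (Everywhere (Reached D₀)) ts

  everywhere-root : ∀ {P : Fin n → Set} {t} → Everywhere P t → P (root t)
  everywhere-root (node p _) = p

  fits-≤ : ∀ {w w′ : (Fin n → ℕ) → ℕ} → (∀ f → w f ≤ w′ f) → Fits w′ → Fits w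
  fits-≤ le h f = ≤-trans (le f) (h f)

  below-active : ∀ {v t ts} → Adj G v (root t) → Active t → Below v ts → Below v (t ∷ ts)
  below-active {v} {t} {ts} v~t A B = record
    { dynamo   = A.dynamo ∪ B.dynamo
    ; actives  = root t ∷ B.actives
    ; count    = cong suc B.count
    ; matches  = skip A.matches B.matches
    ; small    = ≤-trans (card-∪ A.dynamo B.dynamo) (+-mono-≤ A.small B.small)
    ; cheap    = ≤-trans (≤-reflexive (+-assoc A.c B.c B.pending)) (+-mono-≤ A.cheap B.cheap)
    ; spare    = spare B.spare
    ; adjacent = v~t ∷ B.adjacent
    ; fits     = λ f → +-mono-≤ (root≤weight f t) (B.fits f)
    ; reached  = λ D₀ D⊆ → everywhere-root (A.reached D₀ (D⊆ ∘ p⊆p∪q _)) ∷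
                           B.reached D₀ (D⊆ ∘ q⊆p∪q A.dynamo _)
    ; finish   = λ D₀ D⊆ fits v-reached → A.reached D₀ (D⊆ ∘ p⊆p∪q _) ∷
        B.finish D₀ (D⊆ ∘ q⊆p∪q A.dynamo _)
          (fits-≤ (λ f → +-monoʳ-≤ (f v) (m≤n+m _ (weight f t))) fits) v-reached
    }
    where
    module A = Active A
    module B = Below B
    spare : B.pending ≡ 0 ⊎ _ → B.pending ≡ 0 ⊎ _
    spare (inj₁ none)        = inj₁ none
    spare (inj₂ (c′ , M , h)) = inj₂ (A.c + c′ ,
      subst (λ k → Matches any (node v (t ∷ ts)) k (A.c + c′)) (+-suc A.k B.k) (skip A.matches M) ,
      (begin
        A.c + c′ + B.pending                              ≡⟨ +-assoc A.c c′ B.pending ⟩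
        A.c + (c′ + B.pending)                            ≤⟨ +-mono-≤ A.cheap h ⟩
        weight τ t + suc (weights τ ts + deg G v)         ≡⟨ lemma (weight τ t) _ _ ⟩
        suc (weight τ t + weights τ ts + deg G v)         ∎))
      where
      open ≤-Reasoning
      lemma : ∀ a b c → a + suc (b + c) ≡ suc (a + b + c)
      lemma = solve-∀

  -- The saving of the new child is used in two alternative ways: without an edge at v only one unit
  -- of it is kept on record, with an edge all of it is spent.
  below-pending : ∀ {v t ts} → Adj G v (root t) → 1 ≤ deg G (root t) → Pending t → Below v ts →
    Below v (t ∷ ts)
  below-pending {v} {t} {ts} v~t 1≤deg A B = record
    { dynamo   = A.dynamo ∪ B.dynamo
    ; actives  = B.actives
    ; pending  = suc B.pending
    ; count    = trans (+-suc _ B.pending) (cong suc B.count)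
    ; matches  = skip (free⇒any A.matches) B.matches
    ; small    = ≤-trans (card-∪ A.dynamo B.dynamo) (+-mono-≤ A.small B.small)
    ; cheap    = begin
        A.c + B.c + suc B.pending       ≡⟨ rearrange A.c B.c B.pending ⟩
        A.c + 1 + (B.c + B.pending)     ≤⟨ +-mono-≤ (≤-trans (+-monoʳ-≤ A.c 1≤deg) A.cheap) B.cheap ⟩
        weight τ t + weights τ ts       ∎
    -- The edge goes to the newest pending child, and the other children keep the matching that
    -- avoids v; an earlier spare matching is forgotten.
    ; spare    = inj₂ (_ , edge A.matches B.matches , (begin
        deg G v + deg G (root t) + (A.c + B.c) + suc B.pending
          ≡⟨ rearrange′ (deg G v) (deg G (root t)) A.c B.c B.pending ⟩
        suc (A.c + deg G (root t) + (B.c + B.pending) + deg G v)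
          ≤⟨ s≤s (+-monoˡ-≤ (deg G v) (+-mono-≤ A.cheap B.cheap)) ⟩
        suc (weight τ t + weights τ ts + deg G v) ∎))
    ; adjacent = B.adjacent
    ; fits     = λ f → ≤-trans (B.fits f) (m≤n+m _ (weight f t))
    ; reached  = λ D₀ D⊆ → B.reached D₀ (D⊆ ∘ q⊆p∪q A.dynamo _)
    ; finish   = λ D₀ D⊆ fits v-reached →
        A.reached D₀ (D⊆ ∘ p⊆p∪q _) v (subst T (symmetric G v (root t)) v~t)
          (fits-≤ (λ f → +-monoʳ-≤ (f v) (m≤m+n _ _)) fits) v-reached ∷
        B.finish D₀ (D⊆ ∘ q⊆p∪q A.dynamo _)
          (fits-≤ (λ f → +-monoʳ-≤ (f v) (m≤n+m _ (weight f t))) fits) v-reached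
    }
    where
    open ≤-Reasoning
    module A = Pending A
    module B = Below B
    rearrange : ∀ a b p → a + b + suc p ≡ a + 1 + (b + p)
    rearrange = solve-∀
    rearrange′ : ∀ d e a b p → d + e + (a + b) + suc p ≡ suc (a + e + (b + p) + d)
    rearrange′ = solve-∀

  below-none : ∀ {v} → Below v []
  below-none = record
    { dynamo = ∅ ; actives = [] ; pending = 0 ; count = refl ; matches = bare
    ; small = ≤-reflexive (∣⊥∣≡0 n) ; cheap = z≤n ; spare = inj₁ refl ; adjacent = []
    ; fits = λ _ → z≤n ; reached = λ _ _ → [] ; finish = λ _ _ _ _ → [] }

  module Node {e v ts} (deg≡ : deg G v ≡ length ts + e) (B : Below v ts)
              (fits : Fits (λ f → weight f (node v ts))) where

    module B = Below B
    open ≤-Reasoning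

    a = length B.actives

    deg≡′ : deg G v ≡ a + B.pending + e
    deg≡′ = trans deg≡ (cong (_+ e) (sym B.count))

    v-before-actives : Fits (λ f → f v + wsum f B.actives)
    v-before-actives = fits-≤ (λ f → +-monoʳ-≤ (f v) (B.fits f)) fits

    by-children : τ v ≤ a → Active (node v ts)
    by-children τ≤a = record
      { dynamo = B.dynamo ; matches = free⇒any B.matches ; small = B.small
      ; cheap = ≤-trans (m≤m+n B.c B.pending) (≤-trans B.cheap (m≤n+m _ (τ v)))
      ; reached = λ D₀ D⊆ → let
          v-reached = reached-fires D₀ B.adjacent (B.reached D₀ D⊆)
            (fits-≤ (λ f → m≤n+m _ (f v)) v-before-actives) τ≤a
          in node v-reached (B.finish D₀ D⊆ fits v-reached) }

    -- The amount deg v = a + pending + 1 to be saved splits up: τ v supplies a + 1, and the units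
    -- saved by the pending children supply the rest. This is what those units are recorded for.
    by-parent : e ≡ 1 → τ v ≡ suc a → Pending (node v ts)
    by-parent refl τ≡ = record
      { dynamo = B.dynamo ; matches = B.matches ; small = B.small
      ; cheap = begin
          B.c + deg G v                       ≡⟨ cong (B.c +_) deg≡′ ⟩
          B.c + (a + B.pending + 1)           ≡⟨ rearrange B.c a B.pending ⟩
          suc a + (B.c + B.pending)           ≤⟨ +-monoʳ-≤ (suc a) B.cheap ⟩
          suc a + weights τ ts                ≡⟨ cong (_+ weights τ ts) τ≡ ⟨
          τ v + weights τ ts                  ∎
      ; reached = λ D₀ D⊆ p v~p p-fits p-reached → let
          v-reached = reached-fires D₀ (v~p ∷ B.adjacent) (p-reached ∷ B.reached D₀ D⊆)
            (fits-≤ (λ f → +-monoʳ-≤ (f p) (≤-trans (B.fits f) (m≤n+m _ (f v)))) p-fits)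
            (≤-reflexive τ≡)
          in node v-reached (B.finish D₀ D⊆ fits v-reached) }
      where
      rearrange : ∀ c a p → c + (a + p + 1) ≡ suc a + (c + p)
      rearrange = solve-∀

    -- Since τ v is at most deg v, there must be a pending child, and hence a spare matching with
    -- the additional edge that pays for v in the dynamo. What it lacks is deg v + 1 - pending = e +
    -- a + 1, which τ v covers.
    by-choice : e + suc a ≤ τ v → Active (node v ts)
    by-choice big with B.spare
    ... | inj₁ none = contradiction (begin
      suc (a + e)                   ≡⟨ lemma a e ⟩
      e + suc a                     ≤⟨ big ⟩
      τ v                           ≤⟨ τ≤deg v ⟩
      deg G v                       ≡⟨ deg≡′ ⟩
      a + B.pending + e             ≡⟨ cong (λ p → a + p + e) none ⟩
      a + 0 + e                     ≡⟨ cong (_+ e) (+-identityʳ a) ⟩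
      a + e                         ∎) 1+n≰n
      where
      lemma : ∀ a e → suc (a + e) ≡ e + suc a
      lemma = solve-∀
    ... | inj₂ (c′ , M , h) = record
      { dynamo = B.dynamo ∪ ⁅ v ⁆ ; matches = M
      ; small = begin
          ∣ B.dynamo ∪ ⁅ v ⁆ ∣        ≤⟨ card-∪ B.dynamo ⁅ v ⁆ ⟩
          ∣ B.dynamo ∣ + ∣ ⁅ v ⁆ ∣    ≤⟨ +-mono-≤ B.small (≤-reflexive (∣⁅x⁆∣≡1 v)) ⟩
          B.k + 1                     ≡⟨ +-comm B.k 1 ⟩
          suc B.k                     ∎
      ; cheap = +-cancelʳ-≤ B.pending c′ (τ v + weights τ ts) (begin
          c′ + B.pending                                ≤⟨ h ⟩
          suc (weights τ ts + deg G v)                  ≡⟨ cong (λ d → suc (weights τ ts + d)) deg≡′ ⟩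
          suc (weights τ ts + (a + B.pending + e))      ≡⟨ rearrange (weights τ ts) a B.pending e ⟩
          e + suc a + weights τ ts + B.pending
            ≤⟨ +-monoˡ-≤ B.pending (+-monoˡ-≤ (weights τ ts) big) ⟩
          τ v + weights τ ts + B.pending                ∎)
      ; reached = λ D₀ D⊆ → let
          v-reached = reached-initial D₀ (D⊆ (q⊆p∪q B.dynamo _ (x∈⁅x⁆ v)))
          in node v-reached (B.finish D₀ (D⊆ ∘ p⊆p∪q _) fits v-reached) }
      where
      rearrange : ∀ w a p e → suc (w + (a + p + e)) ≡ e + suc a + w + p
      rearrange = solve-∀

  -- Everything depends on τ v against the number a of active children: up to a they activate v; a +
  -- 1 leaves v pending if it has a parent; otherwise τ v is at least e + a + 1 and v is chosen.
  -- With e = 0 there is no parent to wait for.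
  greedy : ∀ {e t} → Rooted e t → Fits (λ f → weight f t) → e ≤ 1 →
    Active t ⊎ e ≡ 1 × Pending t
  below : ∀ {v ts} → Subtrees v ts → Fits (λ f → weights f ts) → Below v ts

  greedy {e} {node v ts} (rooted deg≡ sub) fits e≤1
    with B ← below sub (fits-≤ (λ f → m≤n+m _ (f v)) fits)
    with τ v ≤? length (Below.actives B)
  ... | yes le = inj₁ (Node.by-children deg≡ B fits le)
  ... | no gt with e≤1
  ...   | z≤n = inj₁ (Node.by-choice deg≡ B fits (≰⇒> gt))
  ...   | s≤s z≤n with τ v ≤? suc (length (Below.actives B))
  ...     | yes le = inj₂ (refl , Node.by-parent deg≡ B fits refl (≤-antisym le (≰⇒> gt)))
  ...     | no gt′ = inj₁ (Node.by-choice deg≡ B fits (≰⇒> gt′))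

  below [] fits = below-none
  below {ts = t ∷ ts} ((v~t , h@(rooted deg≡ _)) ∷ sub) fits
    with B ← below sub (fits-≤ (λ f → m≤n+m _ (weight f t)) fits)
    with greedy h (fits-≤ (λ f → m≤m+n _ _) fits) ≤-refl
  ... | inj₁ A       = below-active v~t A B
  ... | inj₂ (_ , A) = below-pending v~t
    (≤-trans (m≤n+m 1 _) (≤-reflexive (sym deg≡))) A B

  record Result (ts : List (Rose (Fin n))) : Set where
    field
      {k c}   : ℕ
      dynamo  : Subset n
      matches : MatchesAll ts k c
      small   : ∣ dynamo ∣ ≤ k
      cheap   : c ≤ weights τ ts
      reached : ∀ D₀ → dynamo ⊆ D₀ → All (Everywhere (Reached D₀)) ts

  greedyAll : ∀ {ts} → All (Rooted 0) ts → Fits (λ f → weights f ts) → Result ts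
  greedyAll [] fits = record
    { dynamo = ∅ ; matches = [] ; small = ≤-reflexive (∣⊥∣≡0 n) ; cheap = z≤n
    ; reached = λ _ _ → [] }
  greedyAll {t ∷ ts} (h ∷ hs) fits
    with greedy h (fits-≤ (λ f → m≤m+n _ _) fits) z≤n
       | greedyAll hs (fits-≤ (λ f → m≤n+m _ (weight f t)) fits)
  ... | inj₁ A | R = record
    { dynamo  = A.dynamo ∪ R.dynamo
    ; matches = A.matches ∷ R.matches
    ; small   = ≤-trans (card-∪ A.dynamo R.dynamo) (+-mono-≤ A.small R.small)
    ; cheap   = +-mono-≤ A.cheap R.cheap
    ; reached = λ D₀ D⊆ → A.reached D₀ (D⊆ ∘ p⊆p∪q _) ∷ R.reached D₀ (D⊆ ∘ q⊆p∪q A.dynamo _)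
    }
    where
    module A = Active A
    module R = Result R

-- Elimination of the vertices of a forest

module Elimination {n} (G : Graph n) where

  open Matching G

  State : Set
  State = List (Rose (Fin n)) × List (Rose (Fin n))

  degreeIn : Fin n → List (Rose (Fin n)) → ℕ
  degreeIn u = wsum (bit ∘ adj G u ∘ root)

  attach : Rose (Fin n) → Rose (Fin n) → Rose (Fin n)
  attach t u = node (root u) (if adj G (root u) (root t) then t ∷ children u else children u)

  -- With no neighbour left, `attach t` changes no tree. It is applied all the same because its
  -- counterpart in the program also deletes the column of t from the matrix.
  advance : ℕ → Rose (Fin n) → State → State
  advance zero          t (ts , ds) = map (attach t) ts , t ∷ ds
  advance (suc zero)    t (ts , ds) = map (attach t) ts , ds
  advance (suc (suc _)) t (ts , ds) = ts ∷ʳ t , ds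

  step : State → State
  step ([] , ds)     = [] , ds
  step (t ∷ ts , ds) = advance (degreeIn (root t) ts) t (ts , ds)

  record Invariant (s : State) : Set where
    field
      -- As this holds for all f, each vertex occurs exactly once.
      covers : ∀ f → weights f (proj₁ s) + weights f (proj₂ s) ≡ total f
      done   : All (Rooted 0) (proj₂ s)
      live   : All (λ t → Rooted (degreeIn (root t) (proj₁ s)) t) (proj₁ s)

  degreeIn-++ : ∀ u ts us → degreeIn u (ts ++ us) ≡ degreeIn u ts + degreeIn u us
  degreeIn-++ u = wsum-++ _

  degreeIn-snoc : ∀ u ts t → degreeIn u (ts ∷ʳ t) ≡ degreeIn u (t ∷ ts)
  degreeIn-snoc u ts t = trans (degreeIn-++ u ts [ t ])
    (trans (+-comm (degreeIn u ts) _) (cong (_+ degreeIn u ts) (+-identityʳ _)))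

  degreeIn-attach : ∀ u t ts → degreeIn u (map (attach t) ts) ≡ degreeIn u ts
  degreeIn-attach u t = wsum-map _ (attach t)

  weight-attach : ∀ f t u →
    weight f (attach t u) ≡ weight f u + bit (adj G (root t) (root u)) * weight f t
  weight-attach f t (node u us) rewrite symmetric G (root t) u with adj G u (root t)
  ... | false = sym (+-identityʳ _)
  ... | true  = lemma (f u) (weight f t) (weights f us)
    where
    lemma : ∀ a b c → a + (b + c) ≡ a + c + (b + 0)
    lemma = solve-∀

  -- Every neighbour of the root of t receives a copy of t. Covering survives as there is exactly
  -- one copy in degree 1, whereas in degree 0 there is none and t moves to the finished trees.
  weights-attach : ∀ f t ts →
    weights f (map (attach t) ts) ≡ weights f ts + degreeIn (root t) ts * weight f t
  weights-attach f t []       = refl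
  weights-attach f t (u ∷ us)
    rewrite weight-attach f t u | weights-attach f t us =
    lemma (weight f u) (bit (adj G (root t) (root u))) (weight f t) (weights f us) _
    where
    lemma : ∀ a b c d e → a + b * c + (d + e * c) ≡ a + d + (b + e) * c
    lemma = solve-∀

  rooted-attach : ∀ {t u e} → (Adj G (root u) (root t) → Rooted 1 t) →
    Rooted (bit (adj G (root u) (root t)) + e) u → Rooted e (attach t u)
  rooted-attach {t} {node u us} {e} h (rooted deg≡ sub) with adj G u (root t) in eq
  ... | false = rooted deg≡ sub
  ... | true  = rooted (trans deg≡ (+-suc (length us) e)) ((subst T (sym eq) _ , h _) ∷ sub)

  live-attach : ∀ t ts us → All (λ u → Adj G (root u) (root t) → Rooted 1 t) us →
    All (λ u → Rooted (degreeIn (root u) (t ∷ ts)) u) us →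
    All (λ u → Rooted (degreeIn (root u) (map (attach t) ts)) u) (map (attach t) us)
  live-attach t ts []       []       []       = []
  live-attach t ts (u ∷ us) (a ∷ as) (h ∷ hs) =
    subst (λ e → Rooted e (attach t u)) (sym (degreeIn-attach (root u) t ts)) (rooted-attach a h) ∷
    live-attach t ts us as hs

  degreeIn-self : ∀ t ts → degreeIn (root t) (t ∷ ts) ≡ degreeIn (root t) ts
  degreeIn-self t ts = cong (λ b → bit b + degreeIn (root t) ts) (irreflexive G (root t))

  isolated : ∀ t us → degreeIn (root t) us ≡ 0 → All (λ u → Adj G (root u) (root t) → Rooted 1 t) us
  isolated t []       eq = []
  isolated t (u ∷ us) eq =
    (λ u~t → contradiction (trans (sym (m+n≡0⇒m≡0 _ eq))
      (cong bit (trans (symmetric G (root t) (root u)) (T⇒≡ u~t)))) λ ()) ∷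
    isolated t us (m+n≡0⇒n≡0 _ eq)

  advance-invariant : ∀ e t ts ds → degreeIn (root t) ts ≡ e → Invariant (t ∷ ts , ds) →
    Invariant (advance e t (ts , ds))
  advance-invariant zero t ts ds eq
    record { covers = covers ; done = done ; live = h ∷ hs } = record
    { covers = λ f → begin
        weights f (map (attach t) ts) + (weight f t + weights f ds)
          ≡⟨ cong (_+ (weight f t + weights f ds))
               (trans (weights-attach f t ts) (cong (λ e → weights f ts + e * weight f t) eq)) ⟩
        weights f ts + 0 + (weight f t + weights f ds)
          ≡⟨ lemma (weights f ts) (weight f t) (weights f ds) ⟩
        weight f t + weights f ts + weights f ds  ≡⟨ covers f ⟩
        total f                                   ∎
    ; done   = subst (λ e → Rooted e t) (trans (degreeIn-self t ts) eq) h ∷ done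
    ; live   = live-attach t ts ts (isolated t ts eq) hs
    }
    where
    open ≡-Reasoning
    lemma : ∀ a b c → a + 0 + (b + c) ≡ b + a + c
    lemma = solve-∀
  advance-invariant (suc zero) t ts ds eq
    record { covers = covers ; done = done ; live = h ∷ hs } = record
    { covers = λ f → begin
        weights f (map (attach t) ts) + weights f ds
          ≡⟨ cong (_+ weights f ds)
               (trans (weights-attach f t ts) (cong (λ e → weights f ts + e * weight f t) eq)) ⟩
        weights f ts + 1 * weight f t + weights f ds
          ≡⟨ lemma (weights f ts) (weight f t) (weights f ds) ⟩
        weight f t + weights f ts + weights f ds  ≡⟨ covers f ⟩
        total f                                   ∎
    ; done   = done
    ; live   = live-attach t ts ts
        (All.tabulate λ _ _ → subst (λ e → Rooted e t) (trans (degreeIn-self t ts) eq) h) hs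
    }
    where
    open ≡-Reasoning
    lemma : ∀ a b c → a + 1 * b + c ≡ b + a + c
    lemma = solve-∀
  advance-invariant (suc (suc _)) t ts ds eq
    record { covers = covers ; done = done ; live = h ∷ hs } = record
    { covers = λ f → begin
        weights f (ts ∷ʳ t) + weights f ds
          ≡⟨ cong (_+ weights f ds) (weights-++ f ts [ t ]) ⟩
        weights f ts + (weight f t + 0) + weights f ds
          ≡⟨ lemma (weights f ts) (weight f t) (weights f ds) ⟩
        weight f t + weights f ts + weights f ds  ≡⟨ covers f ⟩
        total f                                   ∎
    ; done   = done
    ; live   = All.++⁺ (All.map rotate hs) (rotate h ∷ [])
    }
    where
    open ≡-Reasoning
    lemma : ∀ a b c → a + (b + 0) + c ≡ b + a + c
    lemma = solve-∀
    rotate : ∀ {u} → Rooted (degreeIn (root u) (t ∷ ts)) u → Rooted (degreeIn (root u) (ts ∷ʳ t)) u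
    rotate {u} = subst (λ e → Rooted e u) (sym (degreeIn-snoc (root u) ts t))

  step-invariant : ∀ s → Invariant s → Invariant (step s)
  step-invariant ([] , ds)     I = I
  step-invariant (t ∷ ts , ds) I = advance-invariant _ t ts ds refl I

  initialState : State
  initialState = map (λ v → node v []) (allFin n) , []

  initial-invariant : Invariant initialState
  initial-invariant = record
    { covers = λ f → trans (+-identityʳ _) (trans (leaves f (allFin n)) (wsum-tabulate f id))
    ; done   = []
    ; live   = All.map⁺ (All.tabulate λ {v} _ → rooted (sym (full-degree v)) [])
    }
    where
    leaves : ∀ f vs → weights f (map (λ v → node v []) vs) ≡ wsum f vs
    leaves f []       = refl
    leaves f (v ∷ vs) = cong₂ _+_ (+-identityʳ (f v)) (leaves f vs)
    full-degree : ∀ v → degreeIn v (map (λ v → node v []) (allFin n)) ≡ deg G v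
    full-degree v = trans (wsum-map _ (λ v → node v []) (allFin n))
      (trans (wsum-tabulate (bit ∘ adj G v) id) (sym (card-tabulate (adj G v))))

  iter-invariant : ∀ j s → Invariant s → Invariant (iter j step s)
  iter-invariant zero    s I = I
  iter-invariant (suc j) s I = iter-invariant j (step s) (step-invariant s I)

  length-bound : ∀ {s} → Invariant s → length (proj₁ s) ≤ n
  length-bound {ts , ds} I = begin
    length ts                                     ≡⟨ wsum-one ts ⟨
    wsum (λ _ → 1) ts                             ≤⟨ roots≤weights (λ _ → 1) ts ⟩
    weights (λ _ → 1) ts                          ≤⟨ m≤m+n _ _ ⟩
    weights (λ _ → 1) ts + weights (λ _ → 1) ds   ≡⟨ Invariant.covers I _ ⟩
    total {n} (λ _ → 1)                           ≡⟨ trans (total-const n 1) (*-identityʳ n) ⟩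
    n                                             ∎
    where open ≤-Reasoning

-- Leaves in a forest

module _ {n} (G : Graph n) where

  unique-length : ∀ (vs : List (Fin n)) → Unique vs → length vs ≤ n
  unique-length vs u = Fin.injective⇒≤ (lookup-injective u)
    where
    open import Data.List using () renaming (lookup to _!_)
    open import Data.List.Membership.Propositional.Properties using (∈-lookup)
    lookup-injective : ∀ {vs : List (Fin n)} → Unique vs → ∀ {i j} → vs ! i ≡ vs ! j → i ≡ j
    lookup-injective (_ ∷ _) {zero}  {zero}  eq = refl
    lookup-injective {_ ∷ vs} (h ∷ _) {zero}  {suc j} eq = contradiction eq (lookup h (∈-lookup j))
    lookup-injective {_ ∷ vs} (h ∷ _) {suc i} {zero}  eq = contradiction (sym eq) (lookup h (∈-lookup i))
    lookup-injective (_ ∷ u) {suc i} {suc j} eq = cong suc (lookup-injective u eq)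

  linked-prefix : ∀ {R : Fin n → Fin n → Set} x xs {y ys} → Linked R (x ∷ xs ++ y ∷ ys) →
    Linked R (x ∷ xs ∷ʳ y)
  linked-prefix x []        (r ∷ _)  = r ∷ [-]
  linked-prefix x (x′ ∷ xs) (r ∷ rs) = r ∷ linked-prefix x′ xs rs

  unique-prefix : ∀ xs {y : Fin n} {ys} → Unique (xs ++ y ∷ ys) → Unique xs × All (y ≢_) xs
  unique-prefix []       _       = [] , []
  unique-prefix (x ∷ xs) (h ∷ u) with u′ , h′ ← unique-prefix xs u =
    All.++⁻ˡ xs h ∷ u′ , (λ y≡x → All.head (All.++⁻ʳ xs h) (sym y≡x)) ∷ h′

  module _ (vs : List (Fin n)) (fits : Fits (λ f → wsum f vs))
           (two : ∀ {x} → x ∈ˡ vs → 2 ≤ wsum (bit ∘ adj G x) vs) where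

    -- The neighbours of x contribute at least 2 to the sum over vs, and `fits` at `δ y` lets y
    -- contribute at most 1; some entry is therefore a neighbour other than y.
    onward : ∀ {x} y → x ∈ˡ vs → ∃[ z ] z ∈ˡ vs × Adj G z x × z ≢ y
    onward {x} y x∈ with z , z∈ , lt ← wsum-∃> (bit ∘ adj G x) (δ y) vs
      (≤-trans (s≤s (≤-trans (fits (δ y)) (≤-reflexive (total-δ y)))) (two x∈)) =
      z , z∈ , neighbour , different
      where
      neighbour : Adj G z x
      neighbour rewrite symmetric G z x with adj G x z
      ... | true = _
      ... | false = contradiction lt λ ()
      different : z ≢ y
      different refl with z Fin.≟ z
      ... | yes _  = contradiction (≤-trans lt (bit≤1 (adj G x z))) 1+n≰n
      ... | no z≢z = z≢z refl

    split : ∀ {z : Fin n} {xs} → z ∈ˡ xs → ∃₂ λ ys zs → xs ≡ ys ++ z ∷ zs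
    split (here refl)             = [] , _ , refl
    split {xs = x ∷ _} (there z∈) with ys , zs , refl ← split z∈ = x ∷ ys , zs , refl

    -- A walk that never turns back has to close up.
    walk : ∀ fuel x y p → x ∈ˡ vs → Unique (x ∷ y ∷ p) → Linked (Adj G) (x ∷ y ∷ p) →
      n < fuel + length (x ∷ y ∷ p) → Cycle G
    walk zero x y p x∈ u l lt = contradiction (≤-trans lt (unique-length _ u)) 1+n≰n
    walk (suc fuel) x y p x∈ u l lt with z , z∈ , z~x , z≢y ← onward y x∈
      -- As z differs from y by choice and from x by irreflexivity, a repetition can only lie in p,
      -- which makes the cycle long enough. Without repetitions the fuel n cannot run out, since the
      -- vertices of the walk are distinct.
      with Any.any? (z Fin.≟_) p
    ... | no z∉ = walk fuel z x (y ∷ p) z∈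
      (((λ z≡x → irrefl z≡x z~x) ∷ z≢y ∷ All.¬Any⇒All¬ p z∉) ∷ u) (z~x ∷ l)
      (≤-trans lt (≤-reflexive (sym (+-suc fuel _))))
      where
      irrefl : ∀ {z} → z ≡ x → ¬ Adj G z x
      irrefl refl a = subst T (irreflexive G x) a
    ... | yes z∈p with q , r , refl ← split z∈p = record
      { first    = z
      ; rest     = x ∷ y ∷ q
      ; distinct = proj₂ prefix ∷ proj₁ prefix
      ; long     = s≤s (s≤s z≤n)
      ; linked   = z~x ∷ linked-prefix x (y ∷ q) l
      }
      where prefix = unique-prefix (x ∷ y ∷ q) u

    all-busy⇒cycle : ∀ {x} → x ∈ˡ vs → Cycle G
    all-busy⇒cycle {x} x∈ with y , y∈ , y~x , y≢x ← onward x x∈ =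
      walk n y x [] y∈ ((y≢x ∷ []) ∷ [] ∷ []) (y~x ∷ [-])
        (≤-trans (n≤1+n _) (≤-reflexive (+-comm 2 n)))

-- Termination of the elimination within n² steps

module Termination {n} (G : Graph n) (forest : IsForest G) where

  open Elimination G

  cut-any : ∀ {A : Set} {P : A → Set} {xs} → Any P xs →
    ∃[ ys ] ∃[ x ] ∃[ zs ] xs ≡ ys ++ x ∷ zs × P x
  cut-any (here p)              = [] , _ , _ , refl , p
  cut-any {xs = x ∷ _} (there h) with ys , z , zs , refl , p ← cut-any h = x ∷ ys , z , zs , refl , p

  leaf : ∀ t ts ds → Invariant (t ∷ ts , ds) → Any (λ u → degreeIn (root u) (t ∷ ts) ≤ 1) (t ∷ ts)
  leaf t ts ds I with Any.any? (λ u → degreeIn (root u) (t ∷ ts) ≤? 1) (t ∷ ts)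
  ... | yes h  = h
  ... | no  no-leaf = contradiction
    (all-busy⇒cycle G (map root (t ∷ ts)) fits two (here refl)) forest
    where
    fits : Fits (λ f → wsum f (map root (t ∷ ts)))
    fits f = begin
      wsum f (map root (t ∷ ts))              ≡⟨ wsum-map f root (t ∷ ts) ⟩
      wsum (f ∘ root) (t ∷ ts)                ≤⟨ roots≤weights f (t ∷ ts) ⟩
      weights f (t ∷ ts)                      ≤⟨ m≤m+n _ (weights f ds) ⟩
      weights f (t ∷ ts) + weights f ds       ≡⟨ Invariant.covers I f ⟩
      total f                                 ∎
      where open ≤-Reasoning
    two : ∀ {x} → x ∈ˡ map root (t ∷ ts) → 2 ≤ wsum (bit ∘ adj G x) (map root (t ∷ ts))
    two x∈ = subst (2 ≤_) (sym (wsum-map _ root (t ∷ ts)))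
      (lookup busy x∈)
      where
      busy : All (λ x → 2 ≤ degreeIn x (t ∷ ts)) (map root (t ∷ ts))
      busy = All.map⁺ (All.map ≰⇒> (All.¬Any⇒All¬ (t ∷ ts) no-leaf))

  shrinks : ∀ t ts ds → degreeIn (root t) ts ≤ 1 → length (proj₁ (step (t ∷ ts , ds))) ≡ length ts
  shrinks t ts ds h with degreeIn (root t) ts
  ... | zero     = length-map (attach t) ts
  ... | suc zero = length-map (attach t) ts
  shrinks t ts ds (s≤s ()) | suc (suc _)

  rotates : ∀ t ts ds → ¬ degreeIn (root t) ts ≤ 1 → step (t ∷ ts , ds) ≡ (ts ∷ʳ t , ds)
  rotates t ts ds h with degreeIn (root t) ts
  ... | zero        = contradiction z≤n h
  ... | suc zero    = contradiction ≤-refl h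
  ... | suc (suc _) = refl

  degreeIn-rotate : ∀ x t ts us → degreeIn x ((t ∷ ts) ++ us) ≡ degreeIn x (ts ++ (us ∷ʳ t))
  degreeIn-rotate x t ts us = begin
    degreeIn x (t ∷ ts ++ us)       ≡⟨ degreeIn-snoc x (ts ++ us) t ⟨
    degreeIn x ((ts ++ us) ∷ʳ t)    ≡⟨ cong (degreeIn x) (++-assoc ts us [ t ]) ⟩
    degreeIn x (ts ++ (us ∷ʳ t))    ∎
    where
    open ≡-Reasoning

  -- Rotation leaves all degrees unchanged, so u still has degree at most 1 when it reaches the
  -- front, unless some tree of xs is eliminated before. Either way exactly one tree disappears.
  round : ∀ xs u ys ds → degreeIn (root u) (xs ++ u ∷ ys) ≤ 1 →
    ∃[ j ] j ≤ length xs × length (proj₁ (iter (suc j) step (xs ++ u ∷ ys , ds))) ≡ length xs + length ys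
  round []       u ys ds h =
    0 , z≤n , shrinks u ys ds (subst (_≤ 1) (degreeIn-self u ys) h)
  round (x ∷ xs) u ys ds h with degreeIn (root x) (xs ++ u ∷ ys) ≤? 1
  ... | yes h′ = 0 , z≤n , trans (shrinks x (xs ++ u ∷ ys) ds h′)
    (trans (length-++ xs) (+-suc (length xs) (length ys)))
  ... | no h′ with j , j≤ , eq ← round xs u (ys ∷ʳ x) ds
        (subst (_≤ 1) (degreeIn-rotate (root u) x xs (u ∷ ys)) h) =
    suc j , s≤s j≤ , (begin
      length (proj₁ (iter (suc j) step (step (x ∷ xs ++ u ∷ ys , ds))))
        ≡⟨ cong (λ s → length (proj₁ (iter (suc j) step s)))
             (trans (rotates x (xs ++ u ∷ ys) ds h′) (cong (_, ds) (++-assoc xs (u ∷ ys) [ x ]))) ⟩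
      length (proj₁ (iter (suc j) step (xs ++ u ∷ (ys ∷ʳ x) , ds)))  ≡⟨ eq ⟩
      length xs + length (ys ∷ʳ x)
        ≡⟨ cong (length xs +_) (trans (length-++ ys) (+-comm (length ys) 1)) ⟩
      length xs + suc (length ys)                                    ≡⟨ +-suc _ _ ⟩
      suc (length xs + length ys)                                    ∎)
    where
    open ≡-Reasoning

  -- A round takes at most as many steps as there are live trees, hence at most n, and there are at
  -- most m rounds.
  eliminates : ∀ m s → Invariant s → length (proj₁ s) ≤ m →
    ∃[ j ] j ≤ m * n × proj₁ (iter j step s) ≡ []
  eliminates m ([] , ds) I le = 0 , z≤n , refl
  eliminates (suc m) s@(t ∷ ts , ds) I le
    with xs , u , ys , eq , h ← cut-any {P = λ u → degreeIn (root u) (t ∷ ts) ≤ 1} (leaf t ts ds I)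
    with j , j≤ , len ← round xs u ys ds (subst (λ us → degreeIn (root u) us ≤ 1) eq h)
    with i , i≤ , empty ← eliminates m (iter (suc j) step s) (iter-invariant (suc j) s I)
      (≤-trans (≤-reflexive (trans (cong (λ us → length (proj₁ (iter (suc j) step (us , ds)))) eq) len))
        (≤-pred (≤-trans (≤-reflexive (sym (trans (cong length eq)
          (trans (length-++ xs) (+-suc (length xs) _))))) le))) =
    suc j + i ,
    +-mono-≤ (≤-trans (s≤s j≤) (≤-trans (s≤s (m≤m+n (length xs) (length ys)))
      (≤-trans (≤-reflexive (sym (trans (cong length eq) (trans (length-++ xs) (+-suc (length xs) _)))))
        (length-bound I)))) i≤ ,
    trans (cong proj₁ (iter-+ (suc j) i step s)) empty

  stays-empty : ∀ j ds → iter j step ([] , ds) ≡ ([] , ds)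
  stays-empty zero    ds = refl
  stays-empty (suc j) ds = stays-empty j ds

  -- The program makes a fixed number of steps in any case; those after the last elimination do
  -- nothing.
  finished : ∀ N → n * n ≤ N → proj₁ (iter N step initialState) ≡ []
  finished N le with j , j≤ , empty ← eliminates n initialState initial-invariant
                                         (length-bound initial-invariant)
    = begin
      proj₁ (iter N step initialState)
        ≡⟨ cong (λ N → proj₁ (iter N step initialState)) (m+[n∸m]≡n (≤-trans j≤ le)) ⟨
      proj₁ (iter (j + k) step initialState)          ≡⟨ cong proj₁ (iter-+ j k step initialState) ⟩
      proj₁ (iter k step (iter j step initialState))
        ≡⟨ cong (λ ts → proj₁ (iter k step (ts , proj₂ (iter j step initialState)))) empty ⟩
      proj₁ (iter k step ([] , _))                    ≡⟨ cong proj₁ (stays-empty k _) ⟩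
      []                                              ∎
    where
    open ≡-Reasoning
    k = N ∸ j

-- The maximum over all thresholds

module _ {n : ℕ} .{{_ : NonZero n}} (t : ℚ) .{{_ : Positive t}} where

  Affordable : ℕ → Set
  Affordable s = s * ↧ₙ t ≤ n * ℤ.∣ ↥ t ∣

-- Division reduces the fraction to lowest terms, so the comparison is moved to unnormalised
-- rationals, where the order is cross-multiplication by definition.
fraction≤⇒affordable : ∀ {n} .{{_ : NonZero n}} t .{{_ : Positive t}} s →
  (ℤ.+ s) ℚ./ n ℚ.≤ t → Affordable {n} t s
fraction≤⇒affordable {suc n} t@(mkℚ (ℤ.+ suc k) d _) s le
  with ℚᵘ.≤-respˡ-≃ (ℚ.toℚᵘ-fromℚᵘ (ℚᵘ.mkℚᵘ (ℤ.+ s) n)) (ℚ.toℚᵘ-mono-≤ le)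
... | ℚᵘ.*≤* h = ≤-trans (ℤ.drop‿+≤+ (subst₂ ℤ._≤_ (sym (ℤ.pos-* s (suc d)))
        (sym (ℤ.pos-* (suc k) (suc n))) h)) (≤-reflexive (*-comm (suc k) (suc n)))

affordable⇒fraction≤ : ∀ {n} .{{_ : NonZero n}} t .{{_ : Positive t}} s →
  Affordable {n} t s → (ℤ.+ s) ℚ./ n ℚ.≤ t
affordable⇒fraction≤ {suc n} t@(mkℚ (ℤ.+ suc k) d _) s le =
  ℚ.toℚᵘ-cancel-≤ (ℚᵘ.≤-respˡ-≃ (ℚᵘ.≃-sym (ℚ.toℚᵘ-fromℚᵘ (ℚᵘ.mkℚᵘ (ℤ.+ s) n)))
    (ℚᵘ.*≤* (subst₂ ℤ._≤_ (ℤ.pos-* s (suc d)) (ℤ.pos-* (suc k) (suc n))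
      (ℤ.+≤+ (≤-trans le (≤-reflexive (*-comm (suc n) (suc k))))))))

affordable-≤ : ∀ {n} .{{_ : NonZero n}} t .{{_ : Positive t}} {s s′} → s ≤ s′ →
  Affordable {n} t s′ → Affordable {n} t s
affordable-≤ t le h = ≤-trans (*-monoˡ-≤ (↧ₙ t) le) h

module _ {n} .{{_ : NonZero n}} (G : Graph n) (t : ℚ) .{{_ : Positive t}} where

  open Matching G

  module _ {ts} (rooted : All (Rooted 0) ts) (covers : ∀ f → weights f ts ≡ total f) where

    covers-≤ : ∀ f → weights f ts ≤ total f
    covers-≤ f = ≤-reflexive (covers f)

    module Optimal (τ : Fin n → ℕ) (τ≤deg : IsThreshold G τ) where

      open Spread G τ
      open Greedy G τ τ≤deg

      result : Result ts
      result = greedyAll rooted covers-≤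
      open Result result public

      dynamo-spreads : IsDynamo G τ dynamo
      dynamo-spreads = reached⇒dynamo dynamo λ v → everywhere-at-list v (reached dynamo id)
        (≤-reflexive (sym (trans (covers (δ v)) (total-δ v))))

      affordable : average τ ℚ.≤ t → Affordable {n} t c
      affordable avg = affordable-≤ t (≤-trans cheap (≤-reflexive (covers τ)))
        (fraction≤⇒affordable t (total τ) (subst (λ s → (ℤ.+ s) ℚ./ n ℚ.≤ t) (sum-tabulate τ) avg))

    -- The threshold defined by M must have dynamo number exactly m, but M itself only shows that
    -- its dynamos have at least m vertices. The other inequality comes from the greedy dynamo for
    -- the same threshold: its matching is affordable too, and so has at most m edges by maximality.
    matching-maximum⇒Ldyn : ∀ {m} →
      ∃[ c ] MatchesAll ts m c × Affordable {n} t c →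
      (∀ {k c} → MatchesAll ts k c → Affordable {n} t c → k ≤ m) →
      IsLdyn G t m
    matching-maximum⇒Ldyn {m} (c , M , cheap) max =
      (τ , τ≤deg , avg , (τ-dynamo , dyn , ≤-antisym small (large τ-dynamo dyn)) ,
        λ { _ (D , dyn′ , refl) → large D dyn′ }) ,
      λ { k (τ′ , τ′≤deg , avg′ , _ , min) → let open Optimal τ′ τ′≤deg in
          ≤-trans (min _ (dynamo , dynamo-spreads , refl))
            (≤-trans (Optimal.small τ′ τ′≤deg) (max matches (affordable avg′))) }
      where
      edges-M = matchesAll⇒edges rooted M
      open Edges edges-M
      fits′ : ∀ f → wsum (ends f) edges ≤ total f
      fits′ f = ≤-trans (fits f) (covers-≤ f)
      τ = waiting edges
      τ≤deg : IsThreshold G τ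
      τ≤deg = waiting-threshold edges fits′
      avg : average τ ℚ.≤ t
      avg = subst (λ s → (ℤ.+ s) ℚ./ n ℚ.≤ t)
        (sym (trans (sum-tabulate τ) (trans (total-waiting edges) degrees)))
        (affordable⇒fraction≤ t c cheap)
      open Optimal τ τ≤deg using () renaming (dynamo to τ-dynamo; dynamo-spreads to dyn)
      small : ∣ τ-dynamo ∣ ≤ m
      small = ≤-trans (Optimal.small τ τ≤deg) (max (Optimal.matches τ τ≤deg) (Optimal.affordable τ τ≤deg avg))
      large : ∀ D → IsDynamo G τ D → m ≤ ∣ D ∣
      large D dyn′ = subst (_≤ ∣ D ∣) number (dynamo-large adjacent fits′ dyn′)

-- Derived terms

pattern v0 = var (here refl)
pattern v1 = var (there (here refl))
pattern v2 = var (there (there (here refl)))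
pattern v3 = var (there (there (there (here refl))))
pattern v4 = var (there (there (there (there (here refl)))))
pattern v5 = var (there (there (there (there (there (here refl))))))
pattern v6 = var (there (there (there (there (there (there (here refl)))))))
pattern v7 = var (there (there (there (there (there (there (there (here refl))))))))

module _ {Γ : Ctx} where

  weaken : ∀ {A B} → Tm Γ A → Tm (B ∷ Γ) A
  weaken = ren (drop same)

  falseT trueT : Tm Γ bool
  falseT = const falseᶜ
  trueT  = const trueᶜ

  zeroT : Tm Γ nat
  zeroT = const zeroᶜ

  nilT : ∀ {A} → Tm Γ (list A)
  nilT = const nilᶜ

  sucT : Tm Γ nat → Tm Γ nat
  sucT = unary sucᶜ

  fstT : ∀ {A B} → Tm Γ (A ⊗ B) → Tm Γ A
  fstT = unary fstᶜ

  sndT : ∀ {A B} → Tm Γ (A ⊗ B) → Tm Γ B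
  sndT = unary sndᶜ

  pairT : ∀ {A B} → Tm Γ A → Tm Γ B → Tm Γ (A ⊗ B)
  pairT = binary pairᶜ

  consT : ∀ {A} → Tm Γ A → Tm Γ (list A) → Tm Γ (list A)
  consT = binary consᶜ

module _ {Γ : Ctx} where

  -- Three nested loops over the extended rows; all folds below are built on this one loop of N
  -- rounds.
  repeat : ∀ {A} → Tm Γ A → Tm (A ∷ Γ) A → Tm Γ A
  repeat z b = rep rows z (rep rows v0 (rep rows v0 (ren (keep (drop (drop same))) b)))

  -- The remaining count is carried along with the value; once it is zero, the rounds left over are
  -- idle.
  natFold : ∀ {A} → Tm Γ nat → Tm Γ A → Tm (A ∷ Γ) A → Tm Γ A
  natFold c z b = sndT (repeat (pairT c z) (caseNat (fstT v0) v0
    (pairT v0 (bind (sndT v1) (ren (keep (drop (drop same))) b)))))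

  foldlT : ∀ {A B} → Tm Γ (list B) → Tm Γ A → Tm (B ∷ A ∷ Γ) A → Tm Γ A
  foldlT xs z b = sndT (repeat (pairT xs z) (caseList (fstT v0) v0
    (pairT v1 (bind (sndT v2) (bind v1 (ren (keep (keep (drop (drop (drop same))))) b))))))

module _ {Γ : Ctx} where

  foldrT : ∀ {A B} → Tm Γ (list B) → Tm Γ A → Tm (B ∷ A ∷ Γ) A → Tm Γ A
  foldrT xs z b = foldlT (foldlT xs nilT (consT v0 v1)) z b

  addT monusT minT : Tm Γ nat → Tm Γ nat → Tm Γ nat
  addT a b   = natFold a b (sucT v0)
  monusT a b = natFold b a (caseNat v0 zeroT v0)
  minT a b   = caseNat (monusT a b) a (weaken b)

  -- Swapping the components while incrementing one of them serves the two in turn; started at (0 ,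
  -- 0), this yields the floor and the ceiling of one half.
  halvesT : Tm Γ nat → Tm Γ (nat ⊗ nat)
  halvesT a = natFold a (pairT zeroT zeroT) (pairT (sndT v0) (sucT (fstT v0)))

  mapT : ∀ {A B} → Tm Γ (list A) → Tm (A ∷ Γ) B → Tm Γ (list B)
  mapT xs b = foldrT xs nilT (consT (ren (keep (drop same)) b) v1)

  snocT : ∀ {A} → Tm Γ (list A) → Tm Γ A → Tm Γ (list A)
  snocT xs x = foldrT xs (consT x nilT) (consT v0 v1)

  countT : Tm Γ (list bool) → Tm Γ nat
  countT xs = foldrT xs zeroT (branch v0 (sucT v1) v1)

  lengthT : ∀ {A} → Tm Γ (list A) → Tm Γ nat
  lengthT xs = foldrT xs zeroT (sucT v1)

module _ {Γ : Ctx} where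

  -- One pass over xs collects the minima in reverse and keeps what remains of ys; a second pass
  -- puts them back in order in front of that remainder.
  zipMinT : Tm Γ (list nat) → Tm Γ (list nat) → Tm Γ (list nat)
  zipMinT xs ys = bind
    (foldlT xs (pairT ys nilT) (caseList (fstT v1)
      (pairT nilT (consT v0 (sndT v1)))
      (pairT v1 (consT (minT v2 v0) (sndT v3)))))
    (foldlT (sndT v0) (fstT v0) (consT v0 v1))

module _ {Γ : Ctx} where

  mergeT : Tm Γ (list nat) → Tm Γ (list nat) → Tm Γ (list nat)
  mergeT xs ys = caseList xs nilT (consT v0 (zipMinT v1 (weaken (weaken ys))))

module _ {Γ : Ctx} where

  convT : Tm Γ (list nat) → Tm Γ (list nat) → Tm Γ (list nat)
  convT xs ys = foldrT xs nilT
    (mergeT (mapT (weaken (weaken ys)) (addT v1 v0)) v1)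

-- Tables of costs and their (min,+)-convolution

-- A table xs lists, for each k, the least cost xs [ k ] of a matching with
-- k edges; conv is the (min,+)-convolution.

zipMin : List ℕ → List ℕ → List ℕ
zipMin []       ys       = ys
zipMin (x ∷ xs) []       = x ∷ xs
zipMin (x ∷ xs) (y ∷ ys) = x ⊓ y ∷ zipMin xs ys

-- In ys one edge is left out of the count.
merge : List ℕ → List ℕ → List ℕ
merge []       ys = []
merge (x ∷ xs) ys = x ∷ zipMin xs ys

conv : List ℕ → List ℕ → List ℕ
conv xs ys = foldr (λ x → merge (map (x +_) ys)) [] xs

record Within (l b : ℕ) (xs : List ℕ) : Set where
  constructor within
  field
    len : length xs ≤ l
    ent : All (_≤ b) xs

within-≤ : ∀ {l b l′ b′ xs} → l ≤ l′ → b ≤ b′ → Within l b xs → Within l′ b′ xs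
within-≤ l≤ b≤ (within l e) = within (≤-trans l l≤) (All.map (λ h → ≤-trans h b≤) e)

zipMin-within : ∀ {l b} xs ys → Within l b xs → Within l b ys → Within l b (zipMin xs ys)
zipMin-within []       ys       _ w = w
zipMin-within (x ∷ xs) []       w _ = w
zipMin-within {suc l} (x ∷ xs) (y ∷ ys) (within (s≤s k) (h ∷ hs)) (within (s≤s k′) (_ ∷ hs′))
  with within k″ hs″ ← zipMin-within xs ys (within k hs) (within k′ hs′) =
  within (s≤s k″) (≤-trans (m⊓n≤m x y) h ∷ hs″)

merge-within : ∀ {l b} xs ys → Within (suc l) b xs → Within l b ys → Within (suc l) b (merge xs ys)
merge-within []       ys _ _ = within z≤n []
merge-within (x ∷ xs) ys (within (s≤s k) (h ∷ hs)) w
  with within k′ hs′ ← zipMin-within xs ys (within k hs) w = within (s≤s k′) (h ∷ hs′)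

map-within : ∀ {l b x a xs} → x ≤ a → Within l b xs → Within l (a + b) (map (x +_) xs)
map-within {x = x} {xs = xs} x≤a (within k hs) =
  within (≤-trans (≤-reflexive (length-map (x +_) xs)) k) (All.map⁺ (All.map (+-mono-≤ x≤a) hs))

-- Lengths are written as `suc l` because l is then the largest number of edges, and these numbers
-- add up under convolution.
conv-within : ∀ {l b l′ b′} xs ys → Within (suc l) b xs → Within (suc l′) b′ ys →
  Within (suc (l + l′)) (b + b′) (conv xs ys)
conv-within []           ys _ _ = within z≤n []
conv-within {zero} (x ∷ []) ys (within _ (h ∷ _)) w =
  merge-within (map (x +_) ys) [] (map-within h w) (within z≤n [])
conv-within {suc l} {l′ = l′} (x ∷ xs) ys (within (s≤s k) (h ∷ hs)) w =
  merge-within (map (x +_) ys) (conv xs ys)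
    (within-≤ (s≤s (m≤n+m l′ (suc l))) ≤-refl (map-within h w))
    (conv-within xs ys (within k hs) w)
conv-within {zero} (_ ∷ _ ∷ _) ys (within (s≤s ()) _) w

data _[_]=_ : List ℕ → ℕ → ℕ → Set where
  here  : ∀ {x xs} → (x ∷ xs) [ 0 ]= x
  there : ∀ {x xs k c} → xs [ k ]= c → (x ∷ xs) [ suc k ]= c

infix 4 _[_]=_ _[_]≤_

_[_]≤_ : List ℕ → ℕ → ℕ → Set
xs [ k ]≤ c = ∃[ c′ ] xs [ k ]= c′ × c′ ≤ c

there≤ : ∀ {x xs k c} → xs [ k ]≤ c → (x ∷ xs) [ suc k ]≤ c
there≤ (c′ , h , le) = c′ , there h , le

zipMin-sound : ∀ xs ys {k c} → zipMin xs ys [ k ]= c → xs [ k ]= c ⊎ ys [ k ]= c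
zipMin-sound []       ys       h = inj₂ h
zipMin-sound (x ∷ xs) []       h = inj₁ h
zipMin-sound (x ∷ xs) (y ∷ ys) here with ⊓-sel x y
... | inj₁ eq rewrite eq = inj₁ here
... | inj₂ eq rewrite eq = inj₂ here
zipMin-sound (x ∷ xs) (y ∷ ys) (there h) with zipMin-sound xs ys h
... | inj₁ h′ = inj₁ (there h′)
... | inj₂ h′ = inj₂ (there h′)

zipMin-left : ∀ xs ys {k c} → xs [ k ]≤ c → zipMin xs ys [ k ]≤ c
zipMin-left (x ∷ xs) []       h = h
zipMin-left (x ∷ xs) (y ∷ ys) (_ , here , le)    = _ , here , ≤-trans (m⊓n≤m x y) le
zipMin-left (x ∷ xs) (y ∷ ys) (_ , there h , le) = there≤ (zipMin-left xs ys (_ , h , le))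

zipMin-right : ∀ xs ys {k c} → ys [ k ]≤ c → zipMin xs ys [ k ]≤ c
zipMin-right []       ys       h = h
zipMin-right (x ∷ xs) (y ∷ ys) (_ , here , le)    = _ , here , ≤-trans (m⊓n≤n x y) le
zipMin-right (x ∷ xs) (y ∷ ys) (_ , there h , le) = there≤ (zipMin-right xs ys (_ , h , le))

data Shifted (P : ℕ → ℕ → Set) : ℕ → ℕ → Set where
  shifted : ∀ {k c} → P k c → Shifted P (suc k) c

merge-sound : ∀ xs ys {k c} → merge xs ys [ k ]= c → xs [ k ]= c ⊎ Shifted (ys [_]=_) k c
merge-sound (x ∷ xs) ys here = inj₁ here
merge-sound (x ∷ xs) ys (there h) with zipMin-sound xs ys h
... | inj₁ h′ = inj₁ (there h′)
... | inj₂ h′ = inj₂ (shifted h′)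

merge-left : ∀ xs ys {k c} → xs [ k ]≤ c → merge xs ys [ k ]≤ c
merge-left (x ∷ xs) ys (_ , here , le)    = _ , here , le
merge-left (x ∷ xs) ys (_ , there h , le) = there≤ (zipMin-left xs ys (_ , h , le))

-- The given entry of xs guarantees that xs is not empty, in which case `merge` would discard ys.
merge-right : ∀ xs ys {j d k c} → xs [ j ]= d → ys [ k ]≤ c → merge xs ys [ suc k ]≤ c
merge-right (x ∷ xs) ys _ h = there≤ (zipMin-right xs ys h)

map-sound : ∀ a xs {k c} → map (a +_) xs [ k ]= c → ∃[ d ] xs [ k ]= d × c ≡ a + d
map-sound a (x ∷ xs) here      = x , here , refl
map-sound a (x ∷ xs) (there h) with d , h′ , eq ← map-sound a xs h = d , there h′ , eq

map-complete : ∀ a {xs k c} → xs [ k ]= c → map (a +_) xs [ k ]= a + c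
map-complete a here      = here
map-complete a (there h) = there (map-complete a h)

map-complete-≤ : ∀ {a xs k c} → xs [ k ]≤ c → map (a +_) xs [ k ]≤ a + c
map-complete-≤ {a} (_ , h , le) = _ , map-complete a h , +-monoʳ-≤ a le

conv-sound : ∀ xs ys {k c} → conv xs ys [ k ]= c →
  ∃₂ λ i a → ∃₂ λ j b → xs [ i ]= a × ys [ j ]= b × k ≡ i + j × c ≡ a + b
conv-sound (x ∷ xs) ys h with merge-sound (map (x +_) ys) (conv xs ys) h
... | inj₁ h′ with b , h″ , eq ← map-sound x ys h′ = 0 , x , _ , b , here , h″ , refl , eq
... | inj₂ (shifted h′) with i , a , j , b , p , q , refl , eq ← conv-sound xs ys h′ =
  suc i , a , j , b , there p , q , refl , eq

conv-complete : ∀ {xs ys i a j b} → xs [ i ]= a → ys [ j ]= b → conv xs ys [ i + j ]≤ a + b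
conv-complete {x ∷ xs} {ys} here q = merge-left (map (x +_) ys) (conv xs ys) (_ , map-complete x q , ≤-refl)
conv-complete {x ∷ xs} {ys} (there p) q =
  merge-right (map (x +_) ys) (conv xs ys) (map-complete x q) (conv-complete p q)

conv-complete-≤ : ∀ {xs ys i a j b} → xs [ i ]≤ a → ys [ j ]≤ b → conv xs ys [ i + j ]≤ a + b
conv-complete-≤ (_ , p , p≤) (_ , q , q≤) with c , h , le ← conv-complete p q =
  c , h , ≤-trans le (+-mono-≤ p≤ q≤)

-- Tables of the cheapest matchings in a forest

module Tables {n} (G : Graph n) where

  open Matching G

  table : Mode → Rose (Fin n) → List ℕ
  tableAt : Mode → Fin n → List (Rose (Fin n)) → List ℕ
  table m (node v ts) = tableAt m v ts
  tableAt m    v []       = 0 ∷ []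
  tableAt free v (t ∷ ts) = conv (table any t) (tableAt free v ts)
  tableAt any  v (t ∷ ts) = merge (conv (table any t) (tableAt any v ts))
    (map (deg G v + deg G (root t) +_) (conv (table free t) (tableAt free v ts)))

  tableAll : List (Rose (Fin n)) → List ℕ
  tableAll []       = 0 ∷ []
  tableAll (t ∷ ts) = conv (table any t) (tableAll ts)

  table-sound : ∀ m t {k c} → table m t [ k ]= c → Matches m t k c
  tableAt-sound : ∀ m v ts {k c} → tableAt m v ts [ k ]= c → Matches m (node v ts) k c
  table-sound m (node v ts) h = tableAt-sound m v ts h
  tableAt-sound free v []       here = bare
  tableAt-sound any  v []       here = bare
  tableAt-sound free v (t ∷ ts) h
    with _ , _ , _ , _ , p , q , refl , refl ← conv-sound (table any t) _ h =
    skip (table-sound any t p) (tableAt-sound free v ts q)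
  tableAt-sound any v (t ∷ ts) h with merge-sound (conv (table any t) _) _ h
  ... | inj₁ h′ with _ , _ , _ , _ , p , q , refl , refl ← conv-sound (table any t) _ h′ =
    skip (table-sound any t p) (tableAt-sound any v ts q)
  ... | inj₂ (shifted h′) with _ , h″ , refl ← map-sound _ (conv (table free t) _) h′
    with _ , _ , _ , _ , p , q , refl , refl ← conv-sound (table free t) _ h″ =
    edge (table-sound free t p) (tableAt-sound free v ts q)

  tableAll-sound : ∀ ts {k c} → tableAll ts [ k ]= c → MatchesAll ts k c
  tableAll-sound []       here = []
  tableAll-sound (t ∷ ts) h
    with _ , _ , _ , _ , p , q , refl , refl ← conv-sound (table any t) _ h =
    table-sound any t p ∷ tableAll-sound ts q

  -- This is the empty matching. It also shows that tables are never empty, as `merge-right`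
  -- demands.
  table-zero : ∀ m t → table m t [ 0 ]≤ 0
  tableAt-zero : ∀ m v ts → tableAt m v ts [ 0 ]≤ 0
  table-zero m (node v ts) = tableAt-zero m v ts
  tableAt-zero m    v []       = 0 , here , z≤n
  tableAt-zero free v (t ∷ ts) = conv-complete-≤ (table-zero any t) (tableAt-zero free v ts)
  tableAt-zero any  v (t ∷ ts) = merge-left (conv (table any t) _) _
    (conv-complete-≤ (table-zero any t) (tableAt-zero any v ts))

  table-complete : ∀ {m t k c} → Matches m t k c → table m t [ k ]≤ c
  table-complete (bare {m} {v}) = tableAt-zero m v []
  table-complete {free} (skip M M′) = conv-complete-≤ (table-complete M) (table-complete M′)
  table-complete {any} (skip {t = t} M M′) = merge-left (conv (table any t) _) _
    (conv-complete-≤ (table-complete M) (table-complete M′))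
  table-complete (edge {v} {t} {ts} M M′) =
    merge-right (conv (table any t) _) _
      (proj₁ (proj₂ (conv-complete-≤ (table-zero any t) (tableAt-zero any v ts))))
      (map-complete-≤ (conv-complete-≤ (table-complete M) (table-complete M′)))

  tableAll-complete : ∀ {ts k c} → MatchesAll ts k c → tableAll ts [ k ]≤ c
  tableAll-complete []       = 0 , here , z≤n
  tableAll-complete (M ∷ Ms) = conv-complete-≤ (table-complete M) (tableAll-complete Ms)

  tableAll-zero : ∀ ts → tableAll ts [ 0 ]≤ 0
  tableAll-zero []       = 0 , here , z≤n
  tableAll-zero (t ∷ ts) = conv-complete-≤ (table-zero any t) (tableAll-zero ts)

  order : Rose (Fin n) → ℕ
  order = weight (λ _ → 1)

  orders : List (Rose (Fin n)) → ℕ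
  orders = weights (λ _ → 1)

  degrees≤2n : ∀ u v → deg G u + deg G v ≤ 2 * n
  degrees≤2n u v = +-mono-≤ (∣p∣≤n (neighbours G u))
    (≤-trans (∣p∣≤n (neighbours G v)) (≤-reflexive (sym (+-identityʳ n))))

  -- Each edge is charged to its lower end, which lies in ts, and costs at most 2 n. Hence v itself
  -- enters neither bound.
  tableAt-within : ∀ m v ts → Within (suc (orders ts)) (2 * n * orders ts) (tableAt m v ts)
  tableAt-within m    v []       = within ≤-refl (z≤n ∷ [])
  tableAt-within free v (node r us ∷ ts) = within-≤ (s≤s (n≤1+n _)) bound
    (conv-within (tableAt any r us) (tableAt free v ts)
      (tableAt-within any r us) (tableAt-within free v ts))
    where
    bound : 2 * n * orders us + 2 * n * orders ts ≤ 2 * n * (suc (orders us) + orders ts)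
    bound = ≤-trans (≤-reflexive (sym (*-distribˡ-+ (2 * n) (orders us) _)))
      (*-monoʳ-≤ (2 * n) (n≤1+n _))
  tableAt-within any v (node r us ∷ ts) = merge-within (conv (tableAt any r us) _) _
    (within-≤ (s≤s (n≤1+n _)) (≤-trans (m≤n+m _ (2 * n)) (≤-reflexive (sym bound)))
      (conv-within (tableAt any r us) (tableAt any v ts)
        (tableAt-within any r us) (tableAt-within any v ts)))
    (within-≤ ≤-refl (≤-reflexive (sym bound)) (map-within (degrees≤2n v r)
      (conv-within (tableAt free r us) (tableAt free v ts)
        (tableAt-within free r us) (tableAt-within free v ts))))
    where
    bound : 2 * n * (suc (orders us) + orders ts) ≡ 2 * n + (2 * n * orders us + 2 * n * orders ts)
    bound = lemma (2 * n) (orders us) (orders ts)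
      where
      lemma : ∀ m a b → m * (suc a + b) ≡ m + (m * a + m * b)
      lemma = solve-∀

  tableAll-within : ∀ ts → Within (suc (orders ts)) (2 * n * orders ts) (tableAll ts)
  tableAll-within []                = within ≤-refl (z≤n ∷ [])
  tableAll-within (node r us ∷ ts) = within-≤ (s≤s (n≤1+n _))
    (≤-trans (≤-reflexive (sym (*-distribˡ-+ (2 * n) (orders us) _))) (*-monoʳ-≤ (2 * n) (n≤1+n _)))
    (conv-within (tableAt any r us) (tableAll ts) (tableAt-within any r us) (tableAll-within ts))

-- Evaluation of the derived terms

iter-* : ∀ {A : Set} i j (f : A → A) x → iter i (iter j f) x ≡ iter (i * j) f x
iter-* zero    j f x = refl
iter-* (suc i) j f x = trans (iter-* i j f (iter j f x)) (sym (iter-+ j (i * j) f x))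

iter-simulates : ∀ {S A : Set} (π : S → A) (P : S → Set) {f : S → S} {g : A → A} →
  (∀ s → P s → g (π s) ≡ π (f s) × P (f s)) →
  ∀ k s → P s → iter k g (π s) ≡ π (iter k f s)
iter-simulates π P h zero    s p = refl
iter-simulates π P {f} {g} h (suc k) s p with eq , p′ ← h s p =
  trans (cong (iter k g) eq) (iter-simulates π P h k (f s) p′)

iter-cong : ∀ {A : Set} {f g : A → A} → (∀ x → f x ≡ g x) → ∀ k x → iter k f x ≡ iter k g x
iter-cong {f = f} {g} h zero    x = refl
iter-cong {f = f} {g} h (suc k) x = trans (cong (iter k f) (h x)) (iter-cong h k (g x))

countdown : ∀ {A : Set} (f : A → A) N k x → k ≤ N →
  iter N (λ (k , x) → elimNat (k , x) (λ k′ → k′ , f x) k) (k , x) ≡ (0 , iter k f x)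
countdown f zero    zero    x le = refl
countdown f (suc N) zero    x le = countdown f N zero x z≤n
countdown f (suc N) (suc k) x (s≤s le) = countdown f N k (f x) le

unroll : ∀ {A B : Set} (f : A → B → A) N a bs → length bs ≤ N →
  iter N (λ (bs , a) → elimList (bs , a) (λ b bs′ → bs′ , f a b) bs) (bs , a) ≡ ([] , foldl f a bs)
unroll f zero    a []       le = refl
unroll f (suc N) a []       le = unroll f N a [] z≤n
unroll f (suc N) a (b ∷ bs) (s≤s le) = unroll f N (f a b) bs le

foldl-ext : ∀ {A B : Set} (P : List B → A → Set) {f g : A → B → A} →
  (∀ {b bs a} → P (b ∷ bs) a → g a b ≡ f a b × P bs (f a b)) →
  ∀ {bs a} → P bs a → foldl g a bs ≡ foldl f a bs
foldl-ext P h {[]}     p = refl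
foldl-ext P {f} {g} h {b ∷ bs} p with eq , p′ ← h p = trans (cong (λ a → foldl g a bs) eq) (foldl-ext P h p′)

-- The terms to be evaluated agree with their specification only within size bounds; the splitting
-- of bs hands the bounds known for bs on to b and cs.
foldr-ext : ∀ {A B : Set} {f g : B → A → A} {z} bs →
  (∀ as b cs → bs ≡ as ++ b ∷ cs → g b (foldr f z cs) ≡ f b (foldr f z cs)) →
  foldr g z bs ≡ foldr f z bs
foldr-ext []       h = refl
foldr-ext {g = g} (b ∷ bs) h =
  trans (cong (g b) (foldr-ext bs λ as c cs eq → h (b ∷ as) c cs (cong (b ∷_) eq))) (h [] b bs refl)

foldr-cons : ∀ {A B : Set} (f : B → A) bs → foldr (λ b → f b ∷_) [] bs ≡ map f bs
foldr-cons f []       = refl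
foldr-cons f (b ∷ bs) = cong (f b ∷_) (foldr-cons f bs)

foldr-snoc : ∀ {A : Set} (x : A) xs → foldr _∷_ (x ∷ []) xs ≡ xs ∷ʳ x
foldr-snoc x []       = refl
foldr-snoc x (y ∷ xs) = cong (y ∷_) (foldr-snoc x xs)

iter-suc : ∀ a b → iter a suc b ≡ a + b
iter-suc zero    b = refl
iter-suc (suc a) b = trans (iter-suc a (suc b)) (+-suc a b)

iter-pred : ∀ b a → iter b (λ x → elimNat 0 id x) a ≡ a ∸ b
iter-pred zero    a       = refl
iter-pred (suc b) zero    = trans (iter-pred b 0) (0∸n≡0 b)
iter-pred (suc b) (suc a) = iter-pred b a

elimNat-min : ∀ a b → elimNat a (λ _ → b) (a ∸ b) ≡ a ⊓ b
elimNat-min a b with a ∸ b in eq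
... | zero  = sym (m≤n⇒m⊓n≡m (m∸n≡0⇒m≤n eq))
... | suc _ = sym (m≥n⇒m⊓n≡n (≰⇒≥ λ a≤b → contradiction (trans (sym eq) (m≤n⇒m∸n≡0 a≤b)) λ ()))

iter-halves : ∀ a → iter a (λ (x , y) → y , suc x) (0 , 0) ≡ (⌊ a /2⌋ , ⌈ a /2⌉)
iter-halves a = trans (go a 0) (cong (λ c → ⌊ c /2⌋ , ⌈ c /2⌉) (+-identityʳ a))
  where
  go : ∀ a b → iter a (λ (x , y) → y , suc x) (⌊ b /2⌋ , ⌈ b /2⌉) ≡ (⌊ a + b /2⌋ , ⌈ a + b /2⌉)
  go zero    b = refl
  go (suc a) b = trans (go a (suc b)) (cong (λ c → ⌊ c /2⌋ , ⌈ c /2⌉) (+-suc a b))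

zipStep : List ℕ × List ℕ → ℕ → List ℕ × List ℕ
zipStep (ys , out) x = elimList ([] , x ∷ out) (λ y ys′ → ys′ , x ⊓ y ∷ out) ys

zipMin-[] : ∀ xs → zipMin xs [] ≡ xs
zipMin-[] []       = refl
zipMin-[] (x ∷ xs) = refl

zipStep-correct : ∀ xs ys out → (let (ys′ , out′) = foldl zipStep (ys , out) xs) →
  foldl (λ a x → x ∷ a) ys′ out′ ≡ foldl (λ a x → x ∷ a) (zipMin xs ys) out
zipStep-correct []       ys       out = refl
zipStep-correct (x ∷ xs) []       out = trans (zipStep-correct xs [] (x ∷ out))
  (cong (λ zs → foldl (λ a x → x ∷ a) (x ∷ zs) out) (zipMin-[] xs))
zipStep-correct (x ∷ xs) (y ∷ ys) out = zipStep-correct xs ys (x ⊓ y ∷ out)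

zipStep-length : ∀ xs ys out → length (proj₂ (foldl zipStep (ys , out) xs)) ≡ length xs + length out
zipStep-length []       ys       out = refl
zipStep-length (x ∷ xs) []       out = trans (zipStep-length xs [] (x ∷ out)) (+-suc (length xs) _)
zipStep-length (x ∷ xs) (y ∷ ys) out = trans (zipStep-length xs ys (x ⊓ y ∷ out)) (+-suc (length xs) _)

module Evaluation (ticks : Clock → ℕ) where

  open Semantics ticks

  infix 4 _⊢_⇓_

  -- A record, so that terms and values can be inferred by unification.
  record _⊢_⇓_ {Γ A} (γ : Env Γ) (t : Tm Γ A) (x : Val A) : Set where
    constructor ⇓-intro
    field
      ⇓-elim : ⟦ t ⟧ γ ≡ x

  open _⊢_⇓_ public

  N : ℕ
  N = ticks rows * (ticks rows * ticks rows)

  module _ {Γ : Ctx} {γ : Env Γ} where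

    ⇓-≡ : ∀ {A} {t : Tm Γ A} {x y} → γ ⊢ t ⇓ x → x ≡ y → γ ⊢ t ⇓ y
    ⇓-≡ e refl = e

    var⇓ : ∀ {A} {x : A ∈ˡ Γ} → γ ⊢ var x ⇓ lookup γ x
    var⇓ = ⇓-intro refl

    ren⇓ : ∀ {Δ A} {θ : Δ ⊑ Γ} {t : Tm Δ A} {x} → restrict θ γ ⊢ t ⇓ x → γ ⊢ ren θ t ⇓ x
    ren⇓ (⇓-intro e) = ⇓-intro e

    const⇓ : ∀ {A} {o : Constant A} → γ ⊢ const o ⇓ ⟦ o ⟧⁰
    const⇓ = ⇓-intro refl

    unary⇓ : ∀ {A B} {o : Unary A B} {t x} → γ ⊢ t ⇓ x → γ ⊢ unary o t ⇓ ⟦ o ⟧¹ x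
    unary⇓ {o = o} (⇓-intro e) = ⇓-intro (cong ⟦ o ⟧¹ e)

    binary⇓ : ∀ {A B C} {o : Binary A B C} {t u x y} → γ ⊢ t ⇓ x → γ ⊢ u ⇓ y →
      γ ⊢ binary o t u ⇓ ⟦ o ⟧² x y
    binary⇓ {o = o} (⇓-intro e) (⇓-intro e′) = ⇓-intro (cong₂ ⟦ o ⟧² e e′)

    bind⇓ : ∀ {A B} {t : Tm Γ A} {u : Tm (A ∷ Γ) B} {x y} → γ ⊢ t ⇓ x → x ∷ γ ⊢ u ⇓ y →
      γ ⊢ bind t u ⇓ y
    bind⇓ (⇓-intro refl) (⇓-intro e) = ⇓-intro e

    branch⇓ : ∀ {A} {t} {u v : Tm Γ A} {b x y} → γ ⊢ t ⇓ b → γ ⊢ u ⇓ x → γ ⊢ v ⇓ y →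
      γ ⊢ branch t u v ⇓ (if b then x else y)
    branch⇓ {b = false} (⇓-intro e) _ (⇓-intro e′) = ⇓-intro (trans (cong (λ b → if b then _ else _) e) e′)
    branch⇓ {b = true}  (⇓-intro e) (⇓-intro e′) _ = ⇓-intro (trans (cong (λ b → if b then _ else _) e) e′)

    caseNat⇓ : ∀ {A} {t} {u : Tm Γ A} {v} {k x f} → γ ⊢ t ⇓ k → γ ⊢ u ⇓ x →
      (∀ k → k ∷ γ ⊢ v ⇓ f k) → γ ⊢ caseNat t u v ⇓ elimNat x f k
    caseNat⇓ {k = zero}  (⇓-intro e) (⇓-intro e′) _ = ⇓-intro (trans (cong (elimNat _ _) e) e′)
    caseNat⇓ {k = suc k} (⇓-intro e) _ h = ⇓-intro (trans (cong (elimNat _ _) e) (⇓-elim (h k)))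

    caseList⇓ : ∀ {A B} {t : Tm Γ (list B)} {u : Tm Γ A} {v} {xs x f} → γ ⊢ t ⇓ xs → γ ⊢ u ⇓ x →
      (∀ {y ys} → xs ≡ y ∷ ys → y ∷ ys ∷ γ ⊢ v ⇓ f y ys) → γ ⊢ caseList t u v ⇓ elimList x f xs
    caseList⇓ {xs = []}     (⇓-intro e) (⇓-intro e′) _ = ⇓-intro (trans (cong (elimList _ _) e) e′)
    caseList⇓ {xs = y ∷ ys} (⇓-intro e) _ h =
      ⇓-intro (trans (cong (elimList _ _) e) (⇓-elim (h refl)))

    caseNat-zero⇓ : ∀ {A} {t} {u : Tm Γ A} {v x} → γ ⊢ t ⇓ 0 → γ ⊢ u ⇓ x → γ ⊢ caseNat t u v ⇓ x
    caseNat-zero⇓ (⇓-intro e) (⇓-intro e′) = ⇓-intro (trans (cong (elimNat _ _) e) e′)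

    caseNat-suc⇓ : ∀ {A} {t} {u : Tm Γ A} {v k x} → γ ⊢ t ⇓ suc k → k ∷ γ ⊢ v ⇓ x →
      γ ⊢ caseNat t u v ⇓ x
    caseNat-suc⇓ (⇓-intro e) (⇓-intro e′) = ⇓-intro (trans (cong (elimNat _ _) e) e′)

    caseList-nil⇓ : ∀ {A B} {t : Tm Γ (list B)} {u : Tm Γ A} {v x} → γ ⊢ t ⇓ [] → γ ⊢ u ⇓ x →
      γ ⊢ caseList t u v ⇓ x
    caseList-nil⇓ (⇓-intro e) (⇓-intro e′) = ⇓-intro (trans (cong (elimList _ _) e) e′)

    caseList-cons⇓ : ∀ {A B} {t : Tm Γ (list B)} {u : Tm Γ A} {v y ys x} → γ ⊢ t ⇓ y ∷ ys →
      y ∷ ys ∷ γ ⊢ v ⇓ x → γ ⊢ caseList t u v ⇓ x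
    caseList-cons⇓ (⇓-intro e) (⇓-intro e′) = ⇓-intro (trans (cong (elimList _ _) e) e′)

    -- π renders abstract states, such as lists of trees, as values. The loop can thus be followed
    -- on the abstract side, where its invariant P is available.
    repeat⇓ : ∀ {S : Set} {A} (π : S → Val A) (P : S → Set) {z b} {f : S → S} {s} →
      γ ⊢ z ⇓ π s → P s → (∀ s → P s → π s ∷ γ ⊢ b ⇓ π (f s) × P (f s)) →
      γ ⊢ repeat z b ⇓ π (iter N f s)
    repeat⇓ π P {z} {b} {f} {s} (⇓-intro e) p h = ⇓-intro (begin
      iter k (λ x → iter k (iter k g) x) (⟦ z ⟧ γ)
        ≡⟨ iter-cong (λ x → iter-* k k g x) k (⟦ z ⟧ γ) ⟩
      iter k (iter (k * k) g) (⟦ z ⟧ γ)  ≡⟨ iter-* k (k * k) g (⟦ z ⟧ γ) ⟩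
      iter N g (⟦ z ⟧ γ)                 ≡⟨ cong (iter N g) e ⟩
      iter N g (π s)
        ≡⟨ iter-simulates π P (λ s p → ⇓-elim (proj₁ (h s p)) , proj₂ (h s p)) N s p ⟩
      π (iter N f s)                     ∎)
      where
      open ≡-Reasoning
      k = ticks rows
      g = λ x → ⟦ b ⟧ (x ∷ γ)

  module _ {Γ : Ctx} {γ : Env Γ} where

    natFold⇓ : ∀ {A} {c} {z : Tm Γ A} {b k x f} → γ ⊢ c ⇓ k → γ ⊢ z ⇓ x →
      (∀ x → x ∷ γ ⊢ b ⇓ f x) → k ≤ N → γ ⊢ natFold c z b ⇓ iter k f x
    natFold⇓ {c = c} {z} {b} {k} {x} {f} ec ez eb le = ⇓-≡
      (unary⇓ (repeat⇓ id (λ _ → ⊤) (binary⇓ ec ez) _ λ (k , x) _ →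
        caseNat⇓ (unary⇓ var⇓) var⇓ (λ k′ → binary⇓ var⇓ (bind⇓ (unary⇓ var⇓) (ren⇓ (eb x)))) , _))
      (cong proj₂ (countdown f N k x le))

    foldl⇓ : ∀ {A B} (P : List (Val B) → Val A → Set) {t : Tm Γ (list B)} {z : Tm Γ A} {b xs a}
      {f : Val A → Val B → Val A} → γ ⊢ t ⇓ xs → γ ⊢ z ⇓ a → length xs ≤ N → P xs a →
      (∀ {x xs a} → P (x ∷ xs) a → x ∷ a ∷ γ ⊢ b ⇓ f a x × P xs (f a x)) →
      γ ⊢ foldlT t z b ⇓ foldl f a xs
    foldl⇓ P {b = b} {xs} {a} {f} et ez le p h = ⇓-≡
      (unary⇓ (repeat⇓ id (λ _ → ⊤) (binary⇓ et ez) _ λ (xs , a) _ →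
        caseList⇓ (unary⇓ var⇓) var⇓ (λ _ → binary⇓ var⇓ (bind⇓ (unary⇓ var⇓)
          (bind⇓ var⇓ (ren⇓ (⇓-intro refl))))) , _))
      -- The fold is unrolled with the meaning of b itself, since b is known to agree with f only
      -- under P; `foldl-ext` then exchanges the two.
      (trans (cong proj₂ (unroll (λ a x → ⟦ b ⟧ (x ∷ a ∷ γ)) N a xs le))
        (foldl-ext P (λ p → ⇓-elim (proj₁ (h p)) , proj₂ (h p)) p))

module _ {Γ : Ctx} where

  tailT : ∀ {A} → Tm Γ (list A) → Tm Γ (list A)
  tailT xs = caseList xs nilT v1

  absorbT : Tm Γ nat → Tm Γ (list bool) → Tm Γ nat → Tm Γ nat
  absorbT c ds a = caseList ds a
    (addT (weaken (weaken c)) (branch v0 (addT (weaken (weaken c)) (weaken (weaken a))) (weaken (weaken a))))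

  -- The first pass propagates the carry and reverses the digits, the second restores their order. A
  -- carry that survives becomes a new leading digit 1, encoded by `false`.
  incT : Tm Γ (list bool) → Tm Γ (list bool)
  incT ds = bind
    (foldlT ds (pairT trueT nilT) (branch (fstT v1)
      (branch v0 (pairT trueT (consT falseT (sndT v1))) (pairT falseT (consT trueT (sndT v1))))
      (pairT falseT (consT v0 (sndT v1)))))
    (foldlT (sndT v0) (branch (fstT v0) (consT falseT nilT) nilT) (consT v0 v1))

module Derived (ticks : Clock → ℕ) where

  open Semantics ticks
  open Evaluation ticks public

  module _ {Γ : Ctx} {γ : Env Γ} where

    rep⇓ : ∀ {S : Set} {A κ} (π : S → Val A) (P : S → Set) {z b} {f : S → S} {s} →
      γ ⊢ z ⇓ π s → P s → (∀ s → P s → π s ∷ γ ⊢ b ⇓ π (f s) × P (f s)) →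
      γ ⊢ rep κ z b ⇓ π (iter (ticks κ) f s)
    rep⇓ {κ = κ} π P {b = b} {s = s} (⇓-intro e) p h = ⇓-intro
      (trans (cong (iter (ticks κ) (λ x → ⟦ b ⟧ (x ∷ γ))) e)
        (iter-simulates π P (λ s p → ⇓-elim (proj₁ (h s p)) , proj₂ (h s p)) (ticks κ) s p))

    weaken⇓ : ∀ {A B} {t : Tm Γ A} {x} {y : Val B} → γ ⊢ t ⇓ x → y ∷ γ ⊢ weaken t ⇓ x
    weaken⇓ = ren⇓

    foldr⇓ : ∀ {A B} {t : Tm Γ (list B)} {z : Tm Γ A} {b xs a} (f : Val B → Val A → Val A) →
      γ ⊢ t ⇓ xs → γ ⊢ z ⇓ a → length xs ≤ N →
      (∀ as x cs → xs ≡ as ++ x ∷ cs → x ∷ foldr f a cs ∷ γ ⊢ b ⇓ f x (foldr f a cs)) →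
      γ ⊢ foldrT t z b ⇓ foldr f a xs
    foldr⇓ {b = b} {xs} {a} f et ez le h = ⇓-≡
      (foldl⇓ (λ _ _ → ⊤)
        (foldl⇓ (λ _ _ → ⊤) {f = λ a x → x ∷ a} et const⇓ le _ λ _ → binary⇓ var⇓ var⇓ , _)
        ez (≤-trans (≤-reflexive (length-reverse xs)) le) _ λ _ → ⇓-intro refl , _)
      (trans (reverse-foldl (λ a x → ⟦ b ⟧ (x ∷ a ∷ γ)) a xs)
        (foldr-ext xs λ as x cs eq → ⇓-elim (h as x cs eq)))

  module _ {Γ : Ctx} {γ : Env Γ} where

    add⇓ : ∀ {a b : Tm Γ nat} {x y} → γ ⊢ a ⇓ x → γ ⊢ b ⇓ y → x ≤ N → γ ⊢ addT a b ⇓ x + y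
    add⇓ {x = x} {y} ea eb le = ⇓-≡ (natFold⇓ ea eb (λ _ → unary⇓ var⇓) le) (iter-suc x y)

    monus⇓ : ∀ {a b : Tm Γ nat} {x y} → γ ⊢ a ⇓ x → γ ⊢ b ⇓ y → y ≤ N → γ ⊢ monusT a b ⇓ x ∸ y
    monus⇓ {x = x} {y} ea eb le = ⇓-≡
      (natFold⇓ eb ea (λ _ → caseNat⇓ {f = id} var⇓ const⇓ (λ _ → var⇓)) le) (iter-pred y x)

    halves⇓ : ∀ {a : Tm Γ nat} {x} → γ ⊢ a ⇓ x → x ≤ N → γ ⊢ halvesT a ⇓ (⌊ x /2⌋ , ⌈ x /2⌉)
    halves⇓ {x = x} ea le = ⇓-≡ (natFold⇓ ea (binary⇓ const⇓ const⇓)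
      (λ _ → binary⇓ (unary⇓ var⇓) (unary⇓ (unary⇓ var⇓))) le) (iter-halves x)

  module _ {Γ : Ctx} {γ : Env Γ} where

    min⇓ : ∀ {a b : Tm Γ nat} {x y} → γ ⊢ a ⇓ x → γ ⊢ b ⇓ y → y ≤ N → γ ⊢ minT a b ⇓ x ⊓ y
    min⇓ {x = x} {y} ea eb le = ⇓-≡
      (caseNat⇓ {f = λ _ → y} (monus⇓ ea eb le) ea (λ _ → weaken⇓ eb)) (elimNat-min x y)

    map⇓ : ∀ {A B} {t : Tm Γ (list A)} {b : Tm (A ∷ Γ) B} {xs} (f : Val A → Val B) → γ ⊢ t ⇓ xs →
      length xs ≤ N → All (λ x → x ∷ γ ⊢ b ⇓ f x) xs → γ ⊢ mapT t b ⇓ map f xs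
    map⇓ {xs = xs} f et le h = ⇓-≡
      (foldr⇓ (λ x → f x ∷_) et const⇓ le λ { as x cs refl →
        binary⇓ (ren⇓ (All.head (All.++⁻ʳ as h))) var⇓ })
      (foldr-cons f xs)

    map-via⇓ : ∀ {S : Set} {A B} {t : Tm Γ (list A)} {b : Tm (A ∷ Γ) B} (π : S → Val A)
      (ρ : S → Val B) ss → γ ⊢ t ⇓ map π ss → length ss ≤ N → All (λ s → π s ∷ γ ⊢ b ⇓ ρ s) ss →
      γ ⊢ mapT t b ⇓ map ρ ss
    map-via⇓ {b = b} π ρ ss et le h = ⇓-≡
      (map⇓ (λ x → ⟦ b ⟧ (x ∷ γ)) et (≤-trans (≤-reflexive (length-map π ss)) le)
        (All.tabulate λ _ → ⇓-intro refl))
      (pointwise h)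
      where
      pointwise : ∀ {ss} → All (λ s → π s ∷ γ ⊢ b ⇓ ρ s) ss →
        map (λ x → ⟦ b ⟧ (x ∷ γ)) (map π ss) ≡ map ρ ss
      pointwise []       = refl
      pointwise (e ∷ es) = cong₂ _∷_ (⇓-elim e) (pointwise es)

    snoc⇓ : ∀ {A} {t : Tm Γ (list A)} {u xs x} → γ ⊢ t ⇓ xs → γ ⊢ u ⇓ x → length xs ≤ N →
      γ ⊢ snocT t u ⇓ xs ∷ʳ x
    snoc⇓ {xs = xs} {x} et eu le = ⇓-≡
      (foldr⇓ _∷_ et (binary⇓ eu const⇓) le λ _ _ _ _ → binary⇓ var⇓ var⇓) (foldr-snoc x xs)

    count⇓ : ∀ {t : Tm Γ (list bool)} {bs} → γ ⊢ t ⇓ bs → length bs ≤ N → γ ⊢ countT t ⇓ wsum bit bs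
    count⇓ {bs = bs} et le = ⇓-≡
      (foldr⇓ (λ b k → if b then suc k else k) et const⇓ le λ _ _ _ _ → branch⇓ var⇓ (unary⇓ var⇓) var⇓)
      (count bs)
      where
      count : ∀ bs → foldr (λ b k → if b then suc k else k) 0 bs ≡ wsum bit bs
      count []           = refl
      count (false ∷ bs) = count bs
      count (true ∷ bs)  = cong suc (count bs)

    length⇓ : ∀ {A} {t : Tm Γ (list A)} {xs} → γ ⊢ t ⇓ xs → length xs ≤ N → γ ⊢ lengthT t ⇓ length xs
    length⇓ {A} {xs = xs} et le = foldr⇓ {B = A} (λ _ → suc) et const⇓ le λ _ _ _ _ → unary⇓ var⇓

    tail⇓ : ∀ {A} {t : Tm Γ (list A)} {xs} → γ ⊢ t ⇓ xs → γ ⊢ tailT t ⇓ elimList [] (λ _ ys → ys) xs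
    tail⇓ {A} et = caseList⇓ {B = A} {f = λ _ ys → ys} et const⇓ λ _ → var⇓

  module _ {Γ : Ctx} {γ : Env Γ} where

    zipMin⇓ : ∀ {s t : Tm Γ (list nat)} {xs ys} → γ ⊢ s ⇓ xs → γ ⊢ t ⇓ ys → length xs ≤ N →
      All (_≤ N) ys → γ ⊢ zipMinT s t ⇓ zipMin xs ys
    zipMin⇓ {xs = xs} {ys} es et le small = ⇓-≡
      (bind⇓
        (foldl⇓ (λ _ (ys , _) → All (_≤ N) ys) {f = zipStep} es (binary⇓ et const⇓) le small
          λ { {x} {_} {ys , out} p →
            caseList⇓ {f = λ y ys → ys , x ⊓ y ∷ out} (unary⇓ var⇓)
              (binary⇓ const⇓ (binary⇓ var⇓ (unary⇓ var⇓)))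
              (λ { refl → binary⇓ var⇓ (binary⇓ (min⇓ var⇓ var⇓ (All.head p)) (unary⇓ var⇓)) }) ,
            remaining x out p })
        (foldl⇓ (λ _ _ → ⊤) {f = λ a x → x ∷ a} (unary⇓ var⇓) (unary⇓ var⇓)
          (≤-trans (≤-reflexive (trans (zipStep-length xs ys []) (+-identityʳ _))) le) _
          λ _ → binary⇓ var⇓ var⇓ , _))
      (zipStep-correct xs ys [])
      where
      remaining : ∀ {ys} x out → All (_≤ N) ys → All (_≤ N) (proj₁ (zipStep (ys , out) x))
      remaining x out []      = []
      remaining x out (_ ∷ p) = p

  module _ {Γ : Ctx} {γ : Env Γ} where

    merge⇓ : ∀ {s t : Tm Γ (list nat)} {xs ys} → γ ⊢ s ⇓ xs → γ ⊢ t ⇓ ys → length xs ≤ N →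
      All (_≤ N) ys → γ ⊢ mergeT s t ⇓ merge xs ys
    merge⇓ {xs = xs} {ys} es et le small = ⇓-≡
      (caseList⇓ {f = λ x xs → x ∷ zipMin xs ys} es const⇓
        λ { refl → binary⇓ var⇓ (zipMin⇓ var⇓ (weaken⇓ (weaken⇓ et)) (≤-trans (n≤1+n _) le) small) })
      (elim-merge xs)
      where
      elim-merge : ∀ xs → elimList [] (λ x xs → x ∷ zipMin xs ys) xs ≡ merge xs ys
      elim-merge []       = refl
      elim-merge (x ∷ xs) = refl

  module _ {Γ : Ctx} {γ : Env Γ} where

    conv⇓ : ∀ {s t : Tm Γ (list nat)} {xs ys l b l′ b′} → γ ⊢ s ⇓ xs → γ ⊢ t ⇓ ys →
      Within (suc l) b xs → Within (suc l′) b′ ys → suc (l + l′) ≤ N → b + b′ ≤ N →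
      γ ⊢ convT s t ⇓ conv xs ys
    conv⇓ {xs = xs} {ys} {l} {b} {l′} {b′} es et (within k hs) w l≤ b≤ =
      foldr⇓ (λ x → merge (map (x +_) ys)) es const⇓ (≤-trans k (≤-trans (s≤s (m≤m+n l l′)) l≤))
        λ { as x cs refl → merge⇓
          (map⇓ (x +_) (weaken⇓ (weaken⇓ et)) len-ys (All.tabulate λ _ →
            add⇓ var⇓ var⇓ (≤-trans (All.head (All.++⁻ʳ as hs)) (≤-trans (m≤m+n b b′) b≤))))
          var⇓
          (≤-trans (≤-reflexive (length-map (x +_) ys)) len-ys)
          (All.map (λ h → ≤-trans h b≤) (Within.ent (conv-within cs ys
            (within (suffix as k) (All.tail (All.++⁻ʳ as hs))) w))) }
      where
      len-ys : length ys ≤ N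
      len-ys = ≤-trans (Within.len w) (≤-trans (s≤s (m≤n+m l′ l)) l≤)
      suffix : ∀ as {x} {cs : List ℕ} → length (as ++ x ∷ cs) ≤ suc l → length cs ≤ suc l
      suffix as {x} {cs} h = ≤-trans (n≤1+n _) (≤-trans (m≤n+m (suc (length cs)) (length as))
        (≤-trans (≤-reflexive (sym (length-++ as))) h))

-- The elimination as a term

-- Row of the adjacency matrix of the current graph, degree in the original
-- graph, and the two tables.
Vertex : Ty
Vertex = list bool ⊗ nat ⊗ list nat ⊗ list nat

module _ {Γ : Ctx} where

  rowT : Tm Γ Vertex → Tm Γ (list bool)
  rowT v = fstT v

  degT : Tm Γ Vertex → Tm Γ nat
  degT v = fstT (sndT v)

  anyT freeT : Tm Γ Vertex → Tm Γ (list nat)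
  anyT v  = fstT (sndT (sndT v))
  freeT v = sndT (sndT (sndT v))

-- Variable 0 is u, variable 1 the eliminated t. As t is at the front of the queue, the first bit in
-- the row of u tells whether they are adjacent, and removing it deletes the column of t.
attachT : ∀ {Γ} → Tm (Vertex ∷ Vertex ∷ Γ) Vertex
attachT = caseList (rowT v0) v0 (pairT v1 (branch v0
  (pairT (degT v2) (pairT
    (mergeT (convT (anyT v3) (anyT v2))
            (mapT (convT (freeT v3) (freeT v2)) (addT (addT (degT v3) (degT v4)) v0)))
    (convT (anyT v3) (freeT v2))))
  (sndT v2)))

-- The columns have to follow the rotation of the queue.
rotateT : ∀ {Γ} → Tm (Vertex ∷ Γ) Vertex
rotateT = caseList (rowT v0) v0 (pairT (snocT v1 v0) (sndT v2))

stepT : ∀ {Γ} → Tm (list Vertex ⊗ list nat ∷ Γ) (list Vertex ⊗ list nat)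
stepT = caseList (fstT v0) v0
  -- The first bit in the row of t is its diagonal entry; the number of true bits after it is the
  -- current degree. Rows of live trees are never empty, so the default is not reached on them.
  (caseList (rowT v0) v2
    (bind (countT v1)
      (caseNat v0
        (pairT (mapT v4 (ren (keep (drop (drop (drop (keep same))))) attachT))
               (convT (anyT v3) (sndT v5)))
        (caseNat v0
          (pairT (mapT v5 (ren (keep (drop (drop (drop (drop (keep same)))))) attachT)) (sndT v6))
          (pairT (mapT (snocT v6 v5) rotateT) (sndT v7))))))

startT : ∀ {Γ} → Tm (list (list bool) ∷ Γ) (list Vertex ⊗ list nat)
startT = pairT
  (mapT v0 (pairT v0 (pairT (countT v0) (pairT (consT zeroT nilT) (consT zeroT nilT)))))
  (consT zeroT nilT)

-- Agreement of the term with the elimination on trees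

module Simulation {n} (G : Graph n) (ticks : Clock → ℕ) where

  open Matching G
  open Elimination G
  open Tables G
  open Derived ticks

  vertex : List (Rose (Fin n)) → Rose (Fin n) → Val Vertex
  vertex ts t = map (adj G (root t) ∘ root) ts , deg G (root t) , table any t , table free t

  render : State → Val (list Vertex ⊗ list nat)
  render (ts , ds) = map (vertex ts) ts , tableAll ds

  module _ (room : suc (2 * n) + 8 * (n * n) ≤ N) where

    n≤N : n ≤ N
    n≤N = ≤-trans (≤-trans (m≤m+n n (n + 0)) (≤-trans (n≤1+n _) (m≤m+n _ (8 * (n * n))))) room

    2n≤N : 2 * n ≤ N
    2n≤N = ≤-trans (≤-trans (n≤1+n _) (m≤m+n _ (8 * (n * n)))) room

    2n<N : suc (2 * n) ≤ N
    2n<N = ≤-trans (m≤m+n _ (8 * (n * n))) room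

    entries≤N : 2 * n + (2 * n * n + 2 * n * n) ≤ N
    entries≤N = ≤-trans (≤-trans (+-mono-≤ (n≤1+n (2 * n)) (≤-trans (≤-reflexive (lemma n))
      (*-monoˡ-≤ (n * n) (m≤m+n 4 4)))) ≤-refl) room
      where
      lemma : ∀ n → 2 * n * n + 2 * n * n ≡ 4 * (n * n)
      lemma = solve-∀

    sums≤N : 2 * n * n + 2 * n * n ≤ N
    sums≤N = ≤-trans (m≤n+m _ (2 * n)) entries≤N

    table-within : ∀ m {t} → order t ≤ n → Within (suc n) (2 * n * n) (table m t)
    table-within m {node v ts} h = within-≤ (s≤s (≤-trans (n≤1+n _) h))
      (*-monoʳ-≤ (2 * n) (≤-trans (n≤1+n _) h)) (tableAt-within m v ts)

    lengths≤N : suc (n + n) ≤ N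
    lengths≤N = ≤-trans (≤-reflexive (cong (λ m → suc (n + m)) (sym (+-identityʳ n)))) 2n<N

    module _ {Γ : Ctx} {γ : Env Γ} where

      conv-tables⇓ : ∀ {s s′ : Tm Γ (list nat)} {xs ys} → γ ⊢ s ⇓ xs → γ ⊢ s′ ⇓ ys →
        Within (suc n) (2 * n * n) xs → Within (suc n) (2 * n * n) ys → γ ⊢ convT s s′ ⇓ conv xs ys
      conv-tables⇓ es es′ w w′ = conv⇓ es es′ w w′ lengths≤N sums≤N

    conv-tables-within : ∀ {xs ys} → Within (suc n) (2 * n * n) xs → Within (suc n) (2 * n * n) ys →
      Within (suc (n + n)) (2 * n * n + 2 * n * n) (conv xs ys)
    conv-tables-within {xs} {ys} = conv-within xs ys

    attach⇓ : ∀ {Γ} {γ : Env Γ} {ts us t u} → order t ≤ n → order u ≤ n →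
      vertex (t ∷ ts) u ∷ vertex us t ∷ γ ⊢ attachT ⇓
        (map (adj G (root u) ∘ root) ts , proj₂ (vertex ts (attach t u)))
    attach⇓ {ts = ts} {t = t} {u = node r cs} t≤ u≤ = caseList⇓
      {f = λ b bs → bs , proj₂ (vertex ts (node r (if b then t ∷ cs else cs)))}
      (unary⇓ var⇓) var⇓ λ { refl → binary⇓ var⇓ (⇓-≡
        (branch⇓ var⇓
          (binary⇓ (unary⇓ (unary⇓ var⇓)) (binary⇓
            (merge⇓ (conv-tables⇓ (unary⇓ (unary⇓ (unary⇓ var⇓))) (unary⇓ (unary⇓ (unary⇓ var⇓))) wt wu)
              (map⇓ (deg G r + deg G (root t) +_)
                (conv-tables⇓ (unary⇓ (unary⇓ (unary⇓ var⇓))) (unary⇓ (unary⇓ (unary⇓ var⇓))) wt′ wu′)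
                (≤-trans (Within.len (conv-tables-within wt′ wu′)) lengths≤N)
                (All.tabulate λ _ → add⇓
                  (add⇓ (unary⇓ (unary⇓ var⇓)) (unary⇓ (unary⇓ var⇓))
                    (≤-trans (∣p∣≤n (neighbours G r)) n≤N))
                  var⇓ (≤-trans (degrees≤2n r (root t)) 2n≤N)))
              (≤-trans (Within.len (conv-tables-within wt wu)) lengths≤N)
              (All.map (λ h → ≤-trans h entries≤N)
                (Within.ent (map-within (degrees≤2n r (root t)) (conv-tables-within wt′ wu′)))))
            (conv-tables⇓ (unary⇓ (unary⇓ (unary⇓ var⇓))) (unary⇓ (unary⇓ (unary⇓ var⇓))) wt wu′)))
          (unary⇓ var⇓))
        (choose (adj G r (root t)))) }
      where
      wt  = table-within any {t} t≤
      wt′ = table-within free {t} t≤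
      wu  = table-within any {node r cs} u≤
      wu′ = table-within free {node r cs} u≤
      choose : ∀ b →
        (if b then proj₂ (vertex ts (node r (t ∷ cs))) else proj₂ (vertex ts (node r cs))) ≡
        proj₂ (vertex ts (node r (if b then t ∷ cs else cs)))
      choose false = refl
      choose true  = refl

    rotate⇓ : ∀ {Γ} {γ : Env Γ} {t ts u} → length ts ≤ N →
      vertex (t ∷ ts) u ∷ γ ⊢ rotateT ⇓ vertex (ts ∷ʳ t) u
    rotate⇓ {t = t} {ts} {u} le = ⇓-≡
      (caseList⇓ {f = λ b bs → bs ∷ʳ b , proj₂ (vertex ts u)} (unary⇓ var⇓) var⇓
        λ { refl → binary⇓ (snoc⇓ var⇓ var⇓ (≤-trans (≤-reflexive (length-map _ ts)) le)) (unary⇓ var⇓) })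
      (cong (_, proj₂ (vertex ts u)) (sym (map-++ (adj G (root u) ∘ root) ts [ t ])))

    render-attach : ∀ t ts →
      map (λ u → map (adj G (root u) ∘ root) ts , proj₂ (vertex ts (attach t u))) ts ≡
      map (vertex (map (attach t) ts)) (map (attach t) ts)
    render-attach t ts = trans
      (map-cong (λ u → cong (_, proj₂ (vertex ts (attach t u)))
        (map-∘ {g = adj G (root u) ∘ root} {f = attach t} ts)) ts)
      (map-∘ ts)

    -- An arbitrary embedding θ is allowed because `stepT` uses `attachT` under different numbers of
    -- binders.
    attachAll⇓ : ∀ {Γ Δ} {γ : Env Γ} {δ : Env Δ} {θ : Vertex ∷ Δ ⊑ Γ} {s : Tm Γ (list Vertex)} {t ts} →
      restrict θ γ ≡ vertex (t ∷ ts) t ∷ δ →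
      γ ⊢ s ⇓ map (vertex (t ∷ ts)) ts → length ts ≤ N → order t ≤ n → All (λ u → order u ≤ n) ts →
      γ ⊢ mapT s (ren (keep θ) attachT) ⇓ map (vertex (map (attach t) ts)) (map (attach t) ts)
    attachAll⇓ {γ = γ} {t = t} {ts} eq es le t≤ us≤ = ⇓-≡
      (map-via⇓ (vertex (t ∷ ts)) _ ts es le (All.map (λ {u} u≤ → ren⇓ (subst
        (λ δ → vertex (t ∷ ts) u ∷ δ ⊢ attachT ⇓
          (map (adj G (root u) ∘ root) ts , proj₂ (vertex ts (attach t u))))
        (sym eq) (attach⇓ {ts = ts} {us = t ∷ ts} {t} {u} t≤ u≤))) us≤))
      (render-attach t ts)

    orders-bound : ∀ {s} → Invariant s → orders (proj₁ s) + orders (proj₂ s) ≡ n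
    orders-bound I = trans (Invariant.covers I _) (trans (total-const n 1) (*-identityʳ n))

    order≤orders : ∀ ts → All (λ u → order u ≤ orders ts) ts
    order≤orders []       = []
    order≤orders (t ∷ ts) = m≤m+n _ _ ∷ All.map (λ h → ≤-trans h (m≤n+m _ (order t))) (order≤orders ts)

    step⇓ : ∀ {Γ} {γ : Env Γ} s → Invariant s → render s ∷ γ ⊢ stepT ⇓ render (step s)
    step⇓ ([] , ds) I = caseList-nil⇓ (unary⇓ var⇓) var⇓
    step⇓ {γ = γ} (t ∷ ts , ds) I =
      caseList-cons⇓ (unary⇓ var⇓) (caseList-cons⇓ (unary⇓ var⇓)
        (bind⇓ (⇓-≡ (count⇓ var⇓ (≤-trans (≤-reflexive (length-map _ ts)) ts≤))
                     (wsum-map bit (adj G (root t) ∘ root) ts))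
          (advance⇓ (degreeIn (root t) ts))))
      where
      orders≤ : orders (t ∷ ts) ≤ n
      orders≤ = ≤-trans (m≤m+n _ (orders ds)) (≤-reflexive (orders-bound I))
      each≤ : All (λ u → order u ≤ n) (t ∷ ts)
      each≤ = All.map (λ h → ≤-trans h orders≤) (order≤orders (t ∷ ts))
      ts≤ : length ts ≤ N
      ts≤ = ≤-trans (≤-trans (n≤1+n _) (length-bound I)) n≤N
      ds≤ : orders ds ≤ n
      ds≤ = ≤-trans (m≤n+m _ (orders (t ∷ ts))) (≤-reflexive (orders-bound I))
      advance⇓ : ∀ e →
        e ∷ adj G (root t) (root t) ∷ map (adj G (root t) ∘ root) ts ∷ vertex (t ∷ ts) t ∷
          map (vertex (t ∷ ts)) ts ∷ render (t ∷ ts , ds) ∷ γ ⊢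
        caseNat v0
          (pairT (mapT v4 (ren (keep (drop (drop (drop (keep same))))) attachT))
                 (convT (anyT v3) (sndT v5)))
          (caseNat v0
            (pairT (mapT v5 (ren (keep (drop (drop (drop (drop (keep same)))))) attachT)) (sndT v6))
            (pairT (mapT (snocT v6 v5) rotateT) (sndT v7)))
        ⇓ render (advance e t (ts , ds))
      advance⇓ zero = caseNat-zero⇓ var⇓ (binary⇓
        (attachAll⇓ refl var⇓ ts≤ (All.head each≤) (All.tail each≤))
        (conv-tables⇓ (unary⇓ (unary⇓ (unary⇓ var⇓))) (unary⇓ var⇓)
          (table-within any {t} (All.head each≤))
          (within-≤ (s≤s ds≤) (*-monoʳ-≤ (2 * n) ds≤) (tableAll-within ds))))
      advance⇓ (suc zero) = caseNat-suc⇓ var⇓ (caseNat-zero⇓ var⇓ (binary⇓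
        (attachAll⇓ refl var⇓ ts≤ (All.head each≤) (All.tail each≤)) (unary⇓ var⇓)))
      advance⇓ (suc (suc _)) = caseNat-suc⇓ var⇓ (caseNat-suc⇓ var⇓ (binary⇓
        (map-via⇓ (vertex (t ∷ ts)) (vertex (ts ∷ʳ t)) (ts ∷ʳ t)
          (⇓-≡ (snoc⇓ var⇓ var⇓ (≤-trans (≤-reflexive (length-map _ ts)) ts≤))
            (sym (map-++ (vertex (t ∷ ts)) ts [ t ])))
          (≤-trans (≤-reflexive (trans (length-++ ts) (+-comm (length ts) 1)))
            (≤-trans (length-bound I) n≤N))
          (All.tabulate λ {u} _ → rotate⇓ {t = t} {ts} {u} ts≤))
        (unary⇓ var⇓)))

    start⇓ : ∀ {Γ} {γ : Env Γ} →
      map (λ u → map (adj G u) (allFin n)) (allFin n) ∷ γ ⊢ startT ⇓ render initialState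
    start⇓ {γ = γ} = ⇓-≡ (binary⇓
      (map-via⇓ (λ u → map (adj G u) (allFin n))
        (λ u → map (adj G u) (allFin n) , wsum bit (map (adj G u) (allFin n)) , 0 ∷ [] , 0 ∷ [])
        (allFin n) var⇓ all≤N
        (All.tabulate λ {u} _ → binary⇓ var⇓ (binary⇓
          (count⇓ var⇓ (≤-trans (≤-reflexive (length-map _ (allFin n))) all≤N))
          (binary⇓ (binary⇓ const⇓ const⇓) (binary⇓ const⇓ const⇓)))))
      (binary⇓ const⇓ const⇓))
      (cong (_, 0 ∷ []) (trans (map-cong same-vertex (allFin n)) (map-∘ (allFin n))))
      where
      all≤N : length (allFin n) ≤ N
      all≤N = ≤-trans (≤-reflexive (length-tabulate id)) n≤N
      leaves = map (λ v → node v []) (allFin n)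
      same-vertex : ∀ u → (map (adj G u) (allFin n) , wsum bit (map (adj G u) (allFin n)) , 0 ∷ [] , 0 ∷ []) ≡
        vertex leaves (node u [])
      same-vertex u = cong₂ (λ bs d → bs , d , 0 ∷ [] , 0 ∷ []) (map-∘ (allFin n))
        (trans (wsum-map bit (adj G u) (allFin n))
          (trans (wsum-tabulate (bit ∘ adj G u) id) (sym (card-tabulate (adj G u)))))

-- Comparing c q with n p digit by digit

-- As in encodeℕᵇ, the digits are 1 and 2, and the least significant one
-- comes first.
value : List Bool → ℕ
value []       = 0
value (d ∷ ds) = suc (bit d) + (value ds + value ds)

rest : List Bool → List Bool
rest = elimList [] (λ _ ds → ds)

-- The carry a plus c times the lowest digit of ds, which is 1 or 2, or 0 if there is none.
absorb : ℕ → List Bool → ℕ → ℕ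
absorb c ds a = elimList a (λ d _ → c + (if d then c + a else a)) ds

Comparison : Set
Comparison = (List Bool × List Bool) × (ℕ × ℕ)

-- The state ((P , Q) , (a , b)) stands for c · value Q + a ≤ n · value P + b.
compareStep : ℕ → ℕ → Comparison → Comparison
compareStep c n ((P , Q) , (a , b)) =
  (rest P , rest Q) ,
  (⌈ absorb c Q a ∸ absorb n P b /2⌉ , ⌊ absorb n P b ∸ absorb c Q a /2⌋)

Below : ℕ → ℕ → Comparison → Set
Below c n ((P , Q) , (a , b)) = c * value Q + a ≤ n * value P + b

absorb-value : ∀ c ds a →
  c * value (rest ds) + c * value (rest ds) + absorb c ds a ≡ c * value ds + a
absorb-value c []           a rewrite *-zeroʳ c = refl
absorb-value c (false ∷ ds) a = lemma c (value ds) a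
  where
  lemma : ∀ c v a → c * v + c * v + (c + a) ≡ c * (1 + (v + v)) + a
  lemma = solve-∀
absorb-value c (true ∷ ds)  a = lemma c (value ds) a
  where
  lemma : ∀ c v a → c * v + c * v + (c + (c + a)) ≡ c * (2 + (v + v)) + a
  lemma = solve-∀

⌊+/2⌋ : ∀ x d → ⌊ x + x + d /2⌋ ≡ x + ⌊ d /2⌋
⌊+/2⌋ zero    d = refl
⌊+/2⌋ (suc x) d rewrite +-suc x x = cong suc (⌊+/2⌋ x d)

⌈+/2⌉ : ∀ x d → ⌈ x + x + d /2⌉ ≡ x + ⌈ d /2⌉
⌈+/2⌉ zero    d = refl
⌈+/2⌉ (suc x) d rewrite +-suc x x = cong suc (⌈+/2⌉ x d)

⌊/2⌋-double≤ : ∀ d → ⌊ d /2⌋ + ⌊ d /2⌋ ≤ d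
⌊/2⌋-double≤ d = ≤-trans (+-monoʳ-≤ ⌊ d /2⌋ (⌊n/2⌋≤⌈n/2⌉ d)) (≤-reflexive (⌊n/2⌋+⌈n/2⌉≡n d))

⌈/2⌉-double≥ : ∀ d → d ≤ ⌈ d /2⌉ + ⌈ d /2⌉
⌈/2⌉-double≥ d = ≤-trans (≤-reflexive (sym (⌊n/2⌋+⌈n/2⌉≡n d))) (+-monoˡ-≤ ⌈ d /2⌉ (⌊n/2⌋≤⌈n/2⌉ d))

-- Cancelling the smaller of a and b leaves a difference on one side only. As the other side is then
-- even, halving may round this difference up on the left and down on the right without changing the
-- truth of the inequality.
halve-≤ : ∀ x y a b → x + x + a ≤ y + y + b ⇔ x + ⌈ a ∸ b /2⌉ ≤ y + ⌊ b ∸ a /2⌋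
halve-≤ x y a b with ≤-total a b
... | inj₁ a≤b rewrite m≤n⇒m∸n≡0 a≤b | +-identityʳ x = mk⇔
  (λ h → subst₂ _≤_ (trans (⌊+/2⌋ x 0) (+-identityʳ x)) (⌊+/2⌋ y (b ∸ a)) (⌊n/2⌋-mono (begin
    x + x + 0            ≡⟨ +-identityʳ (x + x) ⟩
    x + x                ≤⟨ +-cancelʳ-≤ a (x + x) (y + y + (b ∸ a)) (≤-trans h (≤-reflexive (sym (restore y)))) ⟩
    y + y + (b ∸ a)      ∎)))
  (λ h → begin
    x + x + a                                        ≤⟨ +-monoˡ-≤ a (+-mono-≤ h h) ⟩
    y + ⌊ b ∸ a /2⌋ + (y + ⌊ b ∸ a /2⌋) + a          ≡⟨ lemma y ⌊ b ∸ a /2⌋ a ⟩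
    y + y + (⌊ b ∸ a /2⌋ + ⌊ b ∸ a /2⌋) + a
      ≤⟨ +-monoˡ-≤ a (+-monoʳ-≤ (y + y) (⌊/2⌋-double≤ (b ∸ a))) ⟩
    y + y + (b ∸ a) + a                              ≡⟨ restore y ⟩
    y + y + b                                        ∎)
  where
  open ≤-Reasoning
  restore : ∀ y → y + y + (b ∸ a) + a ≡ y + y + b
  restore y = trans (+-assoc (y + y) (b ∸ a) a) (cong (y + y +_) (m∸n+n≡m a≤b))
  lemma : ∀ y d a → y + d + (y + d) + a ≡ y + y + (d + d) + a
  lemma = solve-∀
... | inj₂ b≤a rewrite m≤n⇒m∸n≡0 b≤a | +-identityʳ y = mk⇔
  (λ h → halve-mono-up (+-cancelʳ-≤ b (x + x + (a ∸ b)) (y + y) (≤-trans (≤-reflexive (restore x)) h)))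
  (λ h → begin
    x + x + a                                ≡⟨ restore x ⟨
    x + x + (a ∸ b) + b                      ≤⟨ +-monoˡ-≤ b (+-monoʳ-≤ (x + x) (⌈/2⌉-double≥ (a ∸ b))) ⟩
    x + x + (⌈ a ∸ b /2⌉ + ⌈ a ∸ b /2⌉) + b  ≡⟨ lemma x ⌈ a ∸ b /2⌉ b ⟩
    x + ⌈ a ∸ b /2⌉ + (x + ⌈ a ∸ b /2⌉) + b  ≤⟨ +-monoˡ-≤ b (+-mono-≤ h h) ⟩
    y + y + b                                ∎)
  where
  open ≤-Reasoning
  restore : ∀ x → x + x + (a ∸ b) + b ≡ x + x + a
  restore x = trans (+-assoc (x + x) (a ∸ b) b) (cong (x + x +_) (m∸n+n≡m b≤a))
  lemma : ∀ x d b → x + x + (d + d) + b ≡ x + d + (x + d) + b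
  lemma = solve-∀
  halve-mono-up : x + x + (a ∸ b) ≤ y + y → x + ⌈ a ∸ b /2⌉ ≤ y
  halve-mono-up h = subst₂ _≤_ (⌈+/2⌉ x (a ∸ b))
    (trans (cong ⌈_/2⌉ (sym (+-identityʳ (y + y)))) (trans (⌈+/2⌉ y 0) (+-identityʳ y)))
    (⌈n/2⌉-mono h)

compareStep-below : ∀ c n s → Below c n s ⇔ Below c n (compareStep c n s)
compareStep-below c n ((P , Q) , (a , b)) =
  subst₂ (λ l r → l ≤ r ⇔ Below c n (compareStep c n ((P , Q) , (a , b)))) (absorb-value c Q a) (absorb-value n P b)
    (halve-≤ (c * value (rest Q)) (n * value (rest P)) (absorb c Q a) (absorb n P b))

compare-below : ∀ c n k s → Below c n s ⇔ Below c n (iter k (compareStep c n) s)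
compare-below c n zero    s = mk⇔ id id
compare-below c n (suc k) s = mk⇔
  (Equivalence.to (compare-below c n k _) ∘ Equivalence.to (compareStep-below c n s))
  (Equivalence.from (compareStep-below c n s) ∘ Equivalence.from (compare-below c n k _))

rest-length : ∀ {k} ds → length ds ≤ suc k → length (rest ds) ≤ k
rest-length []       h       = z≤n
rest-length (d ∷ ds) (s≤s h) = h

compare-exhausts : ∀ c n k s → length (proj₁ (proj₁ s)) ≤ k → length (proj₂ (proj₁ s)) ≤ k →
  proj₁ (iter k (compareStep c n) s) ≡ ([] , [])
compare-exhausts c n zero    (([] , []) , _) _ _ = refl
compare-exhausts c n (suc k) ((P , Q) , ab)  h h′ =
  compare-exhausts c n k (compareStep c n ((P , Q) , ab)) (rest-length P h) (rest-length Q h′)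

atMost : ℕ × ℕ → Bool
atMost (a , b) = elimNat true (λ _ → false) (a ∸ b)

atMost-correct : ∀ a b → a ≤ b ⇔ atMost (a , b) ≡ true
atMost-correct a b with a ∸ b in eq
... | zero  = mk⇔ (λ _ → refl) (λ _ → m∸n≡0⇒m≤n eq)
... | suc _ = mk⇔ (λ h → contradiction (trans (sym eq) (m≤n⇒m∸n≡0 h)) λ ()) (λ ())

compareDigits : ℕ → ℕ → ℕ → List Bool → List Bool → Bool
compareDigits k c n P Q = atMost (proj₂ (iter k (compareStep c n) ((P , Q) , (0 , 0))))

compareDigits-correct : ∀ {k} c n P Q → length P ≤ k → length Q ≤ k →
  c * value Q ≤ n * value P ⇔ compareDigits k c n P Q ≡ true
compareDigits-correct {k} c n P Q h h′ = mk⇔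
  (Equivalence.to (atMost-correct a b) ∘ Equivalence.to leftover ∘ Equivalence.to below ∘
    subst₂ _≤_ (sym (+-identityʳ _)) (sym (+-identityʳ _)))
  (subst₂ _≤_ (+-identityʳ _) (+-identityʳ _) ∘ Equivalence.from below ∘
    Equivalence.from leftover ∘ Equivalence.from (atMost-correct a b))
  where
  final = iter k (compareStep c n) ((P , Q) , (0 , 0))
  a = proj₁ (proj₂ final)
  b = proj₂ (proj₂ final)
  below = compare-below c n k ((P , Q) , (0 , 0))
  leftover : Below c n final ⇔ a ≤ b
  leftover rewrite compare-exhausts c n k ((P , Q) , (0 , 0)) h h′ | *-zeroʳ c | *-zeroʳ n = mk⇔ id id

absorb-bound : ∀ c ds {a} → a ≤ c + c → absorb c ds a ≤ (c + c) + (c + c)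
absorb-bound c []           h = ≤-trans h (m≤m+n (c + c) _)
absorb-bound c (false ∷ ds) h = +-mono-≤ (m≤m+n c c) h
absorb-bound c (true ∷ ds)  h = ≤-trans (≤-reflexive (sym (+-assoc c c _))) (+-monoʳ-≤ (c + c) h)

-- The bound reproduces itself: a digit is at most 2, so a carry of at most 2 c grows to at most 4 c
-- and is then halved. Thus the unary carries stay small however many digits there are.
record Carries (c n : ℕ) (s : Comparison) : Set where
  constructor carries
  field
    left  : proj₁ (proj₂ s) ≤ c + c
    right : proj₂ (proj₂ s) ≤ n + n

compareStep-carries : ∀ c n s → Carries c n s → Carries c n (compareStep c n s)
compareStep-carries c n ((P , Q) , (a , b)) (carries h h′) = carries
  (≤-trans (⌈n/2⌉-mono (≤-trans (m∸n≤m _ (absorb n P b)) (≤-trans (absorb-bound c Q h)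
      (≤-reflexive (sym (+-identityʳ _))))))
    (≤-reflexive (trans (⌈+/2⌉ (c + c) 0) (+-identityʳ _))))
  (≤-trans (⌊n/2⌋-mono (≤-trans (m∸n≤m _ (absorb c Q a)) (≤-trans (absorb-bound n P h′)
      (≤-reflexive (sym (+-identityʳ _))))))
    (≤-reflexive (trans (⌊+/2⌋ (n + n) 0) (+-identityʳ _))))

-- Binary counting

inc : List Bool → List Bool
inc []           = false ∷ []
inc (false ∷ ds) = true ∷ ds
inc (true ∷ ds)  = false ∷ inc ds

digits : ℕ → List Bool
digits zero    = []
digits (suc k) = inc (digits k)

value-inc : ∀ ds → value (inc ds) ≡ suc (value ds)
value-inc []           = refl
value-inc (false ∷ ds) = refl
value-inc (true ∷ ds)  rewrite value-inc ds = cong (λ v → 2+ v) (+-suc (value ds) (value ds))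

value-digits : ∀ k → value (digits k) ≡ k
value-digits zero    = refl
value-digits (suc k) = trans (value-inc (digits k)) (cong suc (value-digits k))

length-inc : ∀ ds → length (inc ds) ≤ suc (length ds)
length-inc []           = ≤-refl
length-inc (false ∷ ds) = n≤1+n _
length-inc (true ∷ ds)  = s≤s (length-inc ds)

length-digits : ∀ k → length (digits k) ≤ k
length-digits zero    = z≤n
length-digits (suc k) = ≤-trans (length-inc (digits k)) (s≤s (length-digits k))

encode-suc : ∀ b ds → encodeℕᵇ b ≡ enc (list bool) ds → encodeℕᵇ (Bin.suc b) ≡ enc (list bool) (inc ds)
encode-suc Bin.zero []          eq   = refl
encode-suc 2[1+ b ] (true ∷ ds) eq   = cong (cons nil) (encode-suc b ds (cong tail eq))
encode-suc 1+[2 b ] (false ∷ ds) eq  = cong (λ t → cons (cons nil nil) (tail t)) eq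

encode-digits : ∀ k → encodeℕ k ≡ enc (list bool) (digits k)
encode-digits k = trans (cong encodeℕᵇ (Bin.fromℕ≡fromℕ' k)) (go k)
  where
  go : ∀ k → encodeℕᵇ (Bin.fromℕ' k) ≡ enc (list bool) (digits k)
  go zero    = refl
  go (suc k) = encode-suc (Bin.fromℕ' k) (digits k) (go k)

incStep : Bool × List Bool → Bool → Bool × List Bool
incStep (carry , out) d =
  if carry then (if d then true , false ∷ out else (false , true ∷ out)) else (false , d ∷ out)

incStep-correct : ∀ ds carry out → (let (carry′ , out′) = foldl incStep (carry , out) ds) →
  foldl (λ a d → d ∷ a) (if carry′ then false ∷ [] else []) out′ ≡
  foldl (λ a d → d ∷ a) (if carry then inc ds else ds) out
incStep-correct []           false out = refl
incStep-correct []           true  out = refl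
incStep-correct (d ∷ ds)     false out = incStep-correct ds false (d ∷ out)
incStep-correct (false ∷ ds) true  out = incStep-correct ds false (true ∷ out)
incStep-correct (true ∷ ds)  true  out = incStep-correct ds true (false ∷ out)

incStep-length : ∀ ds carry out →
  length (proj₂ (foldl incStep (carry , out) ds)) ≡ length ds + length out
incStep-length []           carry out = refl
incStep-length (d ∷ ds)     false out = trans (incStep-length ds false _) (+-suc (length ds) _)
incStep-length (false ∷ ds) true  out = trans (incStep-length ds false _) (+-suc (length ds) _)
incStep-length (true ∷ ds)  true  out = trans (incStep-length ds true _) (+-suc (length ds) _)

-- The last admissible index of a table

-- The whole table is scanned, so that nothing need be known about monotonicity of its entries.
last : (ℕ → Bool) → List ℕ → ℕ → ℕ → ℕ
last ok []       i b = b
last ok (c ∷ cs) i b = last ok cs (suc i) (if ok c then i else b)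

last-≥ : ∀ ok cs i b → b ≤ i → b ≤ last ok cs i b
last-≥ ok []       i b h = ≤-refl
last-≥ ok (c ∷ cs) i b h with ok c
... | true  = ≤-trans h (last-≥ ok cs (suc i) i (n≤1+n i))
... | false = last-≥ ok cs (suc i) b (≤-trans h (n≤1+n i))

last-max : ∀ ok cs i b {k c} → b ≤ i → cs [ k ]= c → ok c ≡ true → i + k ≤ last ok cs i b
last-max ok (c ∷ cs) i b h here eq rewrite eq | +-identityʳ i = last-≥ ok cs (suc i) i (n≤1+n i)
last-max ok (c ∷ cs) i b {suc k} h (there p) eq rewrite +-suc i k with ok c
... | true  = last-max ok cs (suc i) i (n≤1+n i) p eq
... | false = last-max ok cs (suc i) b (≤-trans h (n≤1+n i)) p eq

last-attained : ∀ ok cs i b → last ok cs i b ≡ b ⊎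
  ∃₂ λ k c → cs [ k ]= c × ok c ≡ true × last ok cs i b ≡ i + k
last-attained ok []       i b = inj₁ refl
last-attained ok (c ∷ cs) i b with ok c in eq
... | false with last-attained ok cs (suc i) b
...   | inj₁ h = inj₁ h
...   | inj₂ (k , d , p , eq′ , h) = inj₂ (suc k , d , there p , eq′ , trans h (sym (+-suc i k)))
last-attained ok (c ∷ cs) i b | true with last-attained ok cs (suc i) i
...   | inj₁ h = inj₂ (0 , c , here , eq , trans h (sym (+-identityʳ i)))
...   | inj₂ (k , d , p , eq′ , h) = inj₂ (suc k , d , there p , eq′ , trans h (sym (+-suc i k)))

-- The comparison and the scan of the table as terms

compareT : ∀ {Γ} → Tm Γ nat → Tm Γ nat → Tm Γ (list bool) → Tm Γ (list bool) → Tm Γ bool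
compareT {Γ} c n P Q = bind
  (rep denominator (rep numerator (pairT (pairT P Q) (pairT zeroT zeroT)) body) body)
  (caseNat (monusT (fstT (sndT v0)) (sndT (sndT v0))) trueT falseT)
  where
  State : Ty
  State = (list bool ⊗ list bool) ⊗ (nat ⊗ nat)
  body : Tm (State ∷ Γ) State
  body = bind (absorbT (weaken c) (sndT (fstT v0)) (fstT (sndT v0)))
    (bind (absorbT (weaken (weaken n)) (fstT (fstT v1)) (sndT (sndT v1)))
      (pairT (pairT (tailT (fstT (fstT v2))) (tailT (sndT (fstT v2))))
             (pairT (sndT (halvesT (monusT v1 v0))) (fstT (halvesT (monusT v0 v1))))))

-- The running index and the best one so far are kept in binary, so that the result already has the
-- encoding required of the output.
answerT : ∀ {Γ} → Tm Γ nat → Tm Γ (list bool) → Tm Γ (list bool) → Tm Γ (list nat) → Tm Γ (list bool)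
answerT n P Q R = sndT (foldlT R (pairT nilT nilT) (pairT (incT (fstT v1))
  (branch (compareT v0 (weaken (weaken n)) (weaken (weaken P)) (weaken (weaken Q)))
    (fstT v1) (sndT v1))))

Input : Ty
Input = list (list bool) ⊗ (list bool ⊗ list bool)

-- Opaque, lest the type checker compare programs by running them.
opaque
  mainT : Tm (Input ∷ []) (list bool)
  mainT = bind (repeat (bind (fstT v0) startT) stepT)
    (answerT (lengthT (fstT v1)) (fstT (sndT v1)) (sndT (sndT v1)) (sndT v0))

-- Evaluation of the comparison and of the scan

module Answer (ticks : Clock → ℕ) where

  open Derived ticks

  module _ {Γ : Ctx} {γ : Env Γ} where

    absorb⇓ : ∀ {c a : Tm Γ nat} {ds x y bs} → γ ⊢ c ⇓ x → γ ⊢ ds ⇓ bs → γ ⊢ a ⇓ y → x ≤ N →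
      γ ⊢ absorbT c ds a ⇓ absorb x bs y
    absorb⇓ {x = x} {y} ec eds ea le = caseList⇓ {f = λ d _ → x + (if d then x + y else y)} eds ea
      λ _ → add⇓ (weaken⇓ (weaken⇓ ec)) (branch⇓ var⇓
        (add⇓ (weaken⇓ (weaken⇓ ec)) (weaken⇓ (weaken⇓ ea)) le) (weaken⇓ (weaken⇓ ea))) le

    inc⇓ : ∀ {t : Tm Γ (list bool)} {ds} → γ ⊢ t ⇓ ds → length ds ≤ N → γ ⊢ incT t ⇓ inc ds
    inc⇓ {ds = ds} et le = ⇓-≡
      (bind⇓
        (foldl⇓ (λ _ _ → ⊤) {f = incStep} et (binary⇓ const⇓ const⇓) le _ λ _ →
          branch⇓ (unary⇓ var⇓)
            (branch⇓ var⇓ (binary⇓ const⇓ (binary⇓ const⇓ (unary⇓ var⇓)))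
                          (binary⇓ const⇓ (binary⇓ const⇓ (unary⇓ var⇓))))
            (binary⇓ const⇓ (binary⇓ var⇓ (unary⇓ var⇓))) , _)
        (foldl⇓ (λ _ _ → ⊤) {f = λ a x → x ∷ a} (unary⇓ var⇓)
          (branch⇓ (unary⇓ var⇓) (binary⇓ const⇓ const⇓) const⇓)
          (≤-trans (≤-reflexive (trans (incStep-length ds true []) (+-identityʳ _))) le) _
          λ _ → binary⇓ var⇓ var⇓ , _))
      (incStep-correct ds true [])

  clockTotal : ℕ
  clockTotal = ticks numerator + ticks denominator

  -- The two clocks run one after the other, which gives enough rounds for the longer of the two
  -- numbers; rounds after the digits are used up still preserve the truth of the inequality.
  compare⇓ : ∀ {Γ} {γ : Env Γ} {tc tn : Tm Γ nat} {tP tQ c n P Q} → γ ⊢ tc ⇓ c → γ ⊢ tn ⇓ n →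
    γ ⊢ tP ⇓ P → γ ⊢ tQ ⇓ Q → (c + c) + (c + c) ≤ N → (n + n) + (n + n) ≤ N →
    γ ⊢ compareT tc tn tP tQ ⇓ compareDigits clockTotal c n P Q
  compare⇓ {γ = γ} {c = c} {n} {P} {Q} ec en eP eQ c≤ n≤ = ⇓-≡
    (bind⇓ (rep⇓ id (Carries c n) (rep⇓ id (Carries c n) (binary⇓ (binary⇓ eP eQ) (binary⇓ const⇓ const⇓))
        start round) (iter-carries (ticks numerator) start) round)
      (caseNat⇓ {f = λ _ → false} (monus⇓ (unary⇓ (unary⇓ var⇓)) (unary⇓ (unary⇓ var⇓)) final≤) const⇓
        (λ _ → const⇓)))
    (cong (λ s → atMost (proj₂ s)) (sym (iter-+ (ticks numerator) (ticks denominator) (compareStep c n) _)))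
    where
    self : ∀ x → x ≤ (x + x) + (x + x)
    self x = ≤-trans (m≤m+n x x) (m≤m+n (x + x) (x + x))
    start : Carries c n ((P , Q) , (0 , 0))
    start = carries z≤n z≤n
    iter-carries : ∀ k {s} → Carries c n s → Carries c n (iter k (compareStep c n) s)
    iter-carries zero    p = p
    iter-carries (suc k) p = iter-carries k (compareStep-carries c n _ p)
    final≤ : proj₂ (proj₂ (iter (ticks denominator) (compareStep c n)
      (iter (ticks numerator) (compareStep c n) ((P , Q) , (0 , 0))))) ≤ N
    final≤ = ≤-trans (Carries.right (iter-carries (ticks denominator) (iter-carries (ticks numerator) start)))
      (≤-trans (m≤m+n (n + n) (n + n)) n≤)
    round : ∀ s → Carries c n s → s ∷ γ ⊢ _ ⇓ compareStep c n s × Carries c n (compareStep c n s)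
    round s@((P , Q) , (a , b)) p@(carries a≤ b≤) =
      bind⇓ (absorb⇓ (weaken⇓ ec) (unary⇓ (unary⇓ var⇓)) (unary⇓ (unary⇓ var⇓)) (≤-trans (self c) c≤))
        (bind⇓ (absorb⇓ (weaken⇓ (weaken⇓ en)) (unary⇓ (unary⇓ var⇓)) (unary⇓ (unary⇓ var⇓)) (≤-trans (self n) n≤))
          (binary⇓ (binary⇓ (tail⇓ (unary⇓ (unary⇓ var⇓))) (tail⇓ (unary⇓ (unary⇓ var⇓))))
            (binary⇓ (unary⇓ (halves⇓ (monus⇓ var⇓ var⇓ b′≤) (≤-trans (m∸n≤m _ (absorb n P b)) a′≤)))
                     (unary⇓ (halves⇓ (monus⇓ var⇓ var⇓ a′≤) (≤-trans (m∸n≤m _ (absorb c Q a)) b′≤)))))) ,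
      compareStep-carries c n s p
      where
      a′≤ : absorb c Q a ≤ N
      a′≤ = ≤-trans (absorb-bound c Q a≤) c≤
      b′≤ : absorb n P b ≤ N
      b′≤ = ≤-trans (absorb-bound n P b≤) n≤

  record Scanning (cs : List ℕ) (s : List Bool × List Bool) : Set where
    constructor scanning
    field
      {index best} : ℕ
      state  : s ≡ (digits index , digits best)
      room   : index + length cs ≤ N
      small  : All (λ c → (c + c) + (c + c) ≤ N) cs

  answer⇓ : ∀ {Γ} {γ : Env Γ} {tn tP tQ tR n P Q R} → γ ⊢ tn ⇓ n → γ ⊢ tP ⇓ P → γ ⊢ tQ ⇓ Q →
    γ ⊢ tR ⇓ R → length R ≤ N → (n + n) + (n + n) ≤ N → All (λ c → (c + c) + (c + c) ≤ N) R →
    γ ⊢ answerT tn tP tQ tR ⇓ digits (last (λ c → compareDigits clockTotal c n P Q) R 0 0)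
  answer⇓ {n = n} {P} {Q} {R} en eP eQ eR len≤ n≤ small = ⇓-≡
    (unary⇓ (foldl⇓ Scanning {f = scan} eR (binary⇓ const⇓ const⇓) len≤
      (scanning {index = 0} {0} refl len≤ small) λ { {c} {cs} (scanning {i} {b} refl room (h ∷ hs)) →
        binary⇓ (inc⇓ (unary⇓ var⇓) (≤-trans (length-digits i) (≤-trans (m≤m+n i _) room)))
          (branch⇓ (compare⇓ var⇓ (weaken⇓ (weaken⇓ en)) (weaken⇓ (weaken⇓ eP)) (weaken⇓ (weaken⇓ eQ)) h n≤)
            (unary⇓ var⇓) (unary⇓ var⇓)) ,
        scanning {best = if ok c then i else b} (cong (digits (suc i) ,_) (choose {i} {b} (ok c)))
          (≤-trans (≤-reflexive (sym (+-suc i (length cs)))) room) hs }))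
    (cong proj₂ (scan-last R 0 0))
    where
    ok : ℕ → Bool
    ok c = compareDigits clockTotal c n P Q
    scan : List Bool × List Bool → ℕ → List Bool × List Bool
    scan (is , bs) c = inc is , (if ok c then is else bs)
    choose : ∀ {i b} x → (if x then digits i else digits b) ≡ digits (if x then i else b)
    choose false = refl
    choose true  = refl
    scan-last : ∀ cs i b → foldl scan (digits i , digits b) cs ≡ (digits (i + length cs) , digits (last ok cs i b))
    scan-last []       i b = cong (λ j → digits j , digits b) (sym (+-identityʳ i))
    scan-last (c ∷ cs) i b rewrite +-suc i (length cs) =
      trans (cong (λ bs → foldl scan (digits (suc i) , bs) cs) (choose {i} {b} (ok c)))
        (scan-last cs (suc i) (if ok c then i else b))

spine-list : ∀ {A} (xs : List (Val A)) → spine (enc (list A) xs) ≡ length xs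
spine-list []       = refl
spine-list (x ∷ xs) = cong suc (spine-list xs)

-- Correctness of the program on each instance

module Solve (x : Instance) where

  open Instance x renaming (order to n; forest to G; bound to t)

  instance
    t-positive : Positive t
    t-positive = bound-positive

  P Q : List Bool
  P = digits ℤ.∣ ↥ t ∣
  Q = digits (↧ₙ t)

  input : Val Input
  input = map (λ u → map (adj G u) (allFin n)) (allFin n) , P , Q

  encode-input : enc Input input ≡ encodeInstance x
  encode-input = cong₂ cons
    (cong encodeList (trans (sym (map-∘ (allFin n)))
      (map-cong (λ u → cong encodeList (sym (map-∘ (allFin n)))) (allFin n))))
    (cong₂ cons (sym (encode-digits ℤ.∣ ↥ t ∣)) (sym (encode-digits (↧ₙ t))))

  ticks : Clock → ℕ
  ticks = ticksOf (enc Input input)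

  open Semantics ticks
  open Derived ticks
  open Answer ticks
  open Matching G
  open Elimination G
  open Termination G isForest
  open Tables G

  rows≡ : ticks rows ≡ 4 + n
  rows≡ = cong (4 +_) (trans (spine-list {list bool} (proj₁ input))
    (trans (length-map _ (allFin n)) (length-tabulate id)))

  -- The part needed: 8 n n is four times the largest cost 2 n n and 4 n four times n, both for the
  -- carries, and 1 + 2 n is the length of a convolution of two tables.
  N≡ : N ≡ (8 * (n * n) + 4 * n + suc (2 * n)) + (n * (n * n) + 4 * (n * n) + 42 * n + 63)
  N≡ = trans (cong (λ m → m * (m * m)) rows≡) (cube n)
    where
    cube : ∀ n → (4 + n) * ((4 + n) * (4 + n)) ≡
      (8 * (n * n) + 4 * n + suc (2 * n)) + (n * (n * n) + 4 * (n * n) + 42 * n + 63)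
    cube = solve-∀

  big≤N : 8 * (n * n) + 4 * n + suc (2 * n) ≤ N
  big≤N = ≤-trans (m≤m+n _ _) (≤-reflexive (sym N≡))

  8n²≤N : 8 * (n * n) ≤ N
  8n²≤N = ≤-trans (≤-trans (m≤m+n _ (4 * n)) (m≤m+n _ (suc (2 * n)))) big≤N

  room : suc (2 * n) + 8 * (n * n) ≤ N
  room = ≤-trans (≤-trans (≤-reflexive (+-comm (suc (2 * n)) _))
    (+-monoˡ-≤ (suc (2 * n)) (m≤m+n (8 * (n * n)) (4 * n)))) big≤N

  4n≤N : (n + n) + (n + n) ≤ N
  4n≤N = ≤-trans (≤-trans (≤-reflexive (lemma n))
    (≤-trans (m≤n+m (4 * n) (8 * (n * n))) (m≤m+n _ (suc (2 * n))))) big≤N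
    where
    lemma : ∀ n → (n + n) + (n + n) ≡ 4 * n
    lemma = solve-∀

  n²≤N : n * n ≤ N
  n²≤N = ≤-trans (m≤m+n (n * n) _) 8n²≤N

  open Simulation G ticks

  final : State
  final = iter N step initialState

  trees : List (Rose (Fin n))
  trees = proj₂ final

  final-invariant : Invariant final
  final-invariant = iter-invariant N initialState initial-invariant

  trees-rooted : All (Rooted 0) trees
  trees-rooted = Invariant.done final-invariant

  trees-cover : ∀ f → weights f trees ≡ total f
  trees-cover f = trans (cong (λ ts → weights f ts + weights f trees) (sym (finished N n²≤N)))
    (Invariant.covers final-invariant f)

  R : List ℕ
  R = tableAll trees

  R-within : Within (suc n) (2 * n * n) R
  R-within = within-≤ (s≤s (≤-reflexive orders≡)) (≤-reflexive (cong (2 * n *_) orders≡))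
    (tableAll-within trees)
    where
    orders≡ : orders trees ≡ n
    orders≡ = trans (trees-cover _) (trans (total-const n 1) (*-identityʳ n))

  ok : ℕ → Bool
  ok c = compareDigits clockTotal c n P Q

  answer : ℕ
  answer = last ok R 0 0

  opaque
    unfolding mainT

    main⇓ : input ∷ [] ⊢ mainT ⇓ digits answer
    main⇓ = bind⇓
      (repeat⇓ render Invariant (bind⇓ (unary⇓ var⇓) (start⇓ room)) initial-invariant
        λ s I → step⇓ room s I , step-invariant s I)
      (answer⇓
        (⇓-≡ (length⇓ (unary⇓ var⇓) (≤-trans (≤-reflexive number-of-rows) (n≤N room))) number-of-rows)
        (unary⇓ (unary⇓ var⇓)) (unary⇓ (unary⇓ var⇓)) (unary⇓ var⇓)
        (≤-trans (Within.len R-within) (≤-trans (s≤s (m≤m+n n (n + 0))) (2n<N room))) 4n≤N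
        (All.map (λ {c} c≤ → ≤-trans (≤-trans (+-mono-≤ (+-mono-≤ c≤ c≤) (+-mono-≤ c≤ c≤))
          (≤-reflexive (lemma n))) 8n²≤N) (Within.ent R-within)))
      where
      number-of-rows : length (proj₁ input) ≡ n
      number-of-rows = trans (length-map _ (allFin n)) (length-tabulate id)
      lemma : ∀ n → (2 * n * n + 2 * n * n) + (2 * n * n + 2 * n * n) ≡ 8 * (n * n)
      lemma = solve-∀

  ok-correct : ∀ c → Affordable {n} t c ⇔ ok c ≡ true
  ok-correct c = subst₂ (λ p q → c * q ≤ n * p ⇔ ok c ≡ true)
    (value-digits ℤ.∣ ↥ t ∣) (value-digits (↧ₙ t))
    (compareDigits-correct c n P Q
      (≤-trans (≤-reflexive (sym (spine-list {bool} P))) (m≤m+n _ (ticks denominator)))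
      (≤-trans (≤-reflexive (sym (spine-list {bool} Q))) (m≤n+m _ (ticks numerator))))

  answer-max : ∀ {k c} → MatchesAll trees k c → Affordable {n} t c → k ≤ answer
  answer-max M cheap with c , h , le ← tableAll-complete M =
    last-max ok R 0 0 z≤n h (Equivalence.to (ok-correct c) (affordable-≤ t le cheap))

  answer-attained : ∃[ c ] MatchesAll trees answer c × Affordable {n} t c
  answer-attained with last-attained ok R 0 0
  ... | inj₂ (k , c , h , eq , answer≡) = c ,
    subst (λ m → MatchesAll trees m c) (sym answer≡) (tableAll-sound trees h) ,
    Equivalence.from (ok-correct c) eq
  -- The default 0 of `last` is attained as well, since the empty matching costs nothing.
  ... | inj₁ answer≡0 with c , h , c≤0 ← tableAll-zero trees =
    c , subst (λ m → MatchesAll trees m c) (sym answer≡0) (tableAll-sound trees h) ,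
    affordable-≤ t c≤0 z≤n

  answer-correct : IsLdyn G t answer
  answer-correct = matching-maximum⇒Ldyn G t trees-rooted trees-cover answer-attained answer-max

  main-value : enc (list bool) (⟦ mainT ⟧ (input ∷ [])) ≡ encodeℕ answer
  main-value = trans (cong (enc (list bool)) (⇓-elim main⇓)) (sym (encode-digits answer))

theorem3 : PolyTimeComputable encodeInstance encodeℕ IsLdynOf
theorem3 = term⇒polyTime mainT Solve.input Solve.answer Solve.encode-input
  Solve.main-value
  Solve.answer-correct
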